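{- Let $k$ be an odd positive integer. Then for every $n\in\mathbb{Z}_{\ge 0}$, $$\sum_{i=1}^n i^{\frac{k}{2}} = C_k + \sqrt{n}\,P_k(n) + \sum_{\substack{3\le i\le k+2\\ i\text{ odd}}} A^k_i\,\tau(n,i),$$ where (1) $P_k(n)$ is the polynomial in $n$ $$P_k(n) := \frac{1}{\frac{k}{2}+1}\sum_{i=0}^{\frac{k+1}{2}} \binom{\frac{k}{2}+1}{i} (-1)^i B_i\, n^{\frac{k+1}{2}-i};$$ (2) $A^k_i$, for $i\in\{1,3,5,\dots,k+2\}$, are the constants $$A^k_i := \frac{1}{(\frac{k}{2}+1)2^{i-1}}\sum_{j=0}^{\frac{k-i}{2}+1}\binom{2j+i}{j}\frac{1}{4^j}\binom{\frac{k}{2}+1}{\frac{k-i}{2}+1-j}B_{\frac{k-i}{2}+1-j};$$ (3) $C_k$ is the constant $$C_k := 1 - P_k(1) - \sum_{\substack{3\le i\le k+2\\ i\text{ odd}}} A^k_i\,\tau(1,i).$$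
   Context: $\mathbb{Z}_{\ge 0}$ is the set of nonnegative integers. $B_i$ denotes the $i$-th Bernoulli number, with the convention $B_1=-\frac12$. For real $\alpha$ and integer $i\ge 0$, $\binom{\alpha}{i}=\frac{\alpha(\alpha-1)\cdots(\alpha-i+1)}{i!}$ is the generalized binomial coefficient. For $n,m\in\mathbb{Z}_{\ge0}$ with $m\ge 3$, Ramanujan's function is the convergent series $$\tau(n,m):=\sum_{\nu=0}^{\infty} \frac{1}{(\sqrt{n+\nu}+\sqrt{n+\nu+1})^m}.$$ -}

module Defs where

open import Algebra.Bundles using (Monoid; CommutativeRing)
open import Data.Empty using (⊥-elim)
open import Data.Fin.Base using (toℕ)
import Data.Integer.Base as ℤ
import Data.Integer.Properties as ℤₚ
open import Data.List.Base using ([]; _∷_)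
import Data.Nat.Base as ℕ
open import Data.Nat.Base using (ℕ; zero; suc)
import Data.Nat.Combinatorics as ℕC
import Data.Nat.Properties as ℕₚ
open import Data.Product.Base using (∃-syntax; _×_; _,_; proj₁; proj₂)
import Data.Rational.Base as ℚ
open import Data.Rational.Base using (ℚ; mkℚ; 0ℚ; 1ℚ; ½)
import Data.Rational.Properties as ℚₚ
import Data.Rational.Unnormalised.Base as ℚᵘ
import Data.Rational.Unnormalised.Properties as ℚᵘₚ
open import Data.Sum.Base using (inj₁; inj₂)
open import Level using (0ℓ)
open import Relation.Binary.PropositionalEquality
  using (_≡_; _≢_; refl; sym; trans; cong; cong₂; subst; subst₂)
open import Relation.Nullary using (yes; no)
open import Relation.Nullary.Decidable using (dec⇒maybe)
open import Tactic.RingSolver using (solve)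
open import Tactic.RingSolver.Core.AlmostCommutativeRing
  using (AlmostCommutativeRing; fromCommutativeRing)

ℚ-acr : AlmostCommutativeRing 0ℓ 0ℓ
ℚ-acr = fromCommutativeRing ℚₚ.+-*-commutativeRing (λ x → dec⇒maybe (0ℚ ℚₚ.≟ x))

module ℚ-Lemmas where
  open import Data.Rational.Base

  ≤-by : ∀ {a b e} → e ≡ b - a → 0ℚ ≤ e → a ≤ b
  ≤-by {a} {b} {e} eq 0≤e = subst₂ _≤_ (ℚₚ.+-identityˡ a) p (ℚₚ.+-monoˡ-≤ a 0≤e)
    where
    p : e + a ≡ b
    p = trans (cong (_+ a) eq) (solve (a ∷ b ∷ []) ℚ-acr)

  <-by : ∀ {a b e} → e ≡ b - a → 0ℚ < e → a < b
  <-by {a} {b} {e} eq 0<e = subst₂ _<_ (ℚₚ.+-identityˡ a) p (ℚₚ.+-monoˡ-< a 0<e)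
    where
    p : e + a ≡ b
    p = trans (cong (_+ a) eq) (solve (a ∷ b ∷ []) ℚ-acr)

  ≤⇒0≤ : ∀ {a b} → a ≤ b → 0ℚ ≤ b - a
  ≤⇒0≤ {a} {b} a≤b = subst (_≤ b - a) (ℚₚ.+-inverseʳ a) (ℚₚ.+-monoˡ-≤ (- a) a≤b)

  <⇒0< : ∀ {a b} → a < b → 0ℚ < b - a
  <⇒0< {a} {b} a<b = subst (_< b - a) (ℚₚ.+-inverseʳ a) (ℚₚ.+-monoˡ-< (- a) a<b)

  0≤+ : ∀ {a b} → 0ℚ ≤ a → 0ℚ ≤ b → 0ℚ ≤ a + b
  0≤+ {a} {b} p q = subst (_≤ a + b) (ℚₚ.+-identityˡ 0ℚ) (ℚₚ.+-mono-≤ p q)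

  0<+ : ∀ {a b} → 0ℚ < a → 0ℚ ≤ b → 0ℚ < a + b
  0<+ {a} {b} p q = subst (_< a + b) (ℚₚ.+-identityˡ 0ℚ) (ℚₚ.+-mono-<-≤ p q)

  0≤* : ∀ {a b} → 0ℚ ≤ a → 0ℚ ≤ b → 0ℚ ≤ a * b
  0≤* {a} {b} p q = subst (_≤ a * b) (ℚₚ.*-zeroʳ a)
    (ℚₚ.*-monoˡ-≤-nonNeg a {{nonNegative p}} q)

  0<* : ∀ {a b} → 0ℚ < a → 0ℚ < b → 0ℚ < a * b
  0<* {a} {b} p q = subst (_< a * b) (ℚₚ.*-zeroʳ a)
    (ℚₚ.*-monoʳ-<-pos a {{positive p}} q)

  0<1 : 0ℚ < 1ℚ
  0<1 = ℚₚ.positive⁻¹ 1ℚ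

  0<½ : 0ℚ < ½
  0<½ = ℚₚ.positive⁻¹ ½

  ½+½ : ∀ ε → ½ * ε + ½ * ε ≡ ε
  ½+½ ε = solve (ε ∷ []) ℚ-acr

  0<½* : ∀ {ε} → 0ℚ < ε → 0ℚ < ½ * ε
  0<½* = 0<* 0<½

  +-mono-<½ : ∀ {a b} ε → a < ½ * ε → b < ½ * ε → a + b < ε
  +-mono-<½ ε p q = subst (_ <_) (½+½ ε) (ℚₚ.+-mono-< p q)

  ∣∣≤-resp : ∀ {a b c} → a ≡ b → ∣ a ∣ ≤ c → ∣ b ∣ ≤ c
  ∣∣≤-resp refl p = p

  ≤∣∣ : ∀ x → x ≤ ∣ x ∣
  ≤∣∣ x with ℚₚ.≤-total 0ℚ x
  ... | inj₁ 0≤x = ℚₚ.≤-reflexive (sym (ℚₚ.0≤p⇒∣p∣≡p 0≤x))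
  ... | inj₂ x≤0 = ℚₚ.≤-trans x≤0 (ℚₚ.0≤∣p∣ x)

  -≤∣∣ : ∀ x → - x ≤ ∣ x ∣
  -≤∣∣ x = subst (- x ≤_) (ℚₚ.∣-p∣≡∣p∣ x) (≤∣∣ (- x))

  ∣∣≤ : ∀ {x b} → x ≤ b → - x ≤ b → ∣ x ∣ ≤ b
  ∣∣≤ {x} p q with ℚₚ.∣p∣≡p∨∣p∣≡-p x
  ... | inj₁ e = subst (_≤ _) (sym e) p
  ... | inj₂ e = subst (_≤ _) (sym e) q

  ∣∣< : ∀ {x b} → x < b → - x < b → ∣ x ∣ < b
  ∣∣< {x} p q with ℚₚ.∣p∣≡p∨∣p∣≡-p x
  ... | inj₁ e = subst (_< _) (sym e) p
  ... | inj₂ e = subst (_< _) (sym e) q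

  dist-sym : ∀ a b → ∣ a - b ∣ ≡ ∣ b - a ∣
  dist-sym a b = trans (sym (ℚₚ.∣-p∣≡∣p∣ (a - b))) (cong ∣_∣ p)
    where
    p : - (a - b) ≡ b - a
    p = solve (a ∷ b ∷ []) ℚ-acr

  triangle : ∀ a b c → ∣ a - c ∣ ≤ ∣ a - b ∣ + ∣ b - c ∣
  triangle a b c = ∣∣≤-resp p (ℚₚ.∣p+q∣≤∣p∣+∣q∣ (a - b) (b - c))
    where
    p : (a - b) + (b - c) ≡ a - c
    p = solve (a ∷ b ∷ c ∷ []) ℚ-acr

  triangle½ : ∀ a b c ε → ∣ a - b ∣ < ½ * ε → ∣ b - c ∣ < ½ * ε → ∣ a - c ∣ < ε
  triangle½ a b c ε p q = ℚₚ.≤-<-trans (triangle a b c) (+-mono-<½ ε p q)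

  -- A total inverse, with the junk value 0 at 0.
  inv : ℚ → ℚ
  inv q with q ℚₚ.≟ 0ℚ
  ... | yes _   = 0ℚ
  ... | no  q≢0 = (1/ q) {{≢-nonZero q≢0}}

  *-inv : ∀ {q} → q ≢ 0ℚ → q * inv q ≡ 1ℚ
  *-inv {q} q≢0 with q ℚₚ.≟ 0ℚ
  ... | yes q≡0 = ⊥-elim (q≢0 q≡0)
  ... | no  r   = ℚₚ.*-inverseʳ q {{≢-nonZero r}}

  0<⇒≢0 : ∀ {q} → 0ℚ < q → q ≢ 0ℚ
  0<⇒≢0 0<q refl = ℚₚ.<-irrefl refl 0<q

  *-inv⁺ : ∀ {q} → 0ℚ < q → q * inv q ≡ 1ℚ
  *-inv⁺ 0<q = *-inv (0<⇒≢0 0<q)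

  0<inv : ∀ {q} → 0ℚ < q → 0ℚ < inv q
  0<inv {q} 0<q = ℚₚ.*-cancelˡ-<-nonNeg q {{nonNegative (ℚₚ.<⇒≤ 0<q)}}
    (subst₂ _<_ (sym (ℚₚ.*-zeroʳ q)) (sym (*-inv⁺ 0<q)) 0<1)

  inv-antimono : ∀ {p q} → 0ℚ < p → p ≤ q → inv q ≤ inv p
  inv-antimono {p} {q} 0<p p≤q = ≤-by eq (0≤* (ℚₚ.<⇒≤ (0<* (0<inv 0<p) (0<inv 0<q))) (≤⇒0≤ p≤q))
    where
    0<q : 0ℚ < q
    0<q = ℚₚ.<-≤-trans 0<p p≤q
    i = inv p
    j = inv q
    rearrange : ∀ i j → (i * j) * (q - p) ≡ (q * j) * i - (p * i) * j
    rearrange i j = solve (i ∷ j ∷ p ∷ q ∷ []) ℚ-acr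
    eq : (i * j) * (q - p) ≡ i - j
    eq = trans (rearrange i j)
      (cong₂ (λ s t → s - t)
        (trans (cong (_* i) (*-inv⁺ 0<q)) (ℚₚ.*-identityˡ i))
        (trans (cong (_* j) (*-inv⁺ 0<p)) (ℚₚ.*-identityˡ j)))

  -- Multiplication is uniformly continuous on bounded sets.
  *-close : ∀ K L ε → 0ℚ < K → 0ℚ < L → 0ℚ < ε →
    ∃[ δ ] 0ℚ < δ × (∀ a b c d → ∣ a ∣ ≤ K → ∣ d ∣ ≤ L →
      ∣ a - c ∣ < δ → ∣ b - d ∣ < δ → ∣ a * b - c * d ∣ < ε)
  *-close K L ε 0<K 0<L 0<ε = δ , 0<* 0<ε (0<inv 0<K+L) , bound
    where
    0<K+L : 0ℚ < K + L
    0<K+L = 0<+ 0<K (ℚₚ.<⇒≤ 0<L)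
    i = inv (K + L)
    δ = ε * i
    eq₁ : ∀ i → K * (ε * i) + L * (ε * i) ≡ ε * ((K + L) * i)
    eq₁ i = solve (K ∷ L ∷ ε ∷ i ∷ []) ℚ-acr
    eq : K * δ + L * δ ≡ ε
    eq = trans (eq₁ i) (trans (cong (ε *_) (*-inv⁺ 0<K+L)) (ℚₚ.*-identityʳ ε))
    one : ∀ {x y M} → 0ℚ < M → ∣ x ∣ ≤ M → ∣ y ∣ < δ → ∣ x * y ∣ < M * δ
    one {x} {y} {M} 0<M p q = subst (_< M * δ) (sym (ℚₚ.∣p*q∣≡∣p∣*∣q∣ x y))
      (ℚₚ.≤-<-trans (ℚₚ.*-monoʳ-≤-nonNeg ∣ y ∣ {{ℚₚ.∣-∣-nonNeg y}} p)
        (ℚₚ.*-monoʳ-<-pos M {{positive 0<M}} q))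
    bound : ∀ a b c d → ∣ a ∣ ≤ K → ∣ d ∣ ≤ L →
      ∣ a - c ∣ < δ → ∣ b - d ∣ < δ → ∣ a * b - c * d ∣ < ε
    bound a b c d p q r s = ℚₚ.≤-<-trans
      (∣∣≤-resp split (ℚₚ.∣p+q∣≤∣p∣+∣q∣ (a * (b - d)) (d * (a - c))))
      (subst (_ <_) eq (ℚₚ.+-mono-< (one 0<K p s) (one 0<L q r)))
      where
      split : a * (b - d) + d * (a - c) ≡ a * b - c * d
      split = solve (a ∷ b ∷ c ∷ d ∷ []) ℚ-acr

open ℚ-Lemmas

Eventually : (ℕ → Set) → Set
Eventually P = ∃[ N ] (∀ n → N ℕ.≤ n → P n)

always : ∀ {P : ℕ → Set} → (∀ n → P n) → Eventually P
always p = 0 , λ n _ → p n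

ev-map : ∀ {P Q : ℕ → Set} → (∀ n → P n → Q n) → Eventually P → Eventually Q
ev-map f (N , p) = N , λ n le → f n (p n le)

ev-map₂ : ∀ {P Q R : ℕ → Set} → (∀ n → P n → Q n → R n) →
  Eventually P → Eventually Q → Eventually R
ev-map₂ f (N , p) (M , q) = N ℕ.⊔ M , λ n le →
  f n (p n (ℕₚ.≤-trans (ℕₚ.m≤m⊔n N M) le)) (q n (ℕₚ.≤-trans (ℕₚ.m≤n⊔m N M) le))

ev-map₃ : ∀ {P Q R S : ℕ → Set} → (∀ n → P n → Q n → R n → S n) →
  Eventually P → Eventually Q → Eventually R → Eventually S
ev-map₃ f p q r = ev-map₂ (λ n pq r → f n (proj₁ pq) (proj₂ pq) r) (ev-map₂ (λ _ → _,_) p q) r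

IsCauchy : (ℕ → ℚ) → Set
IsCauchy s = ∀ ε → 0ℚ ℚ.< ε →
  ∃[ N ] (∀ m n → N ℕ.≤ m → N ℕ.≤ n → ℚ.∣ s m ℚ.- s n ∣ ℚ.< ε)

-- Equality of reals is _≃_ below, not _≡_.
record ℝ : Set where
  no-eta-equality
  constructor real
  field
    seq    : ℕ → ℚ
    cauchy : IsCauchy seq

open ℝ public

infix 4 _≃_ _<_ _≤_

record _≃_ (x y : ℝ) : Set where
  constructor mk≃
  field
    close : ∀ ε → 0ℚ ℚ.< ε → Eventually (λ n → ℚ.∣ seq x n ℚ.- seq y n ∣ ℚ.< ε)

record _<_ (x y : ℝ) : Set where
  constructor mk<
  field
    gap       : ℚ
    gap>0     : 0ℚ ℚ.< gap
    separated : Eventually (λ n → seq x n ℚ.+ gap ℚ.≤ seq y n)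

record _≤_ (x y : ℝ) : Set where
  constructor mk≤
  field
    below : ∀ ε → 0ℚ ℚ.< ε → Eventually (λ n → seq x n ℚ.≤ seq y n ℚ.+ ε)

open _≃_ public
open _<_ public
open _≤_ public

bounded : ∀ x → ∃[ K ] 0ℚ ℚ.< K × Eventually (λ n → ℚ.∣ seq x n ∣ ℚ.≤ K)
bounded x with cauchy x 1ℚ 0<1
... | N , c = K , 0<K , N , λ n N≤n → ℚₚ.≤-trans (tri n)
        (ℚₚ.+-monoˡ-≤ _ (ℚₚ.<⇒≤ (c n N N≤n ℕₚ.≤-refl)))
  where
  K = 1ℚ ℚ.+ ℚ.∣ seq x N ∣
  0<K = 0<+ 0<1 (ℚₚ.0≤∣p∣ (seq x N))
  tri : ∀ n → ℚ.∣ seq x n ∣ ℚ.≤ ℚ.∣ seq x n ℚ.- seq x N ∣ ℚ.+ ℚ.∣ seq x N ∣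
  tri n = ∣∣≤-resp (p (seq x n) (seq x N))
    (ℚₚ.∣p+q∣≤∣p∣+∣q∣ (seq x n ℚ.- seq x N) (seq x N))
    where
    p : ∀ a b → (a ℚ.- b) ℚ.+ b ≡ a
    p a b = solve (a ∷ b ∷ []) ℚ-acr

opaque
  const-cauchy : ∀ q → IsCauchy (λ _ → q)
  const-cauchy q ε 0<ε = 0 , λ _ _ _ _ →
    subst (λ t → ℚ.∣ t ∣ ℚ.< ε) (sym (ℚₚ.+-inverseʳ q)) 0<ε

ι : ℚ → ℝ
ι q = real (λ _ → q) (const-cauchy q)

0ℝ 1ℝ : ℝ
0ℝ = ι 0ℚ
1ℝ = ι 1ℚ

infixl 6 _+_ _-_
infixl 7 _*_
infix  8 -_

private
  +-close : ∀ a b c d ε → ℚ.∣ a ℚ.- c ∣ ℚ.< ½ ℚ.* ε → ℚ.∣ b ℚ.- d ∣ ℚ.< ½ ℚ.* ε →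
    ℚ.∣ (a ℚ.+ b) ℚ.- (c ℚ.+ d) ∣ ℚ.< ε
  +-close a b c d ε p q = ℚₚ.≤-<-trans
    (∣∣≤-resp e (ℚₚ.∣p+q∣≤∣p∣+∣q∣ (a ℚ.- c) (b ℚ.- d)))
    (+-mono-<½ ε p q)
    where
    e : (a ℚ.- c) ℚ.+ (b ℚ.- d) ≡ (a ℚ.+ b) ℚ.- (c ℚ.+ d)
    e = solve (a ∷ b ∷ c ∷ d ∷ []) ℚ-acr

  neg-dist : ∀ a b → ℚ.∣ a ℚ.- b ∣ ≡ ℚ.∣ ℚ.- a ℚ.- ℚ.- b ∣
  neg-dist a b = trans (sym (ℚₚ.∣-p∣≡∣p∣ (a ℚ.- b))) (cong ℚ.∣_∣ e)
    where
    e : ℚ.- (a ℚ.- b) ≡ ℚ.- a ℚ.- ℚ.- b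
    e = solve (a ∷ b ∷ []) ℚ-acr

opaque
  +-cauchy : ∀ x y → IsCauchy (λ n → seq x n ℚ.+ seq y n)
  +-cauchy x y ε 0<ε with cauchy x (½ ℚ.* ε) (0<½* 0<ε) | cauchy y (½ ℚ.* ε) (0<½* 0<ε)
  ... | N , p | M , q = N ℕ.⊔ M , λ m n N≤m N≤n →
    +-close (seq x m) (seq y m) (seq x n) (seq y n) ε
      (p m n (ℕₚ.≤-trans (ℕₚ.m≤m⊔n N M) N≤m) (ℕₚ.≤-trans (ℕₚ.m≤m⊔n N M) N≤n))
      (q m n (ℕₚ.≤-trans (ℕₚ.m≤n⊔m N M) N≤m) (ℕₚ.≤-trans (ℕₚ.m≤n⊔m N M) N≤n))

  neg-cauchy : ∀ x → IsCauchy (λ n → ℚ.- seq x n)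
  neg-cauchy x ε 0<ε = proj₁ (cauchy x ε 0<ε) , λ m n N≤m N≤n →
    subst (ℚ._< ε) (neg-dist (seq x m) (seq x n)) (proj₂ (cauchy x ε 0<ε) m n N≤m N≤n)

  *-cauchy : ∀ x y → IsCauchy (λ n → seq x n ℚ.* seq y n)
  *-cauchy x y ε 0<ε =
    let K , 0<K , Nx , bx = bounded x
        L , 0<L , Ny , by = bounded y
        δ , 0<δ , cl      = *-close K L ε 0<K 0<L 0<ε
        N , p             = cauchy x δ 0<δ
        M , q             = cauchy y δ 0<δ
        B = Nx ℕ.⊔ Ny
        C = N ℕ.⊔ M
        l₁ = λ {m} → ℕₚ.≤-trans {k = m} (ℕₚ.≤-trans (ℕₚ.m≤m⊔n Nx Ny) (ℕₚ.m≤m⊔n B C))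
        l₂ = λ {m} → ℕₚ.≤-trans {k = m} (ℕₚ.≤-trans (ℕₚ.m≤n⊔m Nx Ny) (ℕₚ.m≤m⊔n B C))
        l₃ = λ {m} → ℕₚ.≤-trans {k = m} (ℕₚ.≤-trans (ℕₚ.m≤m⊔n N M) (ℕₚ.m≤n⊔m B C))
        l₄ = λ {m} → ℕₚ.≤-trans {k = m} (ℕₚ.≤-trans (ℕₚ.m≤n⊔m N M) (ℕₚ.m≤n⊔m B C))
    in B ℕ.⊔ C , λ m n B≤m B≤n →
      cl (seq x m) (seq y m) (seq x n) (seq y n)
        (bx m (l₁ B≤m)) (by n (l₂ B≤n)) (p m n (l₃ B≤m) (l₃ B≤n)) (q m n (l₄ B≤m) (l₄ B≤n))

_+_ : ℝ → ℝ → ℝ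
x + y = real (λ n → seq x n ℚ.+ seq y n) (+-cauchy x y)

-_ : ℝ → ℝ
- x = real (λ n → ℚ.- seq x n) (neg-cauchy x)

_-_ : ℝ → ℝ → ℝ
x - y = x + (- y)

_*_ : ℝ → ℝ → ℝ
x * y = real (λ n → seq x n ℚ.* seq y n) (*-cauchy x y)

pointwise : ∀ {x y} → (∀ n → seq x n ≡ seq y n) → x ≃ y
pointwise {x} {y} e = mk≃ λ ε 0<ε → always λ n →
  subst (λ t → ℚ.∣ t ∣ ℚ.< ε)
    (sym (trans (cong (ℚ._- seq y n) (e n)) (ℚₚ.+-inverseʳ (seq y n)))) 0<ε

≃-refl : ∀ {x} → x ≃ x
≃-refl = pointwise λ _ → refl

≃-sym : ∀ {x y} → x ≃ y → y ≃ x
≃-sym {x} {y} p = mk≃ λ ε 0<ε →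
  ev-map (λ n → subst (ℚ._< ε) (dist-sym (seq x n) (seq y n))) (close p ε 0<ε)

≃-trans : ∀ {x y z} → x ≃ y → y ≃ z → x ≃ z
≃-trans {x} {y} {z} p q = mk≃ λ ε 0<ε →
  ev-map₂ (λ n → triangle½ (seq x n) (seq y n) (seq z n) ε)
    (close p (½ ℚ.* ε) (0<½* 0<ε)) (close q (½ ℚ.* ε) (0<½* 0<ε))

+-cong : ∀ {x y u v} → x ≃ y → u ≃ v → x + u ≃ y + v
+-cong {x} {y} {u} {v} p q = mk≃ λ ε 0<ε →
  ev-map₂ (λ n → +-close (seq x n) (seq u n) (seq y n) (seq v n) ε)
    (close p (½ ℚ.* ε) (0<½* 0<ε)) (close q (½ ℚ.* ε) (0<½* 0<ε))

-‿cong : ∀ {x y} → x ≃ y → - x ≃ - y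
-‿cong {x} {y} p = mk≃ λ ε 0<ε →
  ev-map (λ n → subst (ℚ._< ε) (neg-dist (seq x n) (seq y n))) (close p ε 0<ε)

*-cong : ∀ {x y u v} → x ≃ y → u ≃ v → x * u ≃ y * v
*-cong {x} {y} {u} {v} p q = mk≃ λ ε 0<ε →
  let K , 0<K , bx = bounded x
      L , 0<L , bv = bounded v
      δ , 0<δ , cl = *-close K L ε 0<K 0<L 0<ε
  in ev-map₂ (λ n b c → cl (seq x n) (seq u n) (seq y n) (seq v n)
                         (proj₁ b) (proj₂ b) (proj₁ c) (proj₂ c))
       (ev-map₂ (λ _ → _,_) bx bv)
       (ev-map₂ (λ _ → _,_) (close p δ 0<δ) (close q δ 0<δ))

ℝ-commutativeRing : CommutativeRing 0ℓ 0ℓ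
ℝ-commutativeRing = record
  { Carrier = ℝ ; _≈_ = _≃_ ; _+_ = _+_ ; _*_ = _*_ ; -_ = -_ ; 0# = 0ℝ ; 1# = 1ℝ
  ; isCommutativeRing = record
    { isRing = record
      { +-isAbelianGroup = record
        { isGroup = record
          { isMonoid = record
            { isSemigroup = record
              { isMagma = record
                { isEquivalence = record { refl = ≃-refl ; sym = ≃-sym ; trans = ≃-trans }
                ; ∙-cong = +-cong }
              ; assoc = λ x y z → pointwise λ n → ℚₚ.+-assoc (seq x n) (seq y n) (seq z n) }
            ; identity = (λ x → pointwise λ n → ℚₚ.+-identityˡ (seq x n))
                       , (λ x → pointwise λ n → ℚₚ.+-identityʳ (seq x n)) }
          ; inverse = (λ x → pointwise λ n → ℚₚ.+-inverseˡ (seq x n))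
                    , (λ x → pointwise λ n → ℚₚ.+-inverseʳ (seq x n))
          ; ⁻¹-cong = -‿cong }
        ; comm = λ x y → pointwise λ n → ℚₚ.+-comm (seq x n) (seq y n) }
      ; *-cong = *-cong
      ; *-assoc = λ x y z → pointwise λ n → ℚₚ.*-assoc (seq x n) (seq y n) (seq z n)
      ; *-identity = (λ x → pointwise λ n → ℚₚ.*-identityˡ (seq x n))
                   , (λ x → pointwise λ n → ℚₚ.*-identityʳ (seq x n))
      ; distrib = (λ x y z → pointwise λ n → ℚₚ.*-distribˡ-+ (seq x n) (seq y n) (seq z n))
                , (λ x y z → pointwise λ n → ℚₚ.*-distribʳ-+ (seq x n) (seq y n) (seq z n)) }
    ; *-comm = λ x y → pointwise λ n → ℚₚ.*-comm (seq x n) (seq y n) } }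

module ℝR = CommutativeRing ℝ-commutativeRing

ι-+ : ∀ p q → ι (p ℚ.+ q) ≃ ι p + ι q
ι-+ p q = pointwise λ _ → refl

ι-* : ∀ p q → ι (p ℚ.* q) ≃ ι p * ι q
ι-* p q = pointwise λ _ → refl

≤-reflexive : ∀ {x y} → x ≃ y → x ≤ y
≤-reflexive {x} {y} p = mk≤ λ ε 0<ε → ev-map (λ n q →
  ≤-by (e (seq x n) (seq y n) ε)
    (≤⇒0≤ (ℚₚ.≤-trans (≤∣∣ (seq x n ℚ.- seq y n)) (ℚₚ.<⇒≤ q)))) (close p ε 0<ε)
  where
  e : ∀ a b ε → ε ℚ.- (a ℚ.- b) ≡ (b ℚ.+ ε) ℚ.- a
  e a b ε = solve (a ∷ b ∷ ε ∷ []) ℚ-acr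

≤-refl : ∀ {x} → x ≤ x
≤-refl = ≤-reflexive ≃-refl

≤-trans : ∀ {x y z} → x ≤ y → y ≤ z → x ≤ z
≤-trans {x} {y} {z} p q = mk≤ λ ε 0<ε → ev-map₂ (λ n a b →
  ℚₚ.≤-trans a (subst (_ ℚ.≤_) (e (seq z n) ε) (ℚₚ.+-monoˡ-≤ (½ ℚ.* ε) b)))
  (below p (½ ℚ.* ε) (0<½* 0<ε)) (below q (½ ℚ.* ε) (0<½* 0<ε))
  where
  e : ∀ a ε → (a ℚ.+ ½ ℚ.* ε) ℚ.+ ½ ℚ.* ε ≡ a ℚ.+ ε
  e a ε = solve (a ∷ ε ∷ []) ℚ-acr

≤-resp : ∀ {x y u v} → x ≃ u → y ≃ v → x ≤ y → u ≤ v
≤-resp p q r = ≤-trans (≤-reflexive (≃-sym p)) (≤-trans r (≤-reflexive q))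

+-mono-≤ : ∀ {x y u v} → x ≤ y → u ≤ v → x + u ≤ y + v
+-mono-≤ {x} {y} {u} {v} p q = mk≤ λ ε 0<ε → ev-map₂ (λ n a b →
  subst (_ ℚ.≤_) (e (seq y n) (seq v n) ε) (ℚₚ.+-mono-≤ a b))
  (below p (½ ℚ.* ε) (0<½* 0<ε)) (below q (½ ℚ.* ε) (0<½* 0<ε))
  where
  e : ∀ a b ε → (a ℚ.+ ½ ℚ.* ε) ℚ.+ (b ℚ.+ ½ ℚ.* ε) ≡ (a ℚ.+ b) ℚ.+ ε
  e a b ε = solve (a ∷ b ∷ ε ∷ []) ℚ-acr

ι-mono-≤ : ∀ {p q} → p ℚ.≤ q → ι p ≤ ι q
ι-mono-≤ {p} {q} p≤q = mk≤ λ ε 0<ε → always λ _ → ℚₚ.≤-trans p≤q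
  (subst (ℚ._≤ q ℚ.+ ε) (ℚₚ.+-identityʳ q) (ℚₚ.+-monoʳ-≤ q (ℚₚ.<⇒≤ 0<ε)))

x≤y⇒0≤y-x : ∀ {x y} → x ≤ y → 0ℝ ≤ y - x
x≤y⇒0≤y-x {x} {y} p = ≤-resp (ℝR.-‿inverseʳ x) ≃-refl (+-mono-≤ p (≤-refl {x = - x}))

0≤y-x⇒x≤y : ∀ {x y} → 0ℝ ≤ y - x → x ≤ y
0≤y-x⇒x≤y {x} {y} p = ≤-resp (ℝR.+-identityˡ x) e (+-mono-≤ p (≤-refl {x = x}))
  where
  e₀ : ∀ a b → (b ℚ.- a) ℚ.+ a ≡ b
  e₀ a b = solve (a ∷ b ∷ []) ℚ-acr
  e : (y - x) + x ≃ y
  e = pointwise λ n → e₀ (seq x n) (seq y n)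

≤-from : ∀ {x y e} → e ≃ y - x → 0ℝ ≤ e → x ≤ y
≤-from p q = 0≤y-x⇒x≤y (≤-trans q (≤-reflexive p))

0≤-+ : ∀ {x y} → 0ℝ ≤ x → 0ℝ ≤ y → 0ℝ ≤ x + y
0≤-+ p q = ≤-trans (≤-reflexive (≃-sym (ℝR.+-identityˡ 0ℝ))) (+-mono-≤ p q)

private
  -- If a , b are nonnegative up to δ, then a * b is nonnegative up to δ(K+L).
  product-bound : ∀ a b δ K L → 0ℚ ℚ.≤ δ → 0ℚ ℚ.≤ a ℚ.+ δ → 0ℚ ℚ.≤ b ℚ.+ δ →
    ℚ.∣ a ∣ ℚ.≤ K → ℚ.∣ b ∣ ℚ.≤ L → 0ℚ ℚ.≤ a ℚ.* b ℚ.+ (K ℚ.+ L) ℚ.* δ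
  product-bound a b δ K L 0≤δ p q r s with ℚₚ.≤-total 0ℚ a | ℚₚ.≤-total 0ℚ b
  ... | inj₁ 0≤a | _ = subst (0ℚ ℚ.≤_) e
          (0≤+ (0≤+ (0≤* 0≤a q) (0≤* K-a 0≤δ)) (0≤* 0≤L 0≤δ))
    where
    K-a = ≤⇒0≤ (ℚₚ.≤-trans (≤∣∣ a) r)
    0≤L = ℚₚ.≤-trans (ℚₚ.0≤∣p∣ b) s
    e : (a ℚ.* (b ℚ.+ δ) ℚ.+ (K ℚ.- a) ℚ.* δ) ℚ.+ L ℚ.* δ ≡ a ℚ.* b ℚ.+ (K ℚ.+ L) ℚ.* δ
    e = solve (a ∷ b ∷ δ ∷ K ∷ L ∷ []) ℚ-acr
  ... | inj₂ a≤0 | inj₁ 0≤b = subst (0ℚ ℚ.≤_) e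
          (0≤+ (0≤+ (0≤* 0≤b p) (0≤* L-b 0≤δ)) (0≤* 0≤K 0≤δ))
    where
    L-b = ≤⇒0≤ (ℚₚ.≤-trans (≤∣∣ b) s)
    0≤K = ℚₚ.≤-trans (ℚₚ.0≤∣p∣ a) r
    e : (b ℚ.* (a ℚ.+ δ) ℚ.+ (L ℚ.- b) ℚ.* δ) ℚ.+ K ℚ.* δ ≡ a ℚ.* b ℚ.+ (K ℚ.+ L) ℚ.* δ
    e = solve (a ∷ b ∷ δ ∷ K ∷ L ∷ []) ℚ-acr
  ... | inj₂ a≤0 | inj₂ b≤0 = 0≤+ (subst (0ℚ ℚ.≤_) e (0≤* (≤⇒0≤ a≤0) (≤⇒0≤ b≤0)))
          (0≤* (0≤+ 0≤K 0≤L) 0≤δ)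
    where
    0≤K = ℚₚ.≤-trans (ℚₚ.0≤∣p∣ a) r
    0≤L = ℚₚ.≤-trans (ℚₚ.0≤∣p∣ b) s
    e : (0ℚ ℚ.- a) ℚ.* (0ℚ ℚ.- b) ≡ a ℚ.* b
    e = solve (a ∷ b ∷ []) ℚ-acr

0≤-* : ∀ {x y} → 0ℝ ≤ x → 0ℝ ≤ y → 0ℝ ≤ x * y
0≤-* {x} {y} p q = mk≤ λ ε 0<ε →
  let K , 0<K , bx = bounded x
      L , 0<L , by = bounded y
      0<K+L = 0<+ 0<K (ℚₚ.<⇒≤ 0<L)
      δ = inv (K ℚ.+ L) ℚ.* ε
      0<δ = 0<* (0<inv 0<K+L) 0<ε
      eq : (K ℚ.+ L) ℚ.* δ ≡ ε
      eq = trans (sym (ℚₚ.*-assoc (K ℚ.+ L) (inv (K ℚ.+ L)) ε))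
             (trans (cong (ℚ._* ε) (*-inv⁺ 0<K+L)) (ℚₚ.*-identityˡ ε))
  in ev-map₂ (λ n b c → subst (λ t → 0ℚ ℚ.≤ seq x n ℚ.* seq y n ℚ.+ t) eq
         (product-bound (seq x n) (seq y n) δ K L (ℚₚ.<⇒≤ 0<δ)
           (proj₁ c) (proj₂ c) (proj₁ b) (proj₂ b)))
       (ev-map₂ (λ _ → _,_) bx by)
       (ev-map₂ (λ _ → _,_) (below p δ 0<δ) (below q δ 0<δ))

*-mono-≤ : ∀ {x y u v} → 0ℝ ≤ x → 0ℝ ≤ u → x ≤ y → u ≤ v → x * u ≤ y * v
*-mono-≤ {x} {y} {u} {v} 0≤x 0≤u x≤y u≤v = ≤-from e
  (0≤-+ (0≤-* (x≤y⇒0≤y-x x≤y) (≤-trans 0≤u u≤v)) (0≤-* 0≤x (x≤y⇒0≤y-x u≤v)))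
  where
  e₀ : ∀ a b c d → (b ℚ.- a) ℚ.* d ℚ.+ a ℚ.* (d ℚ.- c) ≡ b ℚ.* d ℚ.- a ℚ.* c
  e₀ a b c d = solve (a ∷ b ∷ c ∷ d ∷ []) ℚ-acr
  e : (y - x) * v + x * (v - u) ≃ y * v - x * u
  e = pointwise λ n → e₀ (seq x n) (seq y n) (seq u n) (seq v n)

<⇒≤ : ∀ {x y} → x < y → x ≤ y
<⇒≤ {x} {y} p = mk≤ λ ε 0<ε → ev-map (λ n q →
  ≤-by (e (seq x n) (seq y n) (gap p) ε) (0≤+ (≤⇒0≤ q) (0≤+ (ℚₚ.<⇒≤ (gap>0 p)) (ℚₚ.<⇒≤ 0<ε))))
  (separated p)
  where
  e : ∀ a b g ε → (b ℚ.- (a ℚ.+ g)) ℚ.+ (g ℚ.+ ε) ≡ (b ℚ.+ ε) ℚ.- a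
  e a b g ε = solve (a ∷ b ∷ g ∷ ε ∷ []) ℚ-acr

<-≤-trans : ∀ {x y z} → x < y → y ≤ z → x < z
<-≤-trans {x} {y} {z} p q = mk< (½ ℚ.* gap p) (0<½* (gap>0 p)) (ev-map₂ (λ n a b →
  ≤-by (e (seq x n) (seq y n) (seq z n) (gap p)) (0≤+ (≤⇒0≤ a) (≤⇒0≤ b)))
  (separated p) (below q (½ ℚ.* gap p) (0<½* (gap>0 p))))
  where
  e : ∀ a b c g → (b ℚ.- (a ℚ.+ g)) ℚ.+ ((c ℚ.+ ½ ℚ.* g) ℚ.- b) ≡ c ℚ.- (a ℚ.+ ½ ℚ.* g)
  e a b c g = solve (a ∷ b ∷ c ∷ g ∷ []) ℚ-acr

≤-<-trans : ∀ {x y z} → x ≤ y → y < z → x < z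
≤-<-trans {x} {y} {z} p q = mk< (½ ℚ.* gap q) (0<½* (gap>0 q)) (ev-map₂ (λ n a b →
  ≤-by (e (seq x n) (seq y n) (seq z n) (gap q)) (0≤+ (≤⇒0≤ a) (≤⇒0≤ b)))
  (below p (½ ℚ.* gap q) (0<½* (gap>0 q))) (separated q))
  where
  e : ∀ a b c g → ((b ℚ.+ ½ ℚ.* g) ℚ.- a) ℚ.+ (c ℚ.- (b ℚ.+ g)) ≡ c ℚ.- (a ℚ.+ ½ ℚ.* g)
  e a b c g = solve (a ∷ b ∷ c ∷ g ∷ []) ℚ-acr

ι-mono-< : ∀ {p q} → p ℚ.< q → ι p < ι q
ι-mono-< {p} {q} p<q = mk< (q ℚ.- p) (<⇒0< p<q) (always λ _ → ℚₚ.≤-reflexive e)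
  where
  e : p ℚ.+ (q ℚ.- p) ≡ q
  e = solve (p ∷ q ∷ []) ℚ-acr

0<-* : ∀ {x y} → 0ℝ < x → 0ℝ < y → 0ℝ < x * y
0<-* {x} {y} p q = mk< (gap p ℚ.* gap q) (0<* (gap>0 p) (gap>0 q))
  (ev-map₂ (λ n a b → ≤-by (e (seq x n) (seq y n) (gap p) (gap q))
    (0≤+ (0≤* (≤⇒0≤ a) (ℚₚ.≤-trans (0≤+ (ℚₚ.≤-refl {0ℚ}) (ℚₚ.<⇒≤ (gap>0 q))) b))
         (0≤* (ℚₚ.<⇒≤ (gap>0 p)) (≤⇒0≤ b))))
    (separated p) (separated q))
  where
  e : ∀ a b g h → (a ℚ.- (0ℚ ℚ.+ g)) ℚ.* b ℚ.+ g ℚ.* (b ℚ.- (0ℚ ℚ.+ h)) ≡ a ℚ.* b ℚ.- (0ℚ ℚ.+ g ℚ.* h)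
  e a b g h = solve (a ∷ b ∷ g ∷ h ∷ []) ℚ-acr

infix 20 ∣_∣

opaque
  abs-cauchy : ∀ x → IsCauchy (λ n → ℚ.∣ seq x n ∣)
  abs-cauchy x ε 0<ε = proj₁ (cauchy x ε 0<ε) , λ m n N≤m N≤n →
    ℚₚ.≤-<-trans (lipschitz (seq x m) (seq x n)) (proj₂ (cauchy x ε 0<ε) m n N≤m N≤n)
    where
    half : ∀ a b → ℚ.∣ a ∣ ℚ.- ℚ.∣ b ∣ ℚ.≤ ℚ.∣ a ℚ.- b ∣
    half a b = ≤-by (e₁ (ℚ.∣ a ∣) (ℚ.∣ b ∣) (ℚ.∣ a ℚ.- b ∣)) (≤⇒0≤
      (subst (λ t → ℚ.∣ t ∣ ℚ.≤ ℚ.∣ a ℚ.- b ∣ ℚ.+ ℚ.∣ b ∣) e₂ (ℚₚ.∣p+q∣≤∣p∣+∣q∣ (a ℚ.- b) b)))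
      where
      e₁ : ∀ s t u → (u ℚ.+ t) ℚ.- s ≡ u ℚ.- (s ℚ.- t)
      e₁ s t u = solve (s ∷ t ∷ u ∷ []) ℚ-acr
      e₂ : (a ℚ.- b) ℚ.+ b ≡ a
      e₂ = solve (a ∷ b ∷ []) ℚ-acr
    lipschitz : ∀ a b → ℚ.∣ ℚ.∣ a ∣ ℚ.- ℚ.∣ b ∣ ∣ ℚ.≤ ℚ.∣ a ℚ.- b ∣
    lipschitz a b = ∣∣≤ (half a b)
      (subst₂ ℚ._≤_ (e (ℚ.∣ a ∣) (ℚ.∣ b ∣)) (dist-sym b a) (half b a))
      where
      e : ∀ s t → t ℚ.- s ≡ ℚ.- (s ℚ.- t)
      e s t = solve (s ∷ t ∷ []) ℚ-acr

∣_∣ : ℝ → ℝ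
∣ x ∣ = real (λ n → ℚ.∣ seq x n ∣) (abs-cauchy x)

∣x∣≤ : ∀ {x b} → x ≤ b → - x ≤ b → ∣ x ∣ ≤ b
∣x∣≤ p q = mk≤ λ ε 0<ε → ev-map₂ (λ _ → ∣∣≤) (below p ε 0<ε) (below q ε 0<ε)

∣x∣<ι : ∀ {x ε δ} → δ ℚ.< ε → Eventually (λ n → ℚ.∣ seq x n ∣ ℚ.< δ) → ∣ x ∣ < ι ε
∣x∣<ι {x} {ε} {δ} δ<ε p = mk< (ε ℚ.- δ) (<⇒0< δ<ε) (ev-map (λ n q →
  ≤-by (e (ℚ.∣ seq x n ∣) ε δ) (≤⇒0≤ (ℚₚ.<⇒≤ q))) p)
  where
  e : ∀ a ε δ → δ ℚ.- a ≡ ε ℚ.- (a ℚ.+ (ε ℚ.- δ))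
  e a ε δ = solve (a ∷ ε ∷ δ ∷ []) ℚ-acr

∣x∣<ι⁻¹ : ∀ {x ε} → ∣ x ∣ < ι ε → Eventually (λ n → ℚ.∣ seq x n ∣ ℚ.< ε)
∣x∣<ι⁻¹ {x} {ε} p = ev-map (λ n q → <-by (e (ℚ.∣ seq x n ∣) ε (gap p)) (ℚₚ.<-≤-trans (gap>0 p)
   (ℚₚ.≤-trans (ℚₚ.≤-reflexive (sym (ℚₚ.+-identityʳ (gap p)))) (ℚₚ.+-monoʳ-≤ (gap p) (≤⇒0≤ q))))) (separated p)
  where
  e : ∀ a ε g → g ℚ.+ (ε ℚ.- (a ℚ.+ g)) ≡ ε ℚ.- a
  e a ε g = solve (a ∷ ε ∷ g ∷ []) ℚ-acr

private
  eventually≥gap : ∀ {x} (p : 0ℝ < x) → Eventually (λ n → gap p ℚ.≤ seq x n)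
  eventually≥gap {x} p =
    ev-map (λ n → subst (ℚ._≤ seq x n) (ℚₚ.+-identityˡ (gap p))) (separated p)

  inv-close : ∀ δ ε a b → 0ℚ ℚ.< δ → 0ℚ ℚ.< ε → δ ℚ.≤ a → δ ℚ.≤ b →
    ℚ.∣ a ℚ.- b ∣ ℚ.< ε ℚ.* (δ ℚ.* δ) → ℚ.∣ inv a ℚ.- inv b ∣ ℚ.< ε
  inv-close δ ε a b 0<δ 0<ε δ≤a δ≤b p = subst₂ ℚ._<_ (sym eq) K²η≡ε
    (ℚₚ.≤-<-trans (ℚₚ.*-monoʳ-≤-nonNeg D {{ℚₚ.∣-∣-nonNeg (a ℚ.- b)}} ij≤KK)
      (ℚₚ.*-monoʳ-<-pos (K ℚ.* K) {{ℚ.positive (0<* 0<K 0<K)}} p))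
    where
    i = inv a
    j = inv b
    K = inv δ
    D = ℚ.∣ a ℚ.- b ∣
    0<K = 0<inv 0<δ
    0<a = ℚₚ.<-≤-trans 0<δ δ≤a
    0<b = ℚₚ.<-≤-trans 0<δ δ≤b
    0≤i = ℚₚ.<⇒≤ (0<inv 0<a)
    0≤j = ℚₚ.<⇒≤ (0<inv 0<b)
    ij≤KK : i ℚ.* j ℚ.≤ K ℚ.* K
    ij≤KK = ℚₚ.≤-trans
      (ℚₚ.*-monoʳ-≤-nonNeg j {{ℚ.nonNegative 0≤j}} (inv-antimono 0<δ δ≤a))
      (ℚₚ.*-monoˡ-≤-nonNeg K {{ℚ.nonNegative (ℚₚ.<⇒≤ 0<K)}} (inv-antimono 0<δ δ≤b))
    rearrange₁ : ∀ i j → (i ℚ.* j) ℚ.* (b ℚ.- a) ≡ (b ℚ.* j) ℚ.* i ℚ.- (a ℚ.* i) ℚ.* j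
    rearrange₁ i j = solve (i ∷ j ∷ a ∷ b ∷ []) ℚ-acr
    diff : (i ℚ.* j) ℚ.* (b ℚ.- a) ≡ i ℚ.- j
    diff = trans (rearrange₁ i j) (cong₂ ℚ._-_
      (trans (cong (ℚ._* i) (*-inv⁺ 0<b)) (ℚₚ.*-identityˡ i))
      (trans (cong (ℚ._* j) (*-inv⁺ 0<a)) (ℚₚ.*-identityˡ j)))
    eq : ℚ.∣ i ℚ.- j ∣ ≡ (i ℚ.* j) ℚ.* D
    eq = trans (cong ℚ.∣_∣ (sym diff)) (trans (ℚₚ.∣p*q∣≡∣p∣*∣q∣ (i ℚ.* j) (b ℚ.- a))
      (cong₂ ℚ._*_ (ℚₚ.0≤p⇒∣p∣≡p (0≤* 0≤i 0≤j)) (dist-sym b a)))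
    rearrange₂ : ∀ K → (K ℚ.* K) ℚ.* (ε ℚ.* (δ ℚ.* δ)) ≡ ε ℚ.* ((δ ℚ.* K) ℚ.* (δ ℚ.* K))
    rearrange₂ K = solve (K ∷ ε ∷ δ ∷ []) ℚ-acr
    K²η≡ε : (K ℚ.* K) ℚ.* (ε ℚ.* (δ ℚ.* δ)) ≡ ε
    K²η≡ε = trans (rearrange₂ K) (trans
      (cong (λ t → ε ℚ.* (t ℚ.* t)) (*-inv⁺ 0<δ)) (ℚₚ.*-identityʳ ε))

opaque
  recip-cauchy : ∀ x → 0ℝ < x → IsCauchy (λ n → inv (seq x n))
  recip-cauchy x 0<x ε 0<ε =
    let δ = gap 0<x
        0<δ = gap>0 0<x
        M , p = eventually≥gap 0<x
        N , q = cauchy x (ε ℚ.* (δ ℚ.* δ)) (0<* 0<ε (0<* 0<δ 0<δ))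
        l₁ = λ {m} → ℕₚ.≤-trans {k = m} (ℕₚ.m≤m⊔n M N)
        l₂ = λ {m} → ℕₚ.≤-trans {k = m} (ℕₚ.m≤n⊔m M N)
    in M ℕ.⊔ N , λ m n le₁ le₂ →
      inv-close δ ε (seq x m) (seq x n) 0<δ 0<ε
        (p m (l₁ le₁)) (p n (l₁ le₂)) (q m n (l₂ le₁) (l₂ le₂))

recip : (x : ℝ) → 0ℝ < x → ℝ
recip x 0<x = real (λ n → inv (seq x n)) (recip-cauchy x 0<x)

*-recip : ∀ x (0<x : 0ℝ < x) → x * recip x 0<x ≃ 1ℝ
*-recip x 0<x = mk≃ λ ε 0<ε → ev-map (λ n p →
  subst (λ t → ℚ.∣ t ℚ.- 1ℚ ∣ ℚ.< ε) (sym (*-inv⁺ (ℚₚ.<-≤-trans (gap>0 0<x) p)))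
    0<ε) (eventually≥gap 0<x)

0≤recip : ∀ x (0<x : 0ℝ < x) → 0ℝ ≤ recip x 0<x
0≤recip x 0<x = mk≤ λ ε 0<ε → ev-map (λ n p →
  0≤+ (ℚₚ.<⇒≤ (0<inv (ℚₚ.<-≤-trans (gap>0 0<x) p))) (ℚₚ.<⇒≤ 0<ε)) (eventually≥gap 0<x)

recip-unique : ∀ x (0<x : 0ℝ < x) {y} → x * y ≃ 1ℝ → recip x 0<x ≃ y
recip-unique x 0<x {y} xy≃1 = begin
  r            ≈⟨ ℝR.*-identityʳ r ⟨
  r * 1ℝ       ≈⟨ *-cong ≃-refl xy≃1 ⟨
  r * (x * y)  ≈⟨ rearrange r ⟩
  (x * r) * y  ≈⟨ *-cong (*-recip x 0<x) ≃-refl ⟩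
  1ℝ * y       ≈⟨ ℝR.*-identityˡ y ⟩
  y            ∎
  where
  open import Relation.Binary.Reasoning.Setoid ℝR.setoid
  r = recip x 0<x
  rearrange₀ : ∀ a b c → a ℚ.* (b ℚ.* c) ≡ (b ℚ.* a) ℚ.* c
  rearrange₀ a b c = solve (a ∷ b ∷ c ∷ []) ℚ-acr
  rearrange : ∀ r → r * (x * y) ≃ (x * r) * y
  rearrange r = pointwise λ n → rearrange₀ (seq r n) (seq x n) (seq y n)

fromℕ : ℕ → ℚ
fromℕ n = ℤ.+ n ℚ./ 1

module ℕ-in-ℚ where

  fromℚᵘ-+ : ∀ p q → ℚ.fromℚᵘ (p ℚᵘ.+ q) ≡ ℚ.fromℚᵘ p ℚ.+ ℚ.fromℚᵘ q
  fromℚᵘ-+ p q = ℚₚ.toℚᵘ-injective (ℚᵘₚ.≃-trans (ℚₚ.toℚᵘ-fromℚᵘ (p ℚᵘ.+ q)) (ℚᵘₚ.≃-sym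
    (ℚᵘₚ.≃-trans (ℚₚ.toℚᵘ-homo-+ (ℚ.fromℚᵘ p) (ℚ.fromℚᵘ q))
      (ℚᵘₚ.+-cong (ℚₚ.toℚᵘ-fromℚᵘ p) (ℚₚ.toℚᵘ-fromℚᵘ q)))))

  fromℚᵘ-* : ∀ p q → ℚ.fromℚᵘ (p ℚᵘ.* q) ≡ ℚ.fromℚᵘ p ℚ.* ℚ.fromℚᵘ q
  fromℚᵘ-* p q = ℚₚ.toℚᵘ-injective (ℚᵘₚ.≃-trans (ℚₚ.toℚᵘ-fromℚᵘ (p ℚᵘ.* q)) (ℚᵘₚ.≃-sym
    (ℚᵘₚ.≃-trans (ℚₚ.toℚᵘ-homo-* (ℚ.fromℚᵘ p) (ℚ.fromℚᵘ q))
      (ℚᵘₚ.*-cong (ℚₚ.toℚᵘ-fromℚᵘ p) (ℚₚ.toℚᵘ-fromℚᵘ q)))))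

  fromℚᵘ-< : ∀ {p q} → p ℚᵘ.< q → ℚ.fromℚᵘ p ℚ.< ℚ.fromℚᵘ q
  fromℚᵘ-< {p} {q} p<q = ℚₚ.toℚᵘ-cancel-<
    (ℚᵘₚ.<-respˡ-≃ (ℚᵘₚ.≃-sym (ℚₚ.toℚᵘ-fromℚᵘ p))
      (ℚᵘₚ.<-respʳ-≃ (ℚᵘₚ.≃-sym (ℚₚ.toℚᵘ-fromℚᵘ q)) p<q))

  fromℚᵘ-≤ : ∀ {p q} → p ℚᵘ.≤ q → ℚ.fromℚᵘ p ℚ.≤ ℚ.fromℚᵘ q
  fromℚᵘ-≤ {p} {q} p≤q = ℚₚ.toℚᵘ-cancel-≤
    (ℚᵘₚ.≤-respˡ-≃ (ℚᵘₚ.≃-sym (ℚₚ.toℚᵘ-fromℚᵘ p))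
      (ℚᵘₚ.≤-respʳ-≃ (ℚᵘₚ.≃-sym (ℚₚ.toℚᵘ-fromℚᵘ q)) p≤q))

  fromℕ-+ : ∀ m n → fromℕ (m ℕ.+ n) ≡ fromℕ m ℚ.+ fromℕ n
  fromℕ-+ m n = trans
    (ℚₚ.fromℚᵘ-cong {ℚᵘ.mkℚᵘ (ℤ.+ (m ℕ.+ n)) 0} {ℚᵘ.mkℚᵘ (ℤ.+ m) 0 ℚᵘ.+ ℚᵘ.mkℚᵘ (ℤ.+ n) 0}
      (ℚᵘ.*≡* (cong (ℤ._* ℤ.+ 1) (trans (ℤₚ.pos-+ m n)
        (sym (cong₂ ℤ._+_ (ℤₚ.*-identityʳ (ℤ.+ m)) (ℤₚ.*-identityʳ (ℤ.+ n))))))))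
    (fromℚᵘ-+ (ℚᵘ.mkℚᵘ (ℤ.+ m) 0) (ℚᵘ.mkℚᵘ (ℤ.+ n) 0))

  fromℕ-* : ∀ m n → fromℕ (m ℕ.* n) ≡ fromℕ m ℚ.* fromℕ n
  fromℕ-* m n = trans
    (ℚₚ.fromℚᵘ-cong {ℚᵘ.mkℚᵘ (ℤ.+ (m ℕ.* n)) 0} {ℚᵘ.mkℚᵘ (ℤ.+ m) 0 ℚᵘ.* ℚᵘ.mkℚᵘ (ℤ.+ n) 0}
      (ℚᵘ.*≡* (cong (ℤ._* ℤ.+ 1) (ℤₚ.pos-* m n))))
    (fromℚᵘ-* (ℚᵘ.mkℚᵘ (ℤ.+ m) 0) (ℚᵘ.mkℚᵘ (ℤ.+ n) 0))

  fromℕ-≤ : ∀ m n → m ℕ.≤ n → fromℕ m ℚ.≤ fromℕ n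
  fromℕ-≤ m n m≤n = fromℚᵘ-≤ {ℚᵘ.mkℚᵘ (ℤ.+ m) 0} {ℚᵘ.mkℚᵘ (ℤ.+ n) 0}
    (ℚᵘ.*≤* (ℤₚ.*-monoʳ-≤-nonNeg (ℤ.+ 1) (ℤ.+≤+ m≤n)))

  fromℕ-< : ∀ m n → m ℕ.< n → fromℕ m ℚ.< fromℕ n
  fromℕ-< m n m<n = fromℚᵘ-< {ℚᵘ.mkℚᵘ (ℤ.+ m) 0} {ℚᵘ.mkℚᵘ (ℤ.+ n) 0}
    (ℚᵘ.*<* (ℤₚ.*-monoʳ-<-pos (ℤ.+ 1) (ℤ.+<+ m<n)))

  0≤fromℕ : ∀ n → 0ℚ ℚ.≤ fromℕ n
  0≤fromℕ n = fromℕ-≤ 0 n ℕ.z≤n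

  0<fromℕ-suc : ∀ n → 0ℚ ℚ.< fromℕ (suc n)
  0<fromℕ-suc n = fromℕ-< 0 (suc n) ℕ.z<s

  /-*-fromℕ : ∀ m n → (ℤ.+ m ℚ./ suc n) ℚ.* fromℕ (suc n) ≡ fromℕ m
  /-*-fromℕ m n = trans (sym (fromℚᵘ-* (ℚᵘ.mkℚᵘ (ℤ.+ m) n) (ℚᵘ.mkℚᵘ (ℤ.+ suc n) 0)))
    (ℚₚ.fromℚᵘ-cong {ℚᵘ.mkℚᵘ (ℤ.+ m) n ℚᵘ.* ℚᵘ.mkℚᵘ (ℤ.+ suc n) 0} {ℚᵘ.mkℚᵘ (ℤ.+ m) 0}
      (ℚᵘ.*≡* (trans (ℤₚ.*-identityʳ (ℤ.+ m ℤ.* ℤ.+ suc n))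
        (cong (λ t → ℤ.+ m ℤ.* ℤ.+ suc t) (sym (ℕₚ.*-identityʳ n))))))

  0≤/ : ∀ m n → 0ℚ ℚ.≤ ℤ.+ m ℚ./ suc n
  0≤/ m n = ℚₚ.nonNegative⁻¹ (ℤ.+ m ℚ./ suc n) {{ℚₚ.normalize-nonNeg m (suc n)}}

  1/suc : ℕ → ℚ
  1/suc n = ℤ.+ 1 ℚ./ suc n

  1/suc>0 : ∀ n → 0ℚ ℚ.< 1/suc n
  1/suc>0 n = ℚₚ.positive⁻¹ (1/suc n) {{ℚₚ.normalize-pos 1 (suc n)}}

  archimedean : ∀ ε → 0ℚ ℚ.< ε → Eventually (λ n → 1/suc n ℚ.< ε)
  archimedean (mkℚ (ℤ.+ zero) d c) 0<ε = ⊥-elim (ℚₚ.<-irrefl (sym (ℚₚ.↥p≡0⇒p≡0 _ refl)) 0<ε)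
  archimedean (mkℚ (ℤ.-[1+ a ]) d c) 0<ε = ⊥-elim (ℚₚ.<-asym 0<ε (ℚₚ.negative⁻¹ (mkℚ (ℤ.-[1+ a ]) d c)))
  archimedean ε@(mkℚ (ℤ.+ suc a) d c) 0<ε = suc d , λ n d<n →
    ℚₚ.toℚᵘ-cancel-< (ℚᵘₚ.<-respˡ-≃ (ℚᵘₚ.≃-sym (ℚₚ.toℚᵘ-fromℚᵘ (ℚᵘ.mkℚᵘ (ℤ.+ 1) n)))
      (ℚᵘ.*<* (subst₂ ℤ._<_ (sym (ℤₚ.*-identityˡ (ℤ.+ suc d))) (ℤₚ.pos-* (suc a) (suc n))
        (ℤ.+<+ (ℕₚ.<-≤-trans (ℕ.s≤s d<n) (ℕₚ.m≤m+n (suc n) (a ℕ.* suc n)))))))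

  *-cancel-≤ : ∀ {a b} c → 0ℚ ℚ.< c → a ℚ.* c ℚ.≤ b ℚ.* c → a ℚ.≤ b
  *-cancel-≤ c 0<c = ℚₚ.*-cancelʳ-≤-pos c {{ℚ.positive 0<c}}

  *-cancel-< : ∀ {a b} c → 0ℚ ℚ.< c → a ℚ.* c ℚ.< b ℚ.* c → a ℚ.< b
  *-cancel-< c 0<c = ℚₚ.*-cancelʳ-<-nonNeg c {{ℚ.nonNegative (ℚₚ.<⇒≤ 0<c)}}

  square-cancel-< : ∀ {x y} → 0ℚ ℚ.≤ y → x ℚ.* x ℚ.< y ℚ.* y → x ℚ.< y
  square-cancel-< {x} {y} 0≤y p = ℚₚ.≰⇒> λ y≤x → ℚₚ.<-irrefl refl (ℚₚ.<-≤-trans p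
    (ℚₚ.≤-trans (ℚₚ.*-monoˡ-≤-nonNeg y {{ℚ.nonNegative 0≤y}} y≤x)
      (ℚₚ.*-monoʳ-≤-nonNeg x {{ℚ.nonNegative (ℚₚ.≤-trans 0≤y y≤x)}} y≤x)))

open ℕ-in-ℚ

⌊√_⌋ : ℕ → ℕ
⌊√ zero  ⌋ = 0
⌊√ suc n ⌋ with suc ⌊√ n ⌋ ℕ.* suc ⌊√ n ⌋ ℕₚ.≤? suc n
... | yes _ = suc ⌊√ n ⌋
... | no  _ = ⌊√ n ⌋

⌊√⌋-lower : ∀ n → ⌊√ n ⌋ ℕ.* ⌊√ n ⌋ ℕ.≤ n
⌊√⌋-lower zero = ℕ.z≤n
⌊√⌋-lower (suc n) with suc ⌊√ n ⌋ ℕ.* suc ⌊√ n ⌋ ℕₚ.≤? suc n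
... | yes p = p
... | no  _ = ℕₚ.m≤n⇒m≤1+n (⌊√⌋-lower n)

⌊√⌋-upper : ∀ n → n ℕ.< suc ⌊√ n ⌋ ℕ.* suc ⌊√ n ⌋
⌊√⌋-upper zero = ℕ.z<s
⌊√⌋-upper (suc n) with suc ⌊√ n ⌋ ℕ.* suc ⌊√ n ⌋ ℕₚ.≤? suc n
... | yes _ = ℕₚ.≤-<-trans (⌊√⌋-upper n) (ℕₚ.*-mono-< {r} {suc r} {r} {suc r} (ℕₚ.n<1+n r) (ℕₚ.n<1+n r))
  where r = suc ⌊√ n ⌋
... | no  p = ℕₚ.≰⇒> p

√-seq : ℕ → ℕ → ℚ
√-seq n p = ℤ.+ ⌊√ n ℕ.* (suc p ℕ.* suc p) ⌋ ℚ./ suc p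

0≤√-seq : ∀ n p → 0ℚ ℚ.≤ √-seq n p
0≤√-seq n p = 0≤/ ⌊√ n ℕ.* (suc p ℕ.* suc p) ⌋ p

private
  scaled : ∀ n p → fromℕ (n ℕ.* (suc p ℕ.* suc p)) ≡ fromℕ n ℚ.* (fromℕ (suc p) ℚ.* fromℕ (suc p))
  scaled n p = trans (fromℕ-* n _) (cong (fromℕ n ℚ.*_) (fromℕ-* (suc p) (suc p)))

  interchange : ∀ a b → (a ℚ.* a) ℚ.* (b ℚ.* b) ≡ (a ℚ.* b) ℚ.* (a ℚ.* b)
  interchange a b = solve (a ∷ b ∷ []) ℚ-acr

√-seq-lower : ∀ n p → √-seq n p ℚ.* √-seq n p ℚ.≤ fromℕ n
√-seq-lower n p = *-cancel-≤ (P ℚ.* P) (0<* 0<P 0<P)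
  (subst₂ ℚ._≤_ eq (scaled n p) (fromℕ-≤ (s ℕ.* s) _ (⌊√⌋-lower (n ℕ.* (suc p ℕ.* suc p)))))
  where
  s = ⌊√ n ℕ.* (suc p ℕ.* suc p) ⌋
  r = √-seq n p
  P = fromℕ (suc p)
  0<P = 0<fromℕ-suc p
  eq : fromℕ (s ℕ.* s) ≡ (r ℚ.* r) ℚ.* (P ℚ.* P)
  eq = trans (fromℕ-* s s) (sym (trans (interchange r P)
    (cong₂ ℚ._*_ (/-*-fromℕ s p) (/-*-fromℕ s p))))

√-seq-upper : ∀ n p →
  fromℕ n ℚ.< (√-seq n p ℚ.+ 1/suc p) ℚ.* (√-seq n p ℚ.+ 1/suc p)
√-seq-upper n p = *-cancel-< (P ℚ.* P) (0<* 0<P 0<P)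
  (subst₂ ℚ._<_ (scaled n p) eq (fromℕ-< _ (suc s ℕ.* suc s) (⌊√⌋-upper (n ℕ.* (suc p ℕ.* suc p)))))
  where
  s = ⌊√ n ℕ.* (suc p ℕ.* suc p) ⌋
  r = √-seq n p
  e = 1/suc p
  P = fromℕ (suc p)
  0<P = 0<fromℕ-suc p
  eq₁ : (r ℚ.+ e) ℚ.* P ≡ fromℕ (suc s)
  eq₁ = trans (ℚₚ.*-distribʳ-+ P r e) (trans
    (cong₂ ℚ._+_ (/-*-fromℕ s p) (/-*-fromℕ 1 p))
    (trans (ℚₚ.+-comm (fromℕ s) (fromℕ 1)) (sym (fromℕ-+ 1 s))))
  eq : fromℕ (suc s ℕ.* suc s) ≡ ((r ℚ.+ e) ℚ.* (r ℚ.+ e)) ℚ.* (P ℚ.* P)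
  eq = trans (fromℕ-* (suc s) (suc s)) (sym (trans (interchange (r ℚ.+ e) P)
    (cong₂ ℚ._*_ eq₁ eq₁)))

√-seq-close : ∀ n {x} p → x ℚ.* x ℚ.≤ fromℕ n → x ℚ.< √-seq n p ℚ.+ 1/suc p
√-seq-close n p x²≤n = square-cancel-<
  (0≤+ (0≤√-seq n p) (ℚₚ.<⇒≤ (1/suc>0 p)))
  (ℚₚ.≤-<-trans x²≤n (√-seq-upper n p))

opaque
  √-cauchy : ∀ n → IsCauchy (√-seq n)
  √-cauchy n ε 0<ε =
    let N , arch = archimedean ε 0<ε
    in N , λ p q N≤p N≤q →
      ∣∣< (one p q (arch q N≤q))
          (subst (ℚ._< ε) (e (√-seq n p) (√-seq n q)) (one q p (arch p N≤p)))
    where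
    e : ∀ a b → b ℚ.- a ≡ ℚ.- (a ℚ.- b)
    e a b = solve (a ∷ b ∷ []) ℚ-acr
    e₁ : ∀ a b η → (b ℚ.+ η) ℚ.- a ≡ η ℚ.- (a ℚ.- b)
    e₁ a b η = solve (a ∷ b ∷ η ∷ []) ℚ-acr
    one : ∀ p q → 1/suc q ℚ.< ε → √-seq n p ℚ.- √-seq n q ℚ.< ε
    one p q e<ε = ℚₚ.<-trans
      (<-by (e₁ (√-seq n p) (√-seq n q) (1/suc q)) (<⇒0< (√-seq-close n q (√-seq-lower n p))))
      e<ε

-- The p-th approximation of √ n is ⌊(p + 1) √n⌋ / (p + 1).
√_ : ℕ → ℝ
√ n = real (√-seq n) (√-cauchy n)

infix 9 √_

0≤√ : ∀ n → 0ℝ ≤ √ n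
0≤√ n = mk≤ λ ε 0<ε → always λ p → 0≤+ (0≤√-seq n p) (ℚₚ.<⇒≤ 0<ε)

√*√ : ∀ n → √ n * √ n ≃ ι (fromℕ n)
√*√ n = mk≃ λ ε 0<ε →
  let K , 0<K , bK = bounded (√ n)
      0<M = 0<+ 0<1 (ℚₚ.<⇒≤ (0<+ 0<K (ℚₚ.<⇒≤ 0<K)))
      M = 1ℚ ℚ.+ (K ℚ.+ K)
      η = inv M ℚ.* ε
      0<η = 0<* (0<inv 0<M) 0<ε
      Mη≡ε = trans (sym (ℚₚ.*-assoc M (inv M) ε))
               (trans (cong (ℚ._* ε) (*-inv⁺ 0<M)) (ℚₚ.*-identityˡ ε))
  in ev-map₃ (λ p b e<1 e<η → subst (ℚ.∣ _ ∣ ℚ.<_) Mη≡ε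
       (bound (√-seq n p) (1/suc p) (fromℕ n) K η 0<η (1/suc>0 p) e<1 e<η
         (ℚₚ.≤-trans (≤∣∣ (√-seq n p)) b) 0<K (0≤√-seq n p) (√-seq-lower n p) (√-seq-upper n p)))
     bK (archimedean 1ℚ 0<1) (archimedean η 0<η)
  where
  bound : ∀ r e N K η → 0ℚ ℚ.< η → 0ℚ ℚ.< e → e ℚ.< 1ℚ → e ℚ.< η → r ℚ.≤ K → 0ℚ ℚ.< K → 0ℚ ℚ.≤ r →
    r ℚ.* r ℚ.≤ N → N ℚ.< (r ℚ.+ e) ℚ.* (r ℚ.+ e) →
    ℚ.∣ r ℚ.* r ℚ.- N ∣ ℚ.< (1ℚ ℚ.+ (K ℚ.+ K)) ℚ.* η
  bound r e N K η 0<η 0<e e<1 e<η r≤K 0<K 0≤r lo hi = ∣∣<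
    (<-by refl (0<+₂ (≤⇒0≤ lo) 0<Mη))
    (<-by eq (0<+ (<⇒0< hi) (0≤+ (0≤+ (0≤* (≤⇒0≤ r≤K+r) (ℚₚ.<⇒≤ 0<e)) (0≤* (≤⇒0≤ (ℚₚ.<⇒≤ e<1)) (ℚₚ.<⇒≤ 0<e)))
        (0≤* 0≤M (≤⇒0≤ (ℚₚ.<⇒≤ e<η))))))
    where
    0≤M : 0ℚ ℚ.≤ 1ℚ ℚ.+ (K ℚ.+ K)
    0≤M = 0≤+ (ℚₚ.<⇒≤ 0<1) (0≤+ (ℚₚ.<⇒≤ 0<K) (ℚₚ.<⇒≤ 0<K))
    0<Mη : 0ℚ ℚ.< (1ℚ ℚ.+ (K ℚ.+ K)) ℚ.* η
    0<Mη = 0<* (0<+ 0<1 (0≤+ (ℚₚ.<⇒≤ 0<K) (ℚₚ.<⇒≤ 0<K))) 0<η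
    r≤K+r : r ℚ.+ r ℚ.≤ K ℚ.+ K
    r≤K+r = ℚₚ.+-mono-≤ r≤K r≤K
    0<+₂ : 0ℚ ℚ.≤ N ℚ.- r ℚ.* r → 0ℚ ℚ.< (1ℚ ℚ.+ (K ℚ.+ K)) ℚ.* η →
      0ℚ ℚ.< (1ℚ ℚ.+ (K ℚ.+ K)) ℚ.* η ℚ.- (r ℚ.* r ℚ.- N)
    0<+₂ p q = subst (0ℚ ℚ.<_) eq₂ (0<+ q p)
      where
      eq₂ : (1ℚ ℚ.+ (K ℚ.+ K)) ℚ.* η ℚ.+ (N ℚ.- r ℚ.* r) ≡ (1ℚ ℚ.+ (K ℚ.+ K)) ℚ.* η ℚ.- (r ℚ.* r ℚ.- N)
      eq₂ = solve (r ∷ N ∷ K ∷ η ∷ []) ℚ-acr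
    eq : ((r ℚ.+ e) ℚ.* (r ℚ.+ e) ℚ.- N) ℚ.+ ((((K ℚ.+ K) ℚ.- (r ℚ.+ r)) ℚ.* e ℚ.+ (1ℚ ℚ.- e) ℚ.* e)
           ℚ.+ (1ℚ ℚ.+ (K ℚ.+ K)) ℚ.* (η ℚ.- e))
         ≡ (1ℚ ℚ.+ (K ℚ.+ K)) ℚ.* η ℚ.- ℚ.- (r ℚ.* r ℚ.- N)
    eq = solve (r ∷ e ∷ N ∷ K ∷ η ∷ []) ℚ-acr

√-lower : ∀ q n → q ℕ.* q ℕ.≤ n → ι (fromℕ q) ≤ √ n
√-lower q n q²≤n = mk≤ λ ε 0<ε → ev-map (λ p e<ε → ℚₚ.<⇒≤ (ℚₚ.<-trans
  (√-seq-close n p (subst (ℚ._≤ fromℕ n) (fromℕ-* q q) (fromℕ-≤ (q ℕ.* q) n q²≤n)))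
  (ℚₚ.+-monoʳ-< (√-seq n p) e<ε))) (archimedean ε 0<ε)

open import Algebra.Properties.Semiring.Exp ℝR.semiring public using (_^_)
open import Algebra.Properties.Monoid.Sum ℝR.+-monoid using () renaming (sum to sumℝ)

open CommutativeRing ℚₚ.+-*-commutativeRing using () renaming (semiring to ℚ-semiring)
open import Algebra.Properties.Semiring.Exp ℚ-semiring public using () renaming (_^_ to _^ℚ_)
open import Algebra.Properties.Monoid.Sum ℚₚ.+-0-monoid using () renaming (sum to sumℚ)

-- In ∑ℝ[ i < n ] f the index i : ℕ runs over 0, …, n - 1.
∑ℝ : ℕ → (ℕ → ℝ) → ℝ
∑ℝ n f = sumℝ {n} (λ i → f (toℕ i))

∑ℚ : ℕ → (ℕ → ℚ) → ℚ
∑ℚ n f = sumℚ {n} (λ i → f (toℕ i))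

infixl 5 ∑ℝ ∑ℚ
syntax ∑ℝ n (λ i → f) = ∑ℝ[ i < n ] f
syntax ∑ℚ n (λ i → f) = ∑ℚ[ i < n ] f

∑ℝ-last : ∀ n f → ∑ℝ (suc n) f ≃ ∑ℝ n f + f n
∑ℝ-last zero    f = ℝR.+-comm (f 0) 0ℝ
∑ℝ-last (suc n) f = ≃-trans (+-cong (≃-refl {f 0}) (∑ℝ-last n (λ i → f (suc i))))
  (≃-sym (ℝR.+-assoc (f 0) (∑ℝ n (λ i → f (suc i))) (f (suc n))))

^-pos : ∀ {x} m → 0ℝ < x → 0ℝ < x ^ m
^-pos zero    0<x = ι-mono-< 0<1
^-pos (suc m) 0<x = 0<-* 0<x (^-pos m 0<x)

0≤^ : ∀ {x} m → 0ℝ ≤ x → 0ℝ ≤ x ^ m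
0≤^ zero    0≤x = ι-mono-≤ (ℚₚ.<⇒≤ 0<1)
0≤^ (suc m) 0≤x = 0≤-* 0≤x (0≤^ m 0≤x)

^-inverse : ∀ {x y} m → x * y ≃ 1ℝ → x ^ m * y ^ m ≃ 1ℝ
^-inverse zero xy≃1 = ℝR.*-identityˡ 1ℝ
^-inverse {x} {y} (suc m) xy≃1 = ≃-trans (swap x (x ^ m) y (y ^ m))
  (≃-trans (*-cong xy≃1 (^-inverse m xy≃1)) (ℝR.*-identityˡ 1ℝ))
  where
  swap₀ : ∀ a b c d → (a ℚ.* b) ℚ.* (c ℚ.* d) ≡ (a ℚ.* c) ℚ.* (b ℚ.* d)
  swap₀ a b c d = solve (a ∷ b ∷ c ∷ d ∷ []) ℚ-acr
  swap : ∀ a b c d → (a * b) * (c * d) ≃ (a * c) * (b * d)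
  swap a b c d = pointwise λ n → swap₀ (seq a n) (seq b n) (seq c n) (seq d n)

infix 4 _⟶_

_⟶_ : (ℕ → ℝ) → ℝ → Set
xs ⟶ l = ∀ ε → 0ℚ ℚ.< ε → Eventually (λ n → ∣ xs n - l ∣ < ι ε)

IsCauchyℝ : (ℕ → ℝ) → Set
IsCauchyℝ xs = ∀ ε → 0ℚ ℚ.< ε →
  ∃[ N ] (∀ m n → N ℕ.≤ m → N ℕ.≤ n → ∣ xs m - xs n ∣ < ι ε)

-- lim-seq xs n is a rational approximation of xs n up to 1/(n+1).
lim-seq : (ℕ → ℝ) → ℕ → ℚ
lim-seq xs n = seq (xs n) (proj₁ (cauchy (xs n) (1/suc n) (1/suc>0 n)))

private
  lim-seq-approx : ∀ xs n →
    Eventually (λ t → ℚ.∣ seq (xs n) t ℚ.- lim-seq xs n ∣ ℚ.< 1/suc n)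
  lim-seq-approx xs n =
    let N , p = cauchy (xs n) (1/suc n) (1/suc>0 n) in N , λ t N≤t → p t N N≤t ℕₚ.≤-refl

  eventually-const : ∀ {P : Set} → Eventually (λ _ → P) → P
  eventually-const (N , p) = p N ℕₚ.≤-refl

  four-points : ∀ a b c d ε → ℚ.∣ b ℚ.- a ∣ ℚ.< ½ ℚ.* (½ ℚ.* ε) → ℚ.∣ b ℚ.- c ∣ ℚ.< ½ ℚ.* ε →
    ℚ.∣ c ℚ.- d ∣ ℚ.< ½ ℚ.* (½ ℚ.* ε) → ℚ.∣ a ℚ.- d ∣ ℚ.< ε
  four-points a b c d ε p q r = ℚₚ.≤-<-trans (triangle a b d)
    (ℚₚ.≤-<-trans (ℚₚ.+-monoʳ-≤ ℚ.∣ a ℚ.- b ∣ (triangle b c d))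
      (subst₂ ℚ._<_ refl e
        (ℚₚ.+-mono-< (subst (ℚ._< ½ ℚ.* (½ ℚ.* ε)) (dist-sym b a) p) (ℚₚ.+-mono-< q r))))
    where
    e : ½ ℚ.* (½ ℚ.* ε) ℚ.+ (½ ℚ.* ε ℚ.+ ½ ℚ.* (½ ℚ.* ε)) ≡ ε
    e = solve (ε ∷ []) ℚ-acr

opaque
  lim-cauchy : ∀ xs → IsCauchyℝ xs → IsCauchy (lim-seq xs)
  lim-cauchy xs c ε 0<ε =
    let η = ½ ℚ.* (½ ℚ.* ε)
        N , p = c (½ ℚ.* ε) (0<½* 0<ε)
        M , q = archimedean η (0<½* (0<½* 0<ε))
        l₁ = λ {m} → ℕₚ.≤-trans {k = m} (ℕₚ.m≤m⊔n N M)
        l₂ = λ {m} → ℕₚ.≤-trans {k = m} (ℕₚ.m≤n⊔m N M)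
    in N ℕ.⊔ M , λ m n le₁ le₂ → eventually-const
         (ev-map₃ (λ t a b d → four-points (lim-seq xs m) (seq (xs m) t) (seq (xs n) t) (lim-seq xs n) ε
             (ℚₚ.<-trans a (q m (l₂ le₁))) b (ℚₚ.<-trans d (q n (l₂ le₂))))
           (lim-seq-approx xs m)
           (∣x∣<ι⁻¹ {xs m - xs n} (p m n (l₁ le₁) (l₁ le₂)))
           (lim-seq-approx xs n))

lim : (xs : ℕ → ℝ) → IsCauchyℝ xs → ℝ
lim xs c = real (lim-seq xs) (lim-cauchy xs c)

⟶-lim : ∀ xs (c : IsCauchyℝ xs) → xs ⟶ lim xs c
⟶-lim xs c ε 0<ε =
  let η = ½ ℚ.* ε
      N , p = lim-cauchy xs c (½ ℚ.* η) (0<½* (0<½* 0<ε))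
      M , q = archimedean (½ ℚ.* η) (0<½* (0<½* 0<ε))
  in N ℕ.⊔ M , λ n le → ∣x∣<ι {xs n - lim xs c} (half<  ε 0<ε)
       (ev-map₂ (λ t a N≤t → triangle½ (seq (xs n) t) (lim-seq xs n) (lim-seq xs t) η
           (ℚₚ.<-trans a (q n (ℕₚ.≤-trans (ℕₚ.m≤n⊔m N M) le)))
           (p n t (ℕₚ.≤-trans (ℕₚ.m≤m⊔n N M) le) N≤t))
         (lim-seq-approx xs n) (N , λ t N≤t → N≤t))
  where
  half< : ∀ ε → 0ℚ ℚ.< ε → ½ ℚ.* ε ℚ.< ε
  half< ε 0<ε = <-by (e ε) (0<½* 0<ε)
    where
    e : ∀ ε → ½ ℚ.* ε ≡ ε ℚ.- ½ ℚ.* ε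
    e ε = solve (ε ∷ []) ℚ-acr

private
  increasing : ∀ (h : ℕ → ℝ) → (∀ n → h n ≤ h (suc n)) → ∀ {m n} → m ℕ.≤′ n → h m ≤ h n
  increasing h step ℕ.≤′-refl       = ≤-refl
  increasing h step (ℕ.≤′-step m≤n) = ≤-trans (increasing h step m≤n) (step _)

  decreasing : ∀ (h : ℕ → ℝ) → (∀ n → h (suc n) ≤ h n) → ∀ {m n} → m ℕ.≤′ n → h n ≤ h m
  decreasing h step ℕ.≤′-refl       = ≤-refl
  decreasing h step (ℕ.≤′-step m≤n) = ≤-trans (step _) (decreasing h step m≤n)

  within : ∀ {a g x y} → a ≤ y → x ≤ a + g → x - y ≤ g
  within {a} {g} {x} {y} p q = ≤-from e (0≤-+ (x≤y⇒0≤y-x q) (x≤y⇒0≤y-x p))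
    where
    e₀ : ∀ a g x y → ((a ℚ.+ g) ℚ.- x) ℚ.+ (y ℚ.- a) ≡ g ℚ.- (x ℚ.- y)
    e₀ a g x y = solve (a ∷ g ∷ x ∷ y ∷ []) ℚ-acr
    e : ((a + g) - x) + (y - a) ≃ g - (x - y)
    e = pointwise λ n → e₀ (seq a n) (seq g n) (seq x n) (seq y n)

  ∣-∣-within : ∀ {a g x y} → a ≤ x → x ≤ a + g → a ≤ y → y ≤ a + g → ∣ x - y ∣ ≤ g
  ∣-∣-within {a} {g} {x} {y} p q r s = ∣x∣≤ (within r q) (≤-trans (≤-reflexive e) (within p s))
    where
    e₀ : ∀ x y → ℚ.- (x ℚ.- y) ≡ y ℚ.- x
    e₀ x y = solve (x ∷ y ∷ []) ℚ-acr
    e : - (x - y) ≃ y - x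
    e = pointwise λ n → e₀ (seq x n) (seq y n)

telescoping-cauchy : ∀ (f g : ℕ → ℝ) → (∀ n → 0ℝ ≤ f n) → (∀ n → 0ℝ ≤ g n) →
  (∀ n → f (suc n) ≤ g n - g (suc n)) →
  (∀ ε → 0ℚ ℚ.< ε → ∃[ N ] g N < ι ε) → IsCauchyℝ (λ n → ∑ℝ n f)
telescoping-cauchy f g 0≤f 0≤g f≤Δg small ε 0<ε =
  let N , gN<ε = small ε 0<ε
  in suc N , λ m n le₁ le₂ → ≤-<-trans
       (∣-∣-within (S-mono le₁) (S-upper le₁) (S-mono le₂) (S-upper le₂)) gN<ε
  where
  S : ℕ → ℝ
  S n = ∑ℝ n f
  U : ℕ → ℝ
  U n = S (suc n) + g n

  S-step : ∀ n → S n ≤ S (suc n)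
  S-step n = ≤-resp (ℝR.+-identityʳ (S n)) (≃-sym (∑ℝ-last n f)) (+-mono-≤ (≤-refl {S n}) (0≤f n))

  U-step : ∀ n → U (suc n) ≤ U n
  U-step n = ≤-resp (+-cong (≃-sym (∑ℝ-last (suc n) f)) ≃-refl) e
    (+-mono-≤ (+-mono-≤ (≤-refl {S (suc n)}) (f≤Δg n)) (≤-refl {g (suc n)}))
    where
    e₀ : ∀ s a b → (s ℚ.+ (a ℚ.- b)) ℚ.+ b ≡ s ℚ.+ a
    e₀ s a b = solve (s ∷ a ∷ b ∷ []) ℚ-acr
    e : (S (suc n) + (g n - g (suc n))) + g (suc n) ≃ S (suc n) + g n
    e = pointwise λ t → e₀ (seq (S (suc n)) t) (seq (g n) t) (seq (g (suc n)) t)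

  S-mono : ∀ {m n} → m ℕ.≤ n → S m ≤ S n
  S-mono m≤n = increasing S S-step (ℕₚ.≤⇒≤′ m≤n)

  S-upper : ∀ {N n} → suc N ℕ.≤ n → S n ≤ S (suc N) + g N
  S-upper {N} {suc n} (ℕ.s≤s N≤n) = ≤-trans
    (≤-resp (ℝR.+-identityʳ (S (suc n))) ≃-refl (+-mono-≤ (≤-refl {S (suc n)}) (0≤g n)))
    (decreasing U U-step (ℕₚ.≤⇒≤′ N≤n))

√+√ : ℕ → ℝ
√+√ a = √ a + √ (suc a)

1≤√+√ : ∀ a → 1ℝ ≤ √+√ a
1≤√+√ a = ≤-resp (ℝR.+-identityˡ 1ℝ) ≃-refl
  (+-mono-≤ (0≤√ a) (√-lower 1 (suc a) (ℕ.s≤s ℕ.z≤n)))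

0<√+√ : ∀ a → 0ℝ < √+√ a
0<√+√ a = <-≤-trans (ι-mono-< 0<1) (1≤√+√ a)

-- 1 / (√(n+ν) + √(n+ν+1))^m
τ-term : (n m ν : ℕ) → ℝ
τ-term n m ν = recip (√+√ (n ℕ.+ ν) ^ m) (^-pos m (0<√+√ (n ℕ.+ ν)))

δ : ℕ → ℝ
δ a = recip (√+√ a) (0<√+√ a)

0≤δ : ∀ a → 0ℝ ≤ δ a
0≤δ a = 0≤recip (√+√ a) (0<√+√ a)

δ≤1 : ∀ a → δ a ≤ 1ℝ
δ≤1 a = ≤-resp (ℝR.*-identityˡ (δ a)) (*-recip (√+√ a) (0<√+√ a))
  (*-mono-≤ (<⇒≤ (ι-mono-< 0<1)) (0≤δ a) (1≤√+√ a) (≤-refl {δ a}))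

δ≃Δ√ : ∀ a → δ a ≃ √ (suc a) - √ a
δ≃Δ√ a = recip-unique (√+√ a) (0<√+√ a) (≃-trans e₁
  (≃-trans (+-cong (√*√ (suc a)) (-‿cong (√*√ a))) e₂))
  where
  e₀ : ∀ x y → (x ℚ.+ y) ℚ.* (y ℚ.- x) ≡ y ℚ.* y ℚ.- x ℚ.* x
  e₀ x y = solve (x ∷ y ∷ []) ℚ-acr
  e₁ : √+√ a * (√ (suc a) - √ a) ≃ √ (suc a) * √ (suc a) - √ a * √ a
  e₁ = pointwise λ t → e₀ (√-seq a t) (√-seq (suc a) t)
  e₃ : ∀ x → (1ℚ ℚ.+ x) ℚ.- x ≡ 1ℚ
  e₃ x = solve (x ∷ []) ℚ-acr
  e₂ : ι (fromℕ (suc a)) - ι (fromℕ a) ≃ 1ℝ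
  e₂ = pointwise λ _ → trans (cong (ℚ._- fromℕ a) (fromℕ-+ 1 a)) (e₃ (fromℕ a))

Δδ : ∀ a → δ a - δ (suc a) ≃ (δ a * δ (suc a)) * (δ a + δ (suc a))
Δδ a = begin
  D - E                          ≈⟨ +-cong (ℝR.*-identityʳ D) (-‿cong (ℝR.*-identityʳ E)) ⟨
  D * 1ℝ - E * 1ℝ                ≈⟨ +-cong (*-cong (≃-refl {D}) (*-recip t (0<√+√ (suc a))))
                                           (-‿cong (*-cong (≃-refl {E}) (*-recip s (0<√+√ a)))) ⟨
  D * (t * E) - E * (s * D)      ≈⟨ pointwise (λ n → e₁ (seq D n) (seq E n) (√-seq a n) (√-seq (suc a) n) (√-seq (suc (suc a)) n)) ⟩
  (D * E) * ((y - x) + (z - y))  ≈⟨ *-cong (≃-refl {D * E}) (+-cong (δ≃Δ√ a) (δ≃Δ√ (suc a))) ⟨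
  (D * E) * (D + E)              ∎
  where
  open import Relation.Binary.Reasoning.Setoid ℝR.setoid
  D = δ a
  E = δ (suc a)
  s = √+√ a
  t = √+√ (suc a)
  x = √ a
  y = √ (suc a)
  z = √ (suc (suc a))
  e₁ : ∀ D E x y z → D ℚ.* ((y ℚ.+ z) ℚ.* E) ℚ.- E ℚ.* ((x ℚ.+ y) ℚ.* D)
    ≡ (D ℚ.* E) ℚ.* ((y ℚ.- x) ℚ.+ (z ℚ.- y))
  e₁ D E x y z = solve (D ∷ E ∷ x ∷ y ∷ z ∷ []) ℚ-acr

δ-antitone : ∀ a → δ (suc a) ≤ δ a
δ-antitone a = ≤-from (≃-sym (Δδ a))
  (0≤-* (0≤-* (0≤δ a) (0≤δ (suc a))) (0≤-+ (0≤δ a) (0≤δ (suc a))))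

δ³≤Δδ : ∀ a → δ (suc a) ^ 3 ≤ δ a - δ (suc a)
δ³≤Δδ a = ≤-resp e (≃-sym (Δδ a))
  (*-mono-≤ (0≤-* 0≤E 0≤E) 0≤E
    (*-mono-≤ 0≤E 0≤E (δ-antitone a) (≤-refl {E}))
    (≤-resp (ℝR.+-identityˡ E) ≃-refl (+-mono-≤ (0≤δ a) (≤-refl {E}))))
  where
  E = δ (suc a)
  0≤E = 0≤δ (suc a)
  e₀ : ∀ E → (E ℚ.* E) ℚ.* E ≡ E ℚ.* (E ℚ.* (E ℚ.* 1ℚ))
  e₀ E = solve (E ∷ []) ℚ-acr
  e : (E * E) * E ≃ E ^ 3
  e = pointwise λ n → e₀ (seq E n)

δ^-antitone : ∀ a {k m} → k ℕ.≤′ m → δ a ^ m ≤ δ a ^ k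
δ^-antitone a = decreasing (δ a ^_) λ n → ≤-resp ≃-refl (ℝR.*-identityˡ (δ a ^ n))
  (*-mono-≤ (0≤δ a) (0≤^ n (0≤δ a)) (δ≤1 a) (≤-refl {δ a ^ n}))

δ-small : ∀ q a → suc q ℕ.* suc q ℕ.≤ a → δ a ≤ ι (1/suc q)
δ-small q a q²≤a = ≤-resp e₁ (ℝR.*-identityˡ (ι (1/suc q)))
  (*-mono-≤ (0≤-* 0≤Q (0≤δ a)) (ι-mono-≤ (ℚₚ.<⇒≤ (1/suc>0 q))) Qδ≤1 (≤-refl {ι (1/suc q)}))
  where
  Q = ι (fromℕ (suc q))
  0≤Q : 0ℝ ≤ Q
  0≤Q = ι-mono-≤ (0≤fromℕ (suc q))
  Q≤s : Q ≤ √+√ a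
  Q≤s = ≤-resp (ℝR.+-identityʳ Q) ≃-refl (+-mono-≤ (√-lower (suc q) a q²≤a) (0≤√ (suc a)))
  Qδ≤1 : Q * δ a ≤ 1ℝ
  Qδ≤1 = ≤-resp ≃-refl (*-recip (√+√ a) (0<√+√ a)) (*-mono-≤ 0≤Q (0≤δ a) Q≤s (≤-refl {δ a}))
  e₀ : ∀ D Q i → i ℚ.* Q ≡ 1ℚ → (Q ℚ.* D) ℚ.* i ≡ D
  e₀ D Q i h = trans (rearrange D Q i) (trans (cong (ℚ._* D) h) (ℚₚ.*-identityˡ D))
    where
    rearrange : ∀ D Q i → (Q ℚ.* D) ℚ.* i ≡ (i ℚ.* Q) ℚ.* D
    rearrange D Q i = solve (D ∷ Q ∷ i ∷ []) ℚ-acr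
  e₁ : (Q * δ a) * ι (1/suc q) ≃ δ a
  e₁ = pointwise λ n → e₀ (seq (δ a) n) (fromℕ (suc q)) (1/suc q) (/-*-fromℕ 1 q)

τ-term≃δ^ : ∀ n m ν → τ-term n m ν ≃ δ (n ℕ.+ ν) ^ m
τ-term≃δ^ n m ν = recip-unique (√+√ (n ℕ.+ ν) ^ m) (^-pos m (0<√+√ (n ℕ.+ ν)))
  (^-inverse m (*-recip (√+√ (n ℕ.+ ν)) (0<√+√ (n ℕ.+ ν))))

opaque
  τ-cauchy : ∀ n m → 3 ℕ.≤ m → IsCauchyℝ (λ N → ∑ℝ[ ν < N ] τ-term n m ν)
  τ-cauchy n m 3≤m = telescoping-cauchy (τ-term n m) (λ ν → δ (n ℕ.+ ν))
    (λ ν → 0≤recip (√+√ (n ℕ.+ ν) ^ m) (^-pos m (0<√+√ (n ℕ.+ ν))))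
    (λ ν → 0≤δ (n ℕ.+ ν))
    (λ ν → ≤-trans (≤-reflexive (τ-term≃δ^ n m (suc ν)))
      (subst (λ a → δ a ^ m ≤ δ (n ℕ.+ ν) - δ a) (sym (ℕₚ.+-suc n ν))
        (≤-trans (δ^-antitone (suc (n ℕ.+ ν)) (ℕₚ.≤⇒≤′ 3≤m)) (δ³≤Δδ (n ℕ.+ ν)))))
    (λ ε 0<ε → let N , p = archimedean ε 0<ε in suc N ℕ.* suc N ,
      ≤-<-trans (δ-small N (n ℕ.+ suc N ℕ.* suc N) (ℕₚ.m≤n+m _ n))
        (ι-mono-< (p N ℕₚ.≤-refl)))

τ : (n m : ℕ) → 3 ℕ.≤ m → ℝ
τ n m 3≤m = lim (λ N → ∑ℝ[ ν < N ] τ-term n m ν) (τ-cauchy n m 3≤m)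

τ-converges : ∀ n m (3≤m : 3 ℕ.≤ m) → (λ N → ∑ℝ[ ν < N ] τ-term n m ν) ⟶ τ n m 3≤m
τ-converges n m 3≤m = ⟶-lim _ (τ-cauchy n m 3≤m)

falling : ℚ → ℕ → ℚ
falling α zero    = 1ℚ
falling α (suc i) = falling α i ℚ.* (α ℚ.- fromℕ i)

binom : ℚ → ℕ → ℚ
binom α i = falling α i ℚ.* (ℤ.+ 1 ℚ./ (i ℕ.!)) {{i ℕₚ.!≢0}}

-- B₀ = 1 and Bₙ = - 1/(n+1) · ∑_{j<n} (n+1 choose j) Bⱼ for n ≥ 1, which is the
-- recursion for the convention B₁ = - 1/2.
bernoulli-step : ℕ → (ℕ → ℚ) → ℚ
bernoulli-step zero      b = 1ℚ
bernoulli-step n@(suc _) b =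
  ℚ.- 1/suc n ℚ.* (∑ℚ[ j < n ] fromℕ (suc n ℕC.C j) ℚ.* b j)

-- bernoulli-below n agrees with the Bernoulli numbers on arguments below n.
bernoulli-below : ℕ → ℕ → ℚ
bernoulli-below zero    i = 0ℚ
bernoulli-below (suc n) i with i ℕₚ.≟ n
... | yes _ = bernoulli-step n (bernoulli-below n)
... | no  _ = bernoulli-below n i

bernoulli : ℕ → ℚ
bernoulli n = bernoulli-step n (bernoulli-below n)

bernoulli-below-agrees : ∀ n i → i ℕ.< n → bernoulli-below n i ≡ bernoulli i
bernoulli-below-agrees (suc n) i i<1+n with i ℕₚ.≟ n
... | yes refl = refl
... | no  i≢n  = bernoulli-below-agrees n i (ℕₚ.≤∧≢⇒< (ℕₚ.<⇒≤pred i<1+n) i≢n)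

∑ℚ-cong : ∀ n {f g} → (∀ i → i ℕ.< n → f i ≡ g i) → ∑ℚ n f ≡ ∑ℚ n g
∑ℚ-cong zero    f≡g = refl
∑ℚ-cong (suc n) f≡g = cong₂ ℚ._+_ (f≡g 0 ℕ.z<s) (∑ℚ-cong n (λ i i<n → f≡g (suc i) (ℕ.s<s i<n)))

bernoulli-rec : ∀ n → bernoulli (suc n) ≡
  ℚ.- 1/suc (suc n) ℚ.* (∑ℚ[ j < suc n ] fromℕ (suc (suc n) ℕC.C j) ℚ.* bernoulli j)
bernoulli-rec n = cong (ℚ.- 1/suc (suc n) ℚ.*_) (∑ℚ-cong (suc n) λ j j<n →
  cong (fromℕ (suc (suc n) ℕC.C j) ℚ.*_) (bernoulli-below-agrees (suc n) j j<n))

-- The power i^(k/2); the exponent k/2 is rational, not a truncated quotient.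
_^[_/2] : ℕ → ℕ → ℝ
i ^[ k /2] = (√ i) ^ k

[_/2]+1 : ℕ → ℚ
[ k /2]+1 = (ℤ.+ k ℚ./ 2) ℚ.+ 1ℚ

1/[_/2]+1 : ℕ → ℚ
1/[ k /2]+1 = (ℚ.1/ [ k /2]+1) {{ℚₚ.pos⇒nonZero [ k /2]+1 {{positive}}}}
  where
  positive : ℚ.Positive [ k /2]+1
  positive = ℚₚ.nonNeg+pos⇒pos (ℤ.+ k ℚ./ 2) {{ℚₚ.normalize-nonNeg k 2}} 1ℚ

P : ℕ → ℚ → ℚ
P k x = 1/[ k /2]+1 ℚ.* (∑ℚ[ i < suc ((k ℕ.+ 1) ℕ./ 2) ]
  binom [ k /2]+1 i ℚ.* (ℚ.- 1ℚ) ^ℚ i ℚ.* bernoulli i ℚ.* x ^ℚ ((k ℕ.+ 1) ℕ./ 2 ℕ.∸ i))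

-- For odd i ≤ k + 2 the number (k - i)/2 + 1 is computed as (k + 2 - i)/2, which
-- avoids the negative intermediate value at i = k + 2.
A : ℕ → ℕ → ℚ
A k i = 1/[ k /2]+1 ℚ.* ½ ^ℚ (i ℕ.∸ 1) ℚ.* (∑ℚ[ j < suc h ]
  binom (fromℕ (2 ℕ.* j ℕ.+ i)) j ℚ.* (ℤ.+ 1 ℚ./ 4) ^ℚ j
    ℚ.* binom [ k /2]+1 (h ℕ.∸ j) ℚ.* bernoulli (h ℕ.∸ j))
  where
  h = (k ℕ.+ 2 ℕ.∸ i) ℕ./ 2

-- The sum of A k i * τ n i over the odd i with 3 ≤ i ≤ k + 2, written as i = 3 + 2 j.
∑Aτ : ℕ → ℕ → ℝ
∑Aτ k n = ∑ℝ[ j < (k ℕ.+ 1) ℕ./ 2 ]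
  ι (A k (3 ℕ.+ 2 ℕ.* j)) * τ n (3 ℕ.+ 2 ℕ.* j) (ℕₚ.m≤m+n 3 (2 ℕ.* j))

C : ℕ → ℝ
C k = 1ℝ - ι (P k 1ℚ) - ∑Aτ k 1

{-# OPTIONS --safe #-}

-- Put d = √(n+1) - √n and u = √(n+1) + √n, so that u d = 1, τ(n, m) - τ(n+1, m) = dᵐ and
-- √(n+1), √n = (u ± d)/2.  The constant C is chosen so that the formula holds for n = 1, and its
-- increments in n agree if
--   √(n+1) P(n+1) - √n P(n) - (n+1)^(k/2) = ∑ᵢ Aᵢ dⁱ.
-- Put h = (k+1)/2 and α = k/2 + 1 = h + 1/2, and expand each odd power of (u ± d)/2 as a
-- combination of the u^(2i+1) ± d^(2i+1).  The coefficients that arise are, for m + i = h, the numbers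
--   S m α = ∑_{r+j=m} 4^r (α choose r) Bᵣ (2α-2r choose j)
-- up to a power of 2 and a sign (-1)^m.  Since z/(2 sinh (z/2)) is even, S m α vanishes for odd m,
-- so that the powers of u cancel; moreover S h (h + 1/2) = 0, so that d itself does not occur.
module Submission where

open import Algebra.Bundles using (CommutativeRing; CommutativeMonoid)
open import Data.Empty using (⊥-elim)
import Data.Integer.Base as ℤ
open import Data.List.Base using ([]; _∷_)
import Data.Nat.Base as ℕ
open import Data.Nat.Base using (ℕ; zero; suc)
import Data.Nat.Combinatorics as ℕC
open import Data.Nat.Divisibility using (_∣_; divides)
import Data.Nat.DivMod as ℕD
import Data.Nat.Properties as ℕₚ
open import Data.Product.Base using (_,_; ∃-syntax; proj₁; proj₂)
import Data.Rational.Base as ℚ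
open import Data.Rational.Base using (ℚ; 0ℚ; 1ℚ; ½)
import Data.Rational.Properties as ℚₚ
open import Data.Sum.Base using (_⊎_; inj₁; inj₂)
open import Level using (0ℓ)
open import Relation.Binary.PropositionalEquality
  using (_≡_; _≢_; refl; sym; trans; cong; cong₂; subst; module ≡-Reasoning)
open import Relation.Nullary using (¬_)
open import Tactic.RingSolver using (solve)

-- The signs (-1)^r in P change B_r at r = 1 only, where -1/2 becomes 1/2. Dropping them lowers α √n
-- P(n) by exactly α n^(k/2). They are therefore dropped at n + 1, where the difference, divided by
-- α, is the new summand (n+1)^(k/2), and kept at n, where they fit the expansion: √n = (u + (-d))/2
-- with u (-d) = -1, so that the signs combine to (-1)^m in front of S m α and evenness removes
-- them. Both expansions then have the same coefficients, and their difference retains only the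
-- doubled powers of d.
--
-- For the evenness, S m α is identified with the coefficient of z^m in a sum over s of e_s (4z)^s
-- (1 + z²)^(α-s), where e_s vanishes for odd s because it contains a coefficient of z/(2 sinh
-- (z/2)). Here α is not an integer, so the expansion of (1 + z²)^β is obtained from its derivative
-- 2βz (1 + z²)^(β-1) and not by induction on the exponent.

-- Sums over the pairs i + j = n in a commutative ring.

module Antidiagonal (R : CommutativeRing 0ℓ 0ℓ) where
  open CommutativeRing R renaming (refl to ≈-refl; sym to ≈-sym; trans to ≈-trans)
  open import Relation.Binary.Reasoning.Setoid setoid

  open import Algebra.Properties.CommutativeSemigroup +-commutativeSemigroup using (interchange)
  open import Algebra.Properties.CommutativeSemigroup *-commutativeSemigroup
    using (x∙yz≈y∙xz)
  open import Algebra.Properties.Semiring.Exp semiring using (_^_)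

  -- Carrying both indices avoids the truncated difference `n ∸ i`, so that products of power series
  -- can be reindexed by structural recursion.
  ∑₊ : (ℕ → ℕ → Carrier) → ℕ → Carrier
  ∑₊ f zero    = f 0 0
  ∑₊ f (suc n) = f 0 (suc n) + ∑₊ (λ i j → f (suc i) j) n

  ∑₊-cong : ∀ {f g} n → (∀ i j → i ℕ.+ j ≡ n → f i j ≈ g i j) → ∑₊ f n ≈ ∑₊ g n
  ∑₊-cong zero    f≈g = f≈g 0 0 refl
  ∑₊-cong (suc n) f≈g = +-cong (f≈g 0 (suc n) refl)
    (∑₊-cong n λ i j i+j≡n → f≈g (suc i) j (cong suc i+j≡n))

  ∑₊-last : ∀ f n → ∑₊ f (suc n) ≈ ∑₊ (λ i j → f i (suc j)) n + f (suc n) 0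
  ∑₊-last f zero    = ≈-refl
  ∑₊-last f (suc n) = ≈-trans (+-congˡ (∑₊-last (λ i j → f (suc i) j) n)) (≈-sym (+-assoc _ _ _))

  ∑₊-flip : ∀ f n → ∑₊ f n ≈ ∑₊ (λ i j → f j i) n
  ∑₊-flip f zero    = ≈-refl
  ∑₊-flip f (suc n) = ≈-trans (+-congˡ (∑₊-flip (λ i j → f (suc i) j) n))
    (≈-trans (+-comm _ _) (≈-sym (∑₊-last (λ i j → f j i) n)))

  ∑₊-+ : ∀ f g n → ∑₊ (λ i j → f i j + g i j) n ≈ ∑₊ f n + ∑₊ g n
  ∑₊-+ f g zero    = ≈-refl
  ∑₊-+ f g (suc n) = ≈-trans (+-congˡ (∑₊-+ (λ i j → f (suc i) j) (λ i j → g (suc i) j) n))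
    (interchange _ _ _ _)

  *-∑₊ : ∀ x f n → x * ∑₊ f n ≈ ∑₊ (λ i j → x * f i j) n
  *-∑₊ x f zero    = ≈-refl
  *-∑₊ x f (suc n) = ≈-trans (distribˡ x _ _) (+-congˡ (*-∑₊ x (λ i j → f (suc i) j) n))

  -- Both sides run over the triples j + k + l = n; the induction peels off the terms with j = 0.
  ∑₊-assoc : ∀ (f : ℕ → ℕ → ℕ → Carrier) n →
    ∑₊ (λ i l → ∑₊ (λ j k → f j k l) i) n ≈ ∑₊ (λ j i → ∑₊ (λ k l → f j k l) i) n
  ∑₊-assoc f zero    = ≈-refl
  ∑₊-assoc f (suc n) = begin
    f 0 0 (suc n) + ∑₊ (λ i l → f 0 (suc i) l + ∑₊ (λ j k → f (suc j) k l) i) n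
      ≈⟨ +-congˡ (∑₊-+ (λ i l → f 0 (suc i) l) _ n) ⟩
    f 0 0 (suc n) + (∑₊ (λ i l → f 0 (suc i) l) n + ∑₊ (λ i l → ∑₊ (λ j k → f (suc j) k l) i) n)
      ≈⟨ +-assoc _ _ _ ⟨
    ∑₊ (f 0) (suc n) + ∑₊ (λ i l → ∑₊ (λ j k → f (suc j) k l) i) n
      ≈⟨ +-congˡ (∑₊-assoc (λ j → f (suc j)) n) ⟩
    ∑₊ (f 0) (suc n) + ∑₊ (λ j i → ∑₊ (λ k l → f (suc j) k l) i) n ∎

  -- Each pair is matched with its mirror image. The total is odd, so there is no middle term and
  -- the two indices differ by an odd number 2i + 1.
  ∑₊-odd : ∀ f n → ∑₊ f (suc (n ℕ.* 2)) ≈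
    ∑₊ (λ j i → f j (suc (i ℕ.* 2) ℕ.+ j) + f (suc (i ℕ.* 2) ℕ.+ j) j) n
  ∑₊-odd f zero    = ≈-refl
  ∑₊-odd f (suc n) = begin
    f 0 (3 ℕ.+ m) + ∑₊ (λ i j → f (suc i) j) (2 ℕ.+ m)
      ≈⟨ +-congˡ (∑₊-last (λ i j → f (suc i) j) (suc m)) ⟩
    f 0 (3 ℕ.+ m) + (∑₊ (λ i j → f (suc i) (suc j)) (suc m) + f (3 ℕ.+ m) 0)
      ≈⟨ +-congˡ (+-comm _ _) ⟩
    f 0 (3 ℕ.+ m) + (f (3 ℕ.+ m) 0 + ∑₊ (λ i j → f (suc i) (suc j)) (suc m))
      ≈⟨ +-assoc _ _ _ ⟨
    (f 0 (3 ℕ.+ m) + f (3 ℕ.+ m) 0) + ∑₊ (λ i j → f (suc i) (suc j)) (suc m)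
      ≈⟨ +-cong (reflexive (cong₂ (λ s t → f 0 s + f t 0) (p m) (p m)))
           (≈-trans (∑₊-odd (λ i j → f (suc i) (suc j)) n)
             (∑₊-cong n λ j i _ → reflexive (cong₂ (λ s t → f (suc j) s + f t (suc j)) (q i j) (q i j)))) ⟩
    ∑₊ (λ j i → f j (suc (i ℕ.* 2) ℕ.+ j) + f (suc (i ℕ.* 2) ℕ.+ j) j) (suc n) ∎
    where
    m = n ℕ.* 2
    p : ∀ m → 3 ℕ.+ m ≡ 3 ℕ.+ m ℕ.+ 0
    p m = sym (ℕₚ.+-identityʳ (3 ℕ.+ m))
    q : ∀ i j → suc (suc (i ℕ.* 2) ℕ.+ j) ≡ suc (i ℕ.* 2) ℕ.+ suc j
    q i j = sym (ℕₚ.+-suc (suc (i ℕ.* 2)) j)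

  -- The product rule and exponential series, with a weight μ in the role of the embedding of ℕ.

  module Weighted
    (μ : ℕ → Carrier) (μ0≈0 : μ 0 ≈ 0#) (μ-+ : ∀ m n → μ (m ℕ.+ n) ≈ μ m + μ n)
    where

    -- For i + j = n + 1 the weight `μ (suc n)` splits as `μ i + μ j`, and the boundary terms with
    -- `μ 0` drop out. This stands in for differentiating a product of power series.
    ∑₊-leibniz : ∀ f n → μ (suc n) * ∑₊ f (suc n) ≈
      ∑₊ (λ i j → μ (suc i) * f (suc i) j) n + ∑₊ (λ i j → μ (suc j) * f i (suc j)) n
    ∑₊-leibniz f n = begin
      μ (suc n) * ∑₊ f (suc n)
        ≈⟨ *-∑₊ (μ (suc n)) f (suc n) ⟩
      ∑₊ (λ i j → μ (suc n) * f i j) (suc n)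
        ≈⟨ ∑₊-cong (suc n) (λ i j i+j≡n → ≈-trans
             (*-congʳ (≈-trans (reflexive (cong μ (sym i+j≡n))) (μ-+ i j))) (distribʳ (f i j) _ _)) ⟩
      ∑₊ (λ i j → μ i * f i j + μ j * f i j) (suc n)
        ≈⟨ ∑₊-+ (λ i j → μ i * f i j) (λ i j → μ j * f i j) (suc n) ⟩
      ∑₊ (λ i j → μ i * f i j) (suc n) + ∑₊ (λ i j → μ j * f i j) (suc n)
        ≈⟨ +-cong (≈-trans (+-congʳ (vanish (f 0 (suc n)))) (+-identityˡ _))
             (≈-trans (∑₊-last (λ i j → μ j * f i j) n)
               (≈-trans (+-congˡ (vanish (f (suc n) 0))) (+-identityʳ _))) ⟩
      ∑₊ (λ i j → μ (suc i) * f (suc i) j) n + ∑₊ (λ i j → μ (suc j) * f i (suc j)) n ∎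
      where
      vanish : ∀ x → μ 0 * x ≈ 0#
      vanish x = ≈-trans (*-congʳ μ0≈0) (zeroˡ x)

    module Exponential
      (ω : ℕ → Carrier) (ω0≈1 : ω 0 ≈ 1#) (μω : ∀ n → μ (suc n) * ω (suc n) ≈ ω n)
      (μ-cancel : ∀ n {x y} → μ (suc n) * x ≈ μ (suc n) * y → x ≈ y)
      where

      exp : Carrier → ℕ → Carrier
      exp x n = ω n * x ^ n

      μ-exp : ∀ x n → μ (suc n) * exp x (suc n) ≈ x * exp x n
      μ-exp x n = ≈-trans (≈-sym (*-assoc _ _ _)) (≈-trans (*-congʳ (μω n)) (x∙yz≈y∙xz _ _ _))

      -- The coefficientwise form of exp (x t) exp (y t) = exp ((x + y) t): both sides
      -- solve the recursion (n + 1) aₙ₊₁ = (x + y) aₙ.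
      exp-+ : ∀ x y n → ∑₊ (λ i j → exp x i * exp y j) n ≈ exp (x + y) n
      exp-+ x y zero = ≈-trans (*-cong (e x) (e y)) (≈-trans (*-identityˡ 1#) (≈-sym (e (x + y))))
        where
        e : ∀ z → exp z 0 ≈ 1#
        e z = ≈-trans (*-identityʳ (ω 0)) ω0≈1
      exp-+ x y (suc n) = μ-cancel n (begin
        μ (suc n) * ∑₊ (λ i j → exp x i * exp y j) (suc n)
          ≈⟨ ∑₊-leibniz (λ i j → exp x i * exp y j) n ⟩
        ∑₊ (λ i j → μ (suc i) * (exp x (suc i) * exp y j)) n
          + ∑₊ (λ i j → μ (suc j) * (exp x i * exp y (suc j))) n
          ≈⟨ +-cong (∑₊-cong n λ i j _ → ≈-trans (≈-sym (*-assoc _ (exp x (suc i)) (exp y j)))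
                      (≈-trans (*-congʳ (μ-exp x i)) (*-assoc x (exp x i) (exp y j))))
                    (∑₊-cong n λ i j _ → ≈-trans (x∙yz≈y∙xz _ (exp x i) (exp y (suc j)))
                      (≈-trans (*-congˡ (μ-exp y j)) (x∙yz≈y∙xz (exp x i) y (exp y j)))) ⟩
        ∑₊ (λ i j → x * (exp x i * exp y j)) n + ∑₊ (λ i j → y * (exp x i * exp y j)) n
          ≈⟨ +-cong (*-∑₊ x _ n) (*-∑₊ y _ n) ⟨
        x * ∑₊ (λ i j → exp x i * exp y j) n + y * ∑₊ (λ i j → exp x i * exp y j) n
          ≈⟨ distribʳ _ x y ⟨
        (x + y) * ∑₊ (λ i j → exp x i * exp y j) n
          ≈⟨ *-congˡ (exp-+ x y n) ⟩
        (x + y) * exp (x + y) n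
          ≈⟨ μ-exp (x + y) n ⟨
        μ (suc n) * exp (x + y) (suc n) ∎)

-- Reciprocal factorials and binomial coefficients with rational upper argument.

module RationalIdentities where
  open import Data.Rational.Base using (_+_; _*_; _-_; -_)
  open import Defs using
    ( ℚ-acr; module ℚ-Lemmas; module ℕ-in-ℚ; fromℕ; _^ℚ_; ∑ℚ; falling; binom
    ; bernoulli; bernoulli-rec; [_/2]+1; 1/[_/2]+1; A; P )
  open import Algebra.Properties.Semiring.Exp
    (CommutativeRing.semiring ℚₚ.+-*-commutativeRing) using (^-homo-*)
  open import Algebra.Properties.CommutativeSemiring.Exp
    (CommutativeRing.commutativeSemiring ℚₚ.+-*-commutativeRing) using (^-distrib-*)
  open ℕ-in-ℚ
  open ℚ-Lemmas
  open Antidiagonal ℚₚ.+-*-commutativeRing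
  open Weighted fromℕ refl fromℕ-+

  *-cancelˡ-≢0 : ∀ c {x y} → c ≢ 0ℚ → c * x ≡ c * y → x ≡ y
  *-cancelˡ-≢0 c {x} {y} c≢0 cx≡cy = trans (sym (undo x)) (trans (cong (inv c *_) cx≡cy) (undo y))
    where
    undo : ∀ z → inv c * (c * z) ≡ z
    undo z = trans (sym (ℚₚ.*-assoc (inv c) c z)) (trans
      (cong (_* z) (trans (ℚₚ.*-comm (inv c) c) (*-inv c≢0))) (ℚₚ.*-identityˡ z))

  fromℕ-cancel : ∀ n {x y} → fromℕ (suc n) * x ≡ fromℕ (suc n) * y → x ≡ y
  fromℕ-cancel n = *-cancelˡ-≢0 (fromℕ (suc n)) (0<⇒≢0 (0<fromℕ-suc n))

  -- The second factor of `binom`, so that `binom α i` unfolds to `falling α i * 1/! i`.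
  1/! : ℕ → ℚ
  1/! n = (ℤ.+ 1 ℚ./ (n ℕ.!)) {{n ℕₚ.!≢0}}

  1/!-! : ∀ n → fromℕ (n ℕ.!) * 1/! n ≡ 1ℚ
  1/!-! n = trans (ℚₚ.*-comm (fromℕ (n ℕ.!)) (1/! n)) (go (n ℕ.!) {{n ℕₚ.!≢0}})
    where
    go : ∀ m .{{_ : ℕ.NonZero m}} → (ℤ.+ 1 ℚ./ m) * fromℕ m ≡ 1ℚ
    go (suc m) = /-*-fromℕ 1 m

  *-1/!-suc : ∀ n → fromℕ (suc n) * 1/! (suc n) ≡ 1/! n
  *-1/!-suc n = begin
    s * 1/! (suc n)                           ≡⟨ ℚₚ.*-identityʳ _ ⟨
    s * 1/! (suc n) * 1ℚ                      ≡⟨ cong (s * 1/! (suc n) *_) (1/!-! n) ⟨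
    s * 1/! (suc n) * (f * 1/! n)             ≡⟨ rearrange s (1/! (suc n)) f (1/! n) ⟩
    1/! n * ((s * f) * 1/! (suc n))           ≡⟨ cong (λ t → 1/! n * (t * 1/! (suc n))) (fromℕ-* (suc n) (n ℕ.!)) ⟨
    1/! n * (fromℕ (suc n ℕ.!) * 1/! (suc n)) ≡⟨ cong (1/! n *_) (1/!-! (suc n)) ⟩
    1/! n * 1ℚ                                ≡⟨ ℚₚ.*-identityʳ _ ⟩
    1/! n                                     ∎
    where
    open ≡-Reasoning
    s = fromℕ (suc n)
    f = fromℕ (n ℕ.!)
    rearrange : ∀ a b c d → a * b * (c * d) ≡ d * ((a * c) * b)
    rearrange a b c d = solve (a ∷ b ∷ c ∷ d ∷ []) ℚ-acr

  open Exponential 1/! refl *-1/!-suc fromℕ-cancel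

  falling-suc : ∀ α i → falling α (suc i) ≡ α * falling (α - 1ℚ) i
  falling-suc α zero    = e α
    where
    e : ∀ α → 1ℚ * (α - 0ℚ) ≡ α * 1ℚ
    e α = solve (α ∷ []) ℚ-acr
  falling-suc α (suc i) = trans
    (cong₂ (λ s t → s * (α - t)) (falling-suc α i) (fromℕ-+ 1 i))
    (e α (falling (α - 1ℚ) i) (fromℕ i))
    where
    e : ∀ α f i → α * f * (α - (1ℚ + i)) ≡ α * (f * (α - 1ℚ - i))
    e α f i = solve (α ∷ f ∷ i ∷ []) ℚ-acr

  falling-+ : ∀ α s t → falling α (s ℕ.+ t) ≡ falling α s * falling (α - fromℕ s) t
  falling-+ α s zero = trans (cong (falling α) (ℕₚ.+-identityʳ s)) (sym (ℚₚ.*-identityʳ (falling α s)))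
  falling-+ α s (suc t) = trans (cong (falling α) (ℕₚ.+-suc s t)) (trans
    (cong₂ (λ x y → x * (α - y)) (falling-+ α s t) (fromℕ-+ s t))
    (e α (fromℕ s) (fromℕ t) (falling α s) (falling (α - fromℕ s) t)))
    where
    e : ∀ α s t f g → f * g * (α - (s + t)) ≡ f * (g * (α - s - t))
    e α s t f g = solve (α ∷ s ∷ t ∷ f ∷ g ∷ []) ℚ-acr

  binom-step : ∀ α i → fromℕ (suc i) * binom α (suc i) ≡ (α - fromℕ i) * binom α i
  binom-step α i = trans (e₁ (fromℕ (suc i)) (falling α i) (α - fromℕ i) (1/! (suc i)))
    (trans (cong (falling α i * (α - fromℕ i) *_) (*-1/!-suc i))
      (e₂ (falling α i) (α - fromℕ i) (1/! i)))
    where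
    e₁ : ∀ s f x v → s * (f * x * v) ≡ f * x * (s * v)
    e₁ s f x v = solve (s ∷ f ∷ x ∷ v ∷ []) ℚ-acr
    e₂ : ∀ f x v → f * x * v ≡ x * (f * v)
    e₂ f x v = solve (f ∷ x ∷ v ∷ []) ℚ-acr

  binom-absorb : ∀ α i → fromℕ (suc i) * binom α (suc i) ≡ α * binom (α - 1ℚ) i
  binom-absorb α i = trans (cong (λ t → fromℕ (suc i) * (t * 1/! (suc i))) (falling-suc α i))
    (trans (e₁ (fromℕ (suc i)) α (falling (α - 1ℚ) i) (1/! (suc i)))
      (cong (λ t → α * (falling (α - 1ℚ) i * t)) (*-1/!-suc i)))
    where
    e₁ : ∀ s f x v → s * (f * x * v) ≡ f * (x * (s * v))
    e₁ s f x v = solve (s ∷ f ∷ x ∷ v ∷ []) ℚ-acr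

  -- The upper argument is an arbitrary rational. After multiplication by q + 1, `binom-absorb` and
  -- `binom-step` express every term through `binom x q`.
  pascal : ∀ x q → binom (x + 1ℚ) (suc q) ≡ binom x (suc q) + binom x q
  pascal x q = fromℕ-cancel q (begin
    s * binom (x + 1ℚ) (suc q)             ≡⟨ binom-absorb (x + 1ℚ) q ⟩
    (x + 1ℚ) * binom (x + 1ℚ - 1ℚ) q       ≡⟨ cong (λ t → (x + 1ℚ) * binom t q) (e₁ x) ⟩
    (x + 1ℚ) * binom x q                   ≡⟨ e₂ x (fromℕ q) (binom x q) ⟩
    (x - fromℕ q) * binom x q + (1ℚ + fromℕ q) * binom x q
      ≡⟨ cong₂ (λ a b → a + b * binom x q) (binom-step x q) (fromℕ-+ 1 q) ⟨
    s * binom x (suc q) + s * binom x q    ≡⟨ ℚₚ.*-distribˡ-+ s (binom x (suc q)) (binom x q) ⟨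
    s * (binom x (suc q) + binom x q)      ∎)
    where
    open ≡-Reasoning
    s = fromℕ (suc q)
    e₁ : ∀ x → x + 1ℚ - 1ℚ ≡ x
    e₁ x = solve (x ∷ []) ℚ-acr
    e₂ : ∀ x q b → (x + 1ℚ) * b ≡ (x - q) * b + (1ℚ + q) * b
    e₂ x q b = solve (x ∷ q ∷ b ∷ []) ℚ-acr

  2ℚ 4ℚ : ℚ
  2ℚ = fromℕ 2
  4ℚ = fromℕ 4

  fromℕ-suc-1 : ∀ n → fromℕ (suc n) - 1ℚ ≡ fromℕ n
  fromℕ-suc-1 n = trans (cong (_- 1ℚ) (fromℕ-+ 1 n)) (e (fromℕ n))
    where
    e : ∀ x → 1ℚ + x - 1ℚ ≡ x
    e x = solve (x ∷ []) ℚ-acr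

  falling-! : ∀ i j → falling (fromℕ (i ℕ.+ j)) i * fromℕ (j ℕ.!) ≡ fromℕ ((i ℕ.+ j) ℕ.!)
  falling-! zero    j = ℚₚ.*-identityˡ (fromℕ (j ℕ.!))
  falling-! (suc i) j = begin
    falling s (suc i) * fromℕ (j ℕ.!)         ≡⟨ cong (_* fromℕ (j ℕ.!)) (falling-suc s i) ⟩
    s * falling (s - 1ℚ) i * fromℕ (j ℕ.!)    ≡⟨ ℚₚ.*-assoc s (falling (s - 1ℚ) i) (fromℕ (j ℕ.!)) ⟩
    s * (falling (s - 1ℚ) i * fromℕ (j ℕ.!))
      ≡⟨ cong (λ t → s * (falling t i * fromℕ (j ℕ.!))) (fromℕ-suc-1 (i ℕ.+ j)) ⟩
    s * (falling (fromℕ (i ℕ.+ j)) i * fromℕ (j ℕ.!)) ≡⟨ cong (s *_) (falling-! i j) ⟩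
    s * fromℕ ((i ℕ.+ j) ℕ.!)                 ≡⟨ fromℕ-* (suc (i ℕ.+ j)) ((i ℕ.+ j) ℕ.!) ⟨
    fromℕ (suc (i ℕ.+ j) ℕ.!)                 ∎
    where
    open ≡-Reasoning
    s = fromℕ (suc (i ℕ.+ j))

  binom-! : ∀ i j → binom (fromℕ (i ℕ.+ j)) i ≡ fromℕ ((i ℕ.+ j) ℕ.!) * (1/! i * 1/! j)
  binom-! i j = begin
    f * 1/! i                                ≡⟨ ℚₚ.*-identityʳ (f * 1/! i) ⟨
    f * 1/! i * 1ℚ                           ≡⟨ cong (f * 1/! i *_) (1/!-! j) ⟨
    f * 1/! i * (fromℕ (j ℕ.!) * 1/! j)      ≡⟨ e f (1/! i) (fromℕ (j ℕ.!)) (1/! j) ⟩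
    f * fromℕ (j ℕ.!) * (1/! i * 1/! j)      ≡⟨ cong (_* (1/! i * 1/! j)) (falling-! i j) ⟩
    fromℕ ((i ℕ.+ j) ℕ.!) * (1/! i * 1/! j)  ∎
    where
    open ≡-Reasoning
    f = falling (fromℕ (i ℕ.+ j)) i
    e : ∀ a b c d → a * b * (c * d) ≡ a * c * (b * d)
    e a b c d = solve (a ∷ b ∷ c ∷ d ∷ []) ℚ-acr

  binom-sym : ∀ i j → binom (fromℕ (i ℕ.+ j)) i ≡ binom (fromℕ (j ℕ.+ i)) j
  binom-sym i j = trans (binom-! i j) (trans
    (cong₂ (λ n x → fromℕ (n ℕ.!) * x) (ℕₚ.+-comm i j) (ℚₚ.*-comm (1/! i) (1/! j)))
    (sym (binom-! j i)))

  C≡binom : ∀ n k → fromℕ (n ℕC.C k) ≡ binom (fromℕ n) k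
  C≡binom zero    zero    = refl
  C≡binom zero    (suc k) = sym (trans (cong (_* 1/! (suc k)) (falling-suc 0ℚ k)) (e (falling (0ℚ - 1ℚ) k) (1/! (suc k))))
    where
    e : ∀ a b → 0ℚ * a * b ≡ 0ℚ
    e a b = solve (a ∷ b ∷ []) ℚ-acr
  C≡binom (suc n) zero    = refl
  C≡binom (suc n) (suc k) = begin
    fromℕ (suc n ℕC.C suc k)                   ≡⟨ cong fromℕ (ℕC.nCk+nC[k+1]≡[n+1]C[k+1] n k) ⟨
    fromℕ (n ℕC.C k ℕ.+ n ℕC.C suc k)          ≡⟨ fromℕ-+ (n ℕC.C k) (n ℕC.C suc k) ⟩
    fromℕ (n ℕC.C k) + fromℕ (n ℕC.C suc k)    ≡⟨ cong₂ _+_ (C≡binom n k) (C≡binom n (suc k)) ⟩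
    binom (fromℕ n) k + binom (fromℕ n) (suc k) ≡⟨ ℚₚ.+-comm (binom (fromℕ n) k) _ ⟩
    binom (fromℕ n) (suc k) + binom (fromℕ n) k ≡⟨ pascal (fromℕ n) k ⟨
    binom (fromℕ n + 1ℚ) (suc k)               ≡⟨ cong (λ x → binom x (suc k)) (trans (ℚₚ.+-comm (fromℕ n) 1ℚ) (sym (fromℕ-+ 1 n))) ⟩
    binom (fromℕ (suc n)) (suc k)              ∎
    where open ≡-Reasoning

  -- The coefficients of (1 + z²)^β and their parity.

  sgn : ℕ → ℚ
  sgn n = (- 1ℚ) ^ℚ n

  -- The coefficient of zⁿ in (1 + z)^(2β) (1 - 2z/(1 + z)²)^β = (1 + z²)^β.
  T : ℕ → ℚ → ℚ
  T n β = ∑₊ (λ t q → (- 2ℚ) ^ℚ t * binom β t * binom ((β - fromℕ t) + (β - fromℕ t)) q) n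

  module _ (β : ℚ) where
    private
      γ = β - 1ℚ
      y : ℕ → ℚ
      y t = (γ - fromℕ t) + (γ - fromℕ t)
      h : ℕ → ℕ → ℚ
      h t q = (- 2ℚ) ^ℚ t * binom γ t * (binom (y t + 1ℚ) q - binom (y t) q)

    -- Differentiating z^t gives terms with (1 + z)^(y t), differentiating the power of 1 + z gives
    -- terms with (1 + z)^(y t + 1). Both acquire the factor 2β, because (t + 1) `binom β (suc t)`
    -- and (β - t) `binom β t` both equal β `binom γ t`. The difference of the two powers is
    -- collected in `h`.
    T-suc : ∀ n → fromℕ (suc n) * T (suc n) β ≡ (β + β) * ∑₊ h n
    T-suc n = begin
      fromℕ (suc n) * T (suc n) β
        ≡⟨ ∑₊-leibniz f n ⟩
      ∑₊ (λ t q → fromℕ (suc t) * f (suc t) q) n + ∑₊ (λ t q → fromℕ (suc q) * f t (suc q)) n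
        ≡⟨ cong₂ _+_ (∑₊-cong n (λ t q _ → first t q)) (∑₊-cong n (λ t q _ → second t q)) ⟩
      ∑₊ (λ t q → - ((β + β) * (p t * binom (y t) q))) n + ∑₊ (λ t q → (β + β) * (p t * binom (y t + 1ℚ) q)) n
        ≡⟨ ∑₊-+ (λ t q → - ((β + β) * (p t * binom (y t) q))) _ n ⟨
      ∑₊ (λ t q → - ((β + β) * (p t * binom (y t) q)) + (β + β) * (p t * binom (y t + 1ℚ) q)) n
        ≡⟨ ∑₊-cong n (λ t q _ → e₅ (p t) (binom (y t) q) (binom (y t + 1ℚ) q) β) ⟩
      ∑₊ (λ t q → (β + β) * h t q) n
        ≡⟨ *-∑₊ (β + β) h n ⟨
      (β + β) * ∑₊ h n ∎
      where
      open ≡-Reasoning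
      f : ℕ → ℕ → ℚ
      f t q = (- 2ℚ) ^ℚ t * binom β t * binom ((β - fromℕ t) + (β - fromℕ t)) q
      p : ℕ → ℚ
      p t = (- 2ℚ) ^ℚ t * binom γ t
      e₀ : ∀ β t → β - (1ℚ + t) ≡ β - 1ℚ - t
      e₀ β t = solve (β ∷ t ∷ []) ℚ-acr
      e₁ : ∀ s u b c → s * ((- 2ℚ * u) * b * c) ≡ - 2ℚ * u * (s * b) * c
      e₁ s u b c = solve (s ∷ u ∷ b ∷ c ∷ []) ℚ-acr
      e₂ : ∀ u β b c → - 2ℚ * u * (β * b) * c ≡ - ((β + β) * (u * b * c))
      e₂ u β b c = solve (u ∷ β ∷ b ∷ c ∷ []) ℚ-acr
      e₃ : ∀ s u b c → s * (u * b * c) ≡ u * b * (s * c)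
      e₃ s u b c = solve (s ∷ u ∷ b ∷ c ∷ []) ℚ-acr
      e₃′ : ∀ u b x c → u * b * ((x + x) * c) ≡ u * (x * b + x * b) * c
      e₃′ u b x c = solve (u ∷ b ∷ x ∷ c ∷ []) ℚ-acr
      e₄ : ∀ u β b c → u * (β * b + β * b) * c ≡ (β + β) * (u * b * c)
      e₄ u β b c = solve (u ∷ β ∷ b ∷ c ∷ []) ℚ-acr
      e₅ : ∀ p a b β → - ((β + β) * (p * a)) + (β + β) * (p * b) ≡ (β + β) * (p * (b - a))
      e₅ p a b β = solve (p ∷ a ∷ b ∷ β ∷ []) ℚ-acr
      e₆ : ∀ β t → (β - t) + (β - t) - 1ℚ ≡ (β - 1ℚ - t) + (β - 1ℚ - t) + 1ℚ
      e₆ β t = solve (β ∷ t ∷ []) ℚ-acr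
      shift : ∀ t → β - fromℕ (suc t) ≡ γ - fromℕ t
      shift t = trans (cong (λ s → β - s) (fromℕ-+ 1 t)) (e₀ β (fromℕ t))
      absorb : ∀ t → (β - fromℕ t) * binom β t ≡ β * binom γ t
      absorb t = trans (sym (binom-step β t)) (binom-absorb β t)
      first : ∀ t q → fromℕ (suc t) * f (suc t) q ≡ - ((β + β) * (p t * binom (y t) q))
      first t q = trans (e₁ (fromℕ (suc t)) ((- 2ℚ) ^ℚ t) (binom β (suc t)) _)
        (trans (cong₂ (λ b x → - 2ℚ * (- 2ℚ) ^ℚ t * b * binom (x + x) q) (binom-absorb β t) (shift t))
          (e₂ ((- 2ℚ) ^ℚ t) β (binom γ t) (binom (y t) q)))
      second : ∀ t q → fromℕ (suc q) * f t (suc q) ≡ (β + β) * (p t * binom (y t + 1ℚ) q)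
      second t q = trans (e₃ (fromℕ (suc q)) ((- 2ℚ) ^ℚ t) (binom β t) _)
        (trans (cong ((- 2ℚ) ^ℚ t * binom β t *_) (trans (binom-absorb x q)
            (cong (λ z → x * binom z q) (e₆ β (fromℕ t)))))
          (trans (e₃′ ((- 2ℚ) ^ℚ t) (binom β t) (β - fromℕ t) (binom (y t + 1ℚ) q))
            (trans (cong (λ z → (- 2ℚ) ^ℚ t * (z + z) * binom (y t + 1ℚ) q) (absorb t))
              (e₄ ((- 2ℚ) ^ℚ t) β (binom γ t) (binom (y t + 1ℚ) q)))))
        where x = (β - fromℕ t) + (β - fromℕ t)

    private
      h-zero : ∀ t → h t 0 ≡ 0ℚ
      h-zero t = e ((- 2ℚ) ^ℚ t * binom γ t)
        where
        e : ∀ x → x * 0ℚ ≡ 0ℚ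
        e x = solve (x ∷ []) ℚ-acr

    T-1 : T 1 β ≡ 0ℚ
    T-1 = fromℕ-cancel 0 (trans (T-suc 0) (trans (cong ((β + β) *_) (h-zero 0)) (e β)))
      where
      e : ∀ x → (x + x) * 0ℚ ≡ fromℕ 1 * 0ℚ
      e x = solve (x ∷ []) ℚ-acr

    -- By Pascal's rule the difference in `h` is (1 + z)^(y t) multiplied by z. So this is the
    -- derivative 2βz (1 + z²)^(β-1), read off coefficientwise.
    T-2+ : ∀ n → fromℕ (2 ℕ.+ n) * T (2 ℕ.+ n) β ≡ (β + β) * T n (β - 1ℚ)
    T-2+ n = trans (T-suc (suc n)) (cong ((β + β) *_) (begin
      ∑₊ h (suc n)                                 ≡⟨ ∑₊-last h n ⟩
      ∑₊ (λ t q → h t (suc q)) n + h (suc n) 0     ≡⟨ cong₂ _+_ (∑₊-cong n (λ t q _ → step t q)) (h-zero (suc n)) ⟩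
      T n γ + 0ℚ                                   ≡⟨ ℚₚ.+-identityʳ (T n γ) ⟩
      T n γ                                        ∎))
      where
      open ≡-Reasoning
      e : ∀ a b → a + b - a ≡ b
      e a b = solve (a ∷ b ∷ []) ℚ-acr
      step : ∀ t q → h t (suc q) ≡ (- 2ℚ) ^ℚ t * binom γ t * binom (y t) q
      step t q = cong ((- 2ℚ) ^ℚ t * binom γ t *_)
        (trans (cong (_- binom (y t) (suc q)) (pascal (y t) q)) (e (binom (y t) (suc q)) (binom (y t) q)))

  -- Evenness is phrased as invariance under (-1)^n, which needs no case distinction on parity and
  -- passes through Cauchy products. `T-2+` lowers the index by two, and `T-1` starts the odd
  -- indices at 0.
  T-even : ∀ n β → sgn n * T n β ≡ T n β
  T-even zero          β = ℚₚ.*-identityˡ (T 0 β)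
  T-even (suc zero)    β = trans (cong (sgn 1 *_) (T-1 β)) (sym (T-1 β))
  T-even (suc (suc n)) β = fromℕ-cancel (suc n) (begin
    s * (sgn (2 ℕ.+ n) * T (2 ℕ.+ n) β)   ≡⟨ e₁ s (sgn n) (T (2 ℕ.+ n) β) ⟩
    sgn n * (s * T (2 ℕ.+ n) β)           ≡⟨ cong (sgn n *_) (T-2+ β n) ⟩
    sgn n * ((β + β) * T n (β - 1ℚ))      ≡⟨ e₂ (sgn n) (β + β) (T n (β - 1ℚ)) ⟩
    (β + β) * (sgn n * T n (β - 1ℚ))      ≡⟨ cong ((β + β) *_) (T-even n (β - 1ℚ)) ⟩
    (β + β) * T n (β - 1ℚ)                ≡⟨ T-2+ β n ⟨
    s * T (2 ℕ.+ n) β                     ∎)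
    where
    open ≡-Reasoning
    s = fromℕ (2 ℕ.+ n)
    e₁ : ∀ s g t → s * ((- 1ℚ * (- 1ℚ * g)) * t) ≡ g * (s * t)
    e₁ s g t = solve (s ∷ g ∷ t ∷ []) ℚ-acr
    e₂ : ∀ g b t → g * (b * t) ≡ b * (g * t)
    e₂ g b t = solve (g ∷ b ∷ t ∷ []) ℚ-acr

  ∑ℚ≡∑₊ : ∀ n f → ∑ℚ (suc n) f ≡ ∑₊ (λ i _ → f i) n
  ∑ℚ≡∑₊ zero    f = ℚₚ.+-identityʳ (f 0)
  ∑ℚ≡∑₊ (suc n) f = cong (f 0 +_) (∑ℚ≡∑₊ n (λ i → f (suc i)))

  -- Formal power series under the Cauchy product.

  infixl 7 _⊛_
  infix 4 _≋_

  _≋_ : (ℕ → ℚ) → (ℕ → ℚ) → Set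
  f ≋ g = ∀ n → f n ≡ g n

  _⊛_ : (ℕ → ℚ) → (ℕ → ℚ) → ℕ → ℚ
  (f ⊛ g) n = ∑₊ (λ i j → f i * g j) n

  one : ℕ → ℚ
  one zero    = 1ℚ
  one (suc _) = 0ℚ

  ⊛-cong : ∀ {f f′ g g′} → f ≋ f′ → g ≋ g′ → f ⊛ g ≋ f′ ⊛ g′
  ⊛-cong p q n = ∑₊-cong n λ i j _ → cong₂ _*_ (p i) (q j)

  ⊛-comm : ∀ f g → f ⊛ g ≋ g ⊛ f
  ⊛-comm f g n = trans (∑₊-flip (λ i j → f i * g j) n) (∑₊-cong n λ i j _ → ℚₚ.*-comm (f j) (g i))

  ⊛-assoc : ∀ f g h → (f ⊛ g) ⊛ h ≋ f ⊛ (g ⊛ h)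
  ⊛-assoc f g h n = begin
    ∑₊ (λ i l → ∑₊ (λ j k → f j * g k) i * h l) n
      ≡⟨ ∑₊-cong n (λ i l _ → trans (ℚₚ.*-comm _ (h l)) (trans (*-∑₊ (h l) _ i)
           (∑₊-cong i λ j k _ → e (f j) (g k) (h l)))) ⟩
    ∑₊ (λ i l → ∑₊ (λ j k → f j * (g k * h l)) i) n
      ≡⟨ ∑₊-assoc (λ j k l → f j * (g k * h l)) n ⟩
    ∑₊ (λ j i → ∑₊ (λ k l → f j * (g k * h l)) i) n
      ≡⟨ ∑₊-cong n (λ j i _ → *-∑₊ (f j) (λ k l → g k * h l) i) ⟨
    ∑₊ (λ j i → f j * ∑₊ (λ k l → g k * h l) i) n ∎
    where
    open ≡-Reasoning
    e : ∀ a b c → c * (a * b) ≡ a * (b * c)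
    e a b c = solve (a ∷ b ∷ c ∷ []) ℚ-acr

  ⊛-identityˡ : ∀ f → one ⊛ f ≋ f
  ⊛-identityˡ f zero    = ℚₚ.*-identityˡ (f 0)
  ⊛-identityˡ f (suc n) = trans (cong₂ _+_ (ℚₚ.*-identityˡ (f (suc n)))
    (trans (sym (*-∑₊ 0ℚ (λ _ j → f j) n)) (ℚₚ.*-zeroˡ (∑₊ (λ _ j → f j) n)))) (ℚₚ.+-identityʳ (f (suc n)))

  ⊛-commutativeMonoid : CommutativeMonoid 0ℓ 0ℓ
  ⊛-commutativeMonoid = record
    { Carrier = ℕ → ℚ ; _≈_ = _≋_ ; _∙_ = _⊛_ ; ε = one
    ; isCommutativeMonoid = record
      { isMonoid = record
        { isSemigroup = record
          { isMagma = record
            { isEquivalence = record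
              { refl = λ _ → refl ; sym = λ p n → sym (p n) ; trans = λ p q n → trans (p n) (q n) }
            ; ∙-cong = ⊛-cong }
          ; assoc = ⊛-assoc }
        ; identity = ⊛-identityˡ , λ f n → trans (⊛-comm f one n) (⊛-identityˡ f n) }
      ; comm = ⊛-comm } }

  sgn-+ : ∀ m n → sgn (m ℕ.+ n) ≡ sgn m * sgn n
  sgn-+ = ^-homo-* (- 1ℚ)

  -- f(z) ↦ f(-z)
  reflect : (ℕ → ℚ) → ℕ → ℚ
  reflect f n = sgn n * f n

  reflect-cong : ∀ {f g} → f ≋ g → reflect f ≋ reflect g
  reflect-cong p n = cong (sgn n *_) (p n)

  reflect-⊛ : ∀ f g → reflect (f ⊛ g) ≋ reflect f ⊛ reflect g
  reflect-⊛ f g n = trans (*-∑₊ (sgn n) (λ i j → f i * g j) n)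
    (∑₊-cong n λ { i j refl → trans (cong (_* (f i * g j)) (sgn-+ i j)) (e (sgn i) (sgn j) (f i) (g j)) })
    where
    e : ∀ a b c d → a * b * (c * d) ≡ a * c * (b * d)
    e a b c d = solve (a ∷ b ∷ c ∷ d ∷ []) ℚ-acr

  reflect-one : reflect one ≋ one
  reflect-one zero    = refl
  reflect-one (suc n) = ℚₚ.*-zeroʳ (sgn (suc n))

  reflect-exp : ∀ x → reflect (exp x) ≋ exp (- x)
  reflect-exp x n = trans (e₁ (sgn n) (1/! n) (x ^ℚ n)) (cong (1/! n *_)
    (trans (sym (^-distrib-* (- 1ℚ) x n)) (cong (_^ℚ n) (e₂ x))))
    where
    e₁ : ∀ s w x → s * (w * x) ≡ w * (s * x)
    e₁ s w x = solve (s ∷ w ∷ x ∷ []) ℚ-acr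
    e₂ : ∀ x → - 1ℚ * x ≡ - x
    e₂ x = solve (x ∷ []) ℚ-acr

  exp-0 : exp 0ℚ ≋ one
  exp-0 zero    = refl
  exp-0 (suc n) = e (1/! (suc n)) (0ℚ ^ℚ n)
    where
    e : ∀ a b → a * (0ℚ * b) ≡ 0ℚ
    e a b = solve (a ∷ b ∷ []) ℚ-acr

  exp-1 : exp 1ℚ ≋ 1/!
  exp-1 n = trans (cong (1/! n *_) (go n)) (ℚₚ.*-identityʳ (1/! n))
    where
    go : ∀ n → 1ℚ ^ℚ n ≡ 1ℚ
    go zero    = refl
    go (suc n) = trans (ℚₚ.*-identityˡ (1ℚ ^ℚ n)) (go n)

  -- Generating function and parity of the Bernoulli numbers.

  -- The coefficients of z/(eᶻ - 1).
  bern : ℕ → ℚ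
  bern n = bernoulli n * 1/! n

  bernoulli≡!*bern : ∀ n → bernoulli n ≡ fromℕ (n ℕ.!) * bern n
  bernoulli≡!*bern n = sym (trans (e (fromℕ (n ℕ.!)) (bernoulli n) (1/! n))
    (trans (cong (bernoulli n *_) (1/!-! n)) (ℚₚ.*-identityʳ (bernoulli n))))
    where
    e : ∀ a b c → a * (b * c) ≡ b * (a * c)
    e a b c = solve (a ∷ b ∷ c ∷ []) ℚ-acr

  -- The coefficients of (eᶻ - 1)/z.
  expm1/z : ℕ → ℚ
  expm1/z n = 1/! (suc n)

  -- Multiplied by (n + 2)!, the coefficient becomes the sum of C(n+2, j) B_j over j ≤ n + 1. Its
  -- last term (n + 2) B_(n+1) cancels the others by the defining recursion.
  bern-⊛-expm1/z : bern ⊛ expm1/z ≋ one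
  bern-⊛-expm1/z zero    = refl
  bern-⊛-expm1/z (suc n) = *-cancelˡ-≢0 N! (λ N!≡0 → 1≢0 (trans (sym (1/!-! (2 ℕ.+ n)))
      (trans (cong (_* 1/! (2 ℕ.+ n)) N!≡0) (ℚₚ.*-zeroˡ (1/! (2 ℕ.+ n)))))) (begin
    N! * (bern ⊛ expm1/z) (suc n)
      ≡⟨ cong (N! *_) (∑₊-last (λ j i → bern j * expm1/z i) n) ⟩
    N! * (Y + bern (suc n) * 1ℚ)
      ≡⟨ e₁ N! Y (bern (suc n)) ⟩
    N! * Y + N! * bern (suc n)
      ≡⟨ cong (λ t → N! * Y + t * bern (suc n)) (fromℕ-* (2 ℕ.+ n) (suc n ℕ.!)) ⟩
    N! * Y + s * fromℕ (suc n ℕ.!) * bern (suc n)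
      ≡⟨ cong (N! * Y +_) (trans (ℚₚ.*-assoc s (fromℕ (suc n ℕ.!)) (bern (suc n)))
           (cong (s *_) (trans (sym (bernoulli≡!*bern (suc n))) (bernoulli-rec n)))) ⟩
    N! * Y + s * (- 1/suc (suc n) * ∑ℚ (suc n) (λ j → fromℕ ((2 ℕ.+ n) ℕC.C j) * bernoulli j))
      ≡⟨ cong (λ t → N! * Y + s * (- 1/suc (suc n) * t)) sum-eq ⟩
    N! * Y + s * (- 1/suc (suc n) * (N! * Y))
      ≡⟨ e₂ N! Y s (1/suc (suc n)) ⟩
    N! * Y - (1/suc (suc n) * s) * (N! * Y)
      ≡⟨ cong (λ t → N! * Y - t * (N! * Y)) (/-*-fromℕ 1 (suc n)) ⟩
    N! * Y - 1ℚ * (N! * Y)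
      ≡⟨ e₃ N! Y ⟩
    N! * 0ℚ ∎)
    where
    open ≡-Reasoning
    N! = fromℕ ((2 ℕ.+ n) ℕ.!)
    s = fromℕ (2 ℕ.+ n)
    Y = ∑₊ (λ j i → bern j * expm1/z (suc i)) n
    1≢0 : 1ℚ ≢ 0ℚ
    1≢0 ()
    e₁ : ∀ n y b → n * (y + b * 1ℚ) ≡ n * y + n * b
    e₁ n y b = solve (n ∷ y ∷ b ∷ []) ℚ-acr
    e₂ : ∀ n y s i → n * y + s * (- i * (n * y)) ≡ n * y - (i * s) * (n * y)
    e₂ n y s i = solve (n ∷ y ∷ s ∷ i ∷ []) ℚ-acr
    e₃ : ∀ n y → n * y - 1ℚ * (n * y) ≡ n * 0ℚ
    e₃ n y = solve (n ∷ y ∷ []) ℚ-acr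
    e₄ : ∀ n a c b → n * (a * c) * b ≡ n * ((b * a) * c)
    e₄ n a c b = solve (n ∷ a ∷ c ∷ b ∷ []) ℚ-acr
    sum-eq : ∑ℚ (suc n) (λ j → fromℕ ((2 ℕ.+ n) ℕC.C j) * bernoulli j) ≡ N! * Y
    sum-eq = trans (∑ℚ≡∑₊ n (λ j → fromℕ ((2 ℕ.+ n) ℕC.C j) * bernoulli j)) (sym (trans
      (*-∑₊ N! (λ j i → bern j * expm1/z (suc i)) n)
      (∑₊-cong n λ j i j+i≡n → sym (trans
        (cong (_* bernoulli j) (trans (C≡binom (2 ℕ.+ n) j) (coeff j i j+i≡n)))
        (e₄ N! (1/! j) (1/! (2 ℕ.+ i)) (bernoulli j))))))
      where
      coeff : ∀ j i → j ℕ.+ i ≡ n → binom (fromℕ (2 ℕ.+ n)) j ≡ N! * (1/! j * 1/! (2 ℕ.+ i))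
      coeff j i j+i≡n = subst (λ m → binom (fromℕ m) j ≡ fromℕ (m ℕ.!) * (1/! j * 1/! (2 ℕ.+ i)))
        (trans (ℕₚ.+-suc j (suc i)) (cong suc (trans (ℕₚ.+-suc j i) (cong suc j+i≡n))))
        (binom-! j (2 ℕ.+ i))

  -- This is e^(-z) (e^z - 1)/z = (e^(-z) - 1)/(-z). Adding and removing the boundary term i = 0
  -- completes the shifted sum to a coefficient of e^(-z) e^z = 1.
  exp-⊛-expm1/z : exp (- 1ℚ) ⊛ expm1/z ≋ reflect expm1/z
  exp-⊛-expm1/z n = begin
    X                                         ≡⟨ e₁ X (exp (- 1ℚ) (suc n)) ⟩
    X + exp (- 1ℚ) (suc n) * 1ℚ - exp (- 1ℚ) (suc n)
      ≡⟨ cong (_- exp (- 1ℚ) (suc n)) (∑₊-last (λ j i → exp (- 1ℚ) j * 1/! i) n) ⟨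
    ∑₊ (λ j i → exp (- 1ℚ) j * 1/! i) (suc n) - exp (- 1ℚ) (suc n)
      ≡⟨ cong (_- exp (- 1ℚ) (suc n)) (trans
           (∑₊-cong (suc n) (λ j i _ → cong (exp (- 1ℚ) j *_) (sym (exp-1 i))))
           (trans (exp-+ (- 1ℚ) 1ℚ (suc n)) (exp-0 (suc n)))) ⟩
    0ℚ - exp (- 1ℚ) (suc n)                   ≡⟨ e₂ (1/! (suc n)) (sgn n) ⟩
    sgn n * 1/! (suc n)                       ∎
    where
    open ≡-Reasoning
    X = (exp (- 1ℚ) ⊛ expm1/z) n
    e₁ : ∀ x y → x ≡ x + y * 1ℚ - y
    e₁ x y = solve (x ∷ y ∷ []) ℚ-acr
    e₂ : ∀ w s → 0ℚ - w * (- 1ℚ * s) ≡ s * w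
    e₂ w s = solve (w ∷ s ∷ []) ℚ-acr

  module _ where
    open CommutativeMonoid ⊛-commutativeMonoid using (setoid; ∙-congˡ; ∙-congʳ; assoc; comm; identityˡ; identityʳ)
    open import Relation.Binary.Reasoning.Setoid setoid

    -- Inverses are unique: `reflect bern ⊛ exp (- 1ℚ)` and `bern` are both inverse to `expm1/z`.
    reflect-bern : reflect bern ≋ bern ⊛ exp 1ℚ
    reflect-bern = begin
      reflect bern                               ≈⟨ identityʳ (reflect bern) ⟨
      reflect bern ⊛ one                         ≈⟨ ∙-congˡ {reflect bern} (λ n → trans (exp-+ (- 1ℚ) 1ℚ n) (exp-0 n)) ⟨
      reflect bern ⊛ (exp (- 1ℚ) ⊛ exp 1ℚ)       ≈⟨ assoc (reflect bern) (exp (- 1ℚ)) (exp 1ℚ) ⟨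
      X ⊛ exp 1ℚ                                 ≈⟨ ∙-congʳ {exp 1ℚ} X≋bern ⟩
      bern ⊛ exp 1ℚ                              ∎
      where
      X = reflect bern ⊛ exp (- 1ℚ)
      X-inverse : X ⊛ expm1/z ≋ one
      X-inverse = begin
        X ⊛ expm1/z                              ≈⟨ assoc (reflect bern) (exp (- 1ℚ)) expm1/z ⟩
        reflect bern ⊛ (exp (- 1ℚ) ⊛ expm1/z)    ≈⟨ ∙-congˡ {reflect bern} exp-⊛-expm1/z ⟩
        reflect bern ⊛ reflect expm1/z           ≈⟨ reflect-⊛ bern expm1/z ⟨
        reflect (bern ⊛ expm1/z)                 ≈⟨ reflect-cong bern-⊛-expm1/z ⟩
        reflect one                              ≈⟨ reflect-one ⟩
        one                                      ∎
      X≋bern : X ≋ bern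
      X≋bern = begin
        X                                        ≈⟨ identityʳ X ⟨
        X ⊛ one                                  ≈⟨ ∙-congˡ {X} bern-⊛-expm1/z ⟨
        X ⊛ (bern ⊛ expm1/z)                     ≈⟨ ∙-congˡ {X} (comm bern expm1/z) ⟩
        X ⊛ (expm1/z ⊛ bern)                     ≈⟨ assoc X expm1/z bern ⟨
        (X ⊛ expm1/z) ⊛ bern                     ≈⟨ ∙-congʳ {bern} X-inverse ⟩
        one ⊛ bern                               ≈⟨ identityˡ bern ⟩
        bern                                     ∎

    -- The coefficients of z/(2 sinh (z/2)), i.e. the values Bₙ(1/2)/n!.
    centred : ℕ → ℚ
    centred = bern ⊛ exp ½

    -- Reflection multiplies z/(e^z - 1) by e^z and turns e^(z/2) into e^(-z/2); together these
    -- restore e^(z/2).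
    centred-even : reflect centred ≋ centred
    centred-even = begin
      reflect (bern ⊛ exp ½)                     ≈⟨ reflect-⊛ bern (exp ½) ⟩
      reflect bern ⊛ reflect (exp ½)             ≈⟨ ⊛-cong reflect-bern (reflect-exp ½) ⟩
      (bern ⊛ exp 1ℚ) ⊛ exp (- ½)                ≈⟨ assoc bern (exp 1ℚ) (exp (- ½)) ⟩
      bern ⊛ (exp 1ℚ ⊛ exp (- ½))                ≈⟨ ∙-congˡ {bern} (exp-+ 1ℚ (- ½)) ⟩
      bern ⊛ exp ½                               ∎

    bern≋centred : bern ≋ centred ⊛ exp (- ½)
    bern≋centred = begin
      bern                                       ≈⟨ identityʳ bern ⟨
      bern ⊛ one                                 ≈⟨ ∙-congˡ {bern} (λ n → trans (exp-+ ½ (- ½) n) (exp-0 n)) ⟨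
      bern ⊛ (exp ½ ⊛ exp (- ½))                 ≈⟨ assoc bern (exp ½) (exp (- ½)) ⟨
      centred ⊛ exp (- ½)                        ∎

  -- From z e^z/(e^z - 1) = z/(e^z - 1) + z: the term `one n` is the coefficient of z at index n +
  -- 1.
  sgn-bern-suc : ∀ n → sgn (suc n) * bern (suc n) ≡ bern (suc n) + one n
  sgn-bern-suc n = begin
    sgn (suc n) * bern (suc n)                   ≡⟨ reflect-bern (suc n) ⟩
    (bern ⊛ exp 1ℚ) (suc n)                      ≡⟨ ⊛-cong {bern} (λ _ → refl) exp-1 (suc n) ⟩
    (bern ⊛ 1/!) (suc n)                         ≡⟨ ∑₊-last (λ j i → bern j * 1/! i) n ⟩
    (bern ⊛ expm1/z) n + bern (suc n) * 1ℚ       ≡⟨ cong (_+ bern (suc n) * 1ℚ) (bern-⊛-expm1/z n) ⟩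
    one n + bern (suc n) * 1ℚ                    ≡⟨ e (one n) (bern (suc n)) ⟩
    bern (suc n) + one n                         ∎
    where
    open ≡-Reasoning
    e : ∀ x y → x + y * 1ℚ ≡ y + x
    e x y = solve (x ∷ y ∷ []) ℚ-acr

  sgn-bernoulli-1 : sgn 1 * bernoulli 1 ≡ bernoulli 1 + 1ℚ
  sgn-bernoulli-1 = refl

  sgn-bernoulli-2+ : ∀ n → sgn (2 ℕ.+ n) * bernoulli (2 ℕ.+ n) ≡ bernoulli (2 ℕ.+ n)
  sgn-bernoulli-2+ n = begin
    sgn N * bernoulli N                ≡⟨ cong (sgn N *_) (bernoulli≡!*bern N) ⟩
    sgn N * (fromℕ (N ℕ.!) * bern N)   ≡⟨ e (sgn N) (fromℕ (N ℕ.!)) (bern N) ⟩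
    fromℕ (N ℕ.!) * (sgn N * bern N)   ≡⟨ cong (fromℕ (N ℕ.!) *_) (trans (sgn-bern-suc (suc n)) (ℚₚ.+-identityʳ (bern N))) ⟩
    fromℕ (N ℕ.!) * bern N             ≡⟨ bernoulli≡!*bern N ⟨
    bernoulli N                        ∎
    where
    open ≡-Reasoning
    N = 2 ℕ.+ n
    e : ∀ s f b → s * (f * b) ≡ f * (s * b)
    e s f b = solve (s ∷ f ∷ b ∷ []) ℚ-acr

  -- Parity and vanishing of the numbers S m α.

  -- The coefficient of zᵐ in (1 + z)^(2α) ∑ᵣ (α choose r) Bᵣ (4z/(1 + z)²)^r.
  S : ℕ → ℚ → ℚ
  S m α = ∑₊ (λ r j → 4ℚ ^ℚ r * (binom α r * bernoulli r) * binom ((α - fromℕ r) + (α - fromℕ r)) j) m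

  -- Expanding B around 1/2 turns 1 - 4z/(1 + z)² ⋅ 1/2 into (1 + z²)/(1 + z)², which is
  -- where the coefficients T come from.
  S≡∑T : ∀ m α → S m α ≡ ∑₊ (λ s n → 4ℚ ^ℚ s * falling α s * centred s * T n (α - fromℕ s)) m
  S≡∑T m α = begin
    S m α
      ≡⟨ ∑₊-cong m (λ r j _ → expand r j) ⟩
    ∑₊ (λ r j → ∑₊ (λ s t → f s t j) r) m
      ≡⟨ ∑₊-assoc f m ⟩
    ∑₊ (λ s n → ∑₊ (λ t j → f s t j) n) m
      ≡⟨ ∑₊-cong m (λ s n _ → *-∑₊ (4ℚ ^ℚ s * falling α s * centred s) _ n) ⟨
    ∑₊ (λ s n → 4ℚ ^ℚ s * falling α s * centred s * T n (α - fromℕ s)) m ∎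
    where
    open ≡-Reasoning
    X : ℚ → ℕ → ℚ
    X x j = binom (x + x) j
    f : ℕ → ℕ → ℕ → ℚ
    f s t j = 4ℚ ^ℚ s * falling α s * centred s
      * ((- 2ℚ) ^ℚ t * binom (α - fromℕ s) t * X (α - fromℕ s - fromℕ t) j)
    e₁ : ∀ p g w b x → p * (g * w * b) * x ≡ p * g * x * (b * w)
    e₁ p g w b x = solve (p ∷ g ∷ w ∷ b ∷ x ∷ []) ℚ-acr
    e₂ : ∀ p q g h x c w v → p * q * (g * h) * x * (c * (w * v)) ≡ p * g * c * ((q * v) * (h * w) * x)
    e₂ p q g h x c w v = solve (p ∷ q ∷ g ∷ h ∷ x ∷ c ∷ w ∷ v ∷ []) ℚ-acr
    e₃ : ∀ α s t → α - (s + t) ≡ α - s - t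
    e₃ α s t = solve (α ∷ s ∷ t ∷ []) ℚ-acr
    expand : ∀ r j → 4ℚ ^ℚ r * (binom α r * bernoulli r) * X (α - fromℕ r) j ≡ ∑₊ (λ s t → f s t j) r
    expand r j = begin
      4ℚ ^ℚ r * (binom α r * bernoulli r) * X (α - fromℕ r) j
        ≡⟨ e₁ (4ℚ ^ℚ r) (falling α r) (1/! r) (bernoulli r) (X (α - fromℕ r) j) ⟩
      Y r * bern r
        ≡⟨ cong (Y r *_) (bern≋centred r) ⟩
      Y r * ∑₊ (λ s t → centred s * exp (- ½) t) r
        ≡⟨ *-∑₊ (Y r) (λ s t → centred s * exp (- ½) t) r ⟩
      ∑₊ (λ s t → Y r * (centred s * exp (- ½) t)) r
        ≡⟨ ∑₊-cong r (λ { s t refl → term s t }) ⟩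
      ∑₊ (λ s t → f s t j) r ∎
      where
      Y : ℕ → ℚ
      Y r = 4ℚ ^ℚ r * falling α r * X (α - fromℕ r) j
      term : ∀ s t → Y (s ℕ.+ t) * (centred s * exp (- ½) t) ≡ f s t j
      term s t = begin
        Y (s ℕ.+ t) * (centred s * exp (- ½) t)
          ≡⟨ cong (_* (centred s * exp (- ½) t)) (cong₂ _*_
               (cong₂ _*_ (^-homo-* 4ℚ s t) (falling-+ α s t))
               (cong (λ x → X x j) (trans (cong (λ x → α - x) (fromℕ-+ s t)) (e₃ α (fromℕ s) (fromℕ t))))) ⟩
        4ℚ ^ℚ s * 4ℚ ^ℚ t * (falling α s * falling (α - fromℕ s) t) * X (α - fromℕ s - fromℕ t) j
          * (centred s * (1/! t * (- ½) ^ℚ t))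
          ≡⟨ e₂ (4ℚ ^ℚ s) (4ℚ ^ℚ t) (falling α s) (falling (α - fromℕ s) t) (X (α - fromℕ s - fromℕ t) j)
               (centred s) (1/! t) ((- ½) ^ℚ t) ⟩
        4ℚ ^ℚ s * falling α s * centred s
          * ((4ℚ ^ℚ t * (- ½) ^ℚ t) * binom (α - fromℕ s) t * X (α - fromℕ s - fromℕ t) j)
          -- The product of 4 and -1/2 is the base -2 of the powers in `T`.
          ≡⟨ cong (λ x → 4ℚ ^ℚ s * falling α s * centred s
               * (x * binom (α - fromℕ s) t * X (α - fromℕ s - fromℕ t) j)) (^-distrib-* 4ℚ (- ½) t) ⟨
        f s t j ∎

  -- In `S≡∑T` every term pairs a coefficient of the even series `centred` with one of an even
  -- series `T`, and their indices add up to m.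
  S-even : ∀ m α → sgn m * S m α ≡ S m α
  S-even m α = begin
    sgn m * S m α                      ≡⟨ cong (sgn m *_) (S≡∑T m α) ⟩
    sgn m * ∑₊ g m                     ≡⟨ *-∑₊ (sgn m) g m ⟩
    ∑₊ (λ s n → sgn m * g s n) m       ≡⟨ ∑₊-cong m (λ { s n refl → term s n }) ⟩
    ∑₊ g m                             ≡⟨ S≡∑T m α ⟨
    S m α                              ∎
    where
    open ≡-Reasoning
    g : ℕ → ℕ → ℚ
    g s n = 4ℚ ^ℚ s * falling α s * centred s * T n (α - fromℕ s)
    e : ∀ a b p c t → a * b * (p * c * t) ≡ p * (a * c) * (b * t)
    e a b p c t = solve (a ∷ b ∷ p ∷ c ∷ t ∷ []) ℚ-acr
    term : ∀ s n → sgn (s ℕ.+ n) * g s n ≡ g s n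
    term s n = begin
      sgn (s ℕ.+ n) * g s n            ≡⟨ cong (_* g s n) (sgn-+ s n) ⟩
      sgn s * sgn n * g s n            ≡⟨ e (sgn s) (sgn n) (4ℚ ^ℚ s * falling α s) (centred s) (T n (α - fromℕ s)) ⟩
      4ℚ ^ℚ s * falling α s * (sgn s * centred s) * (sgn n * T n (α - fromℕ s))
        ≡⟨ cong₂ (λ x y → 4ℚ ^ℚ s * falling α s * x * y) (centred-even s) (T-even n (α - fromℕ s)) ⟩
      g s n                            ∎

  -- With `n * 2` in place of `2 * n`, `odd (suc n)` reduces to `suc (suc (odd n))`, so that odd
  -- powers unfold two factors at a time.
  odd : ℕ → ℕ
  odd n = suc (n ℕ.* 2)

  odd≡+suc : ∀ j → odd j ≡ j ℕ.+ suc j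
  odd≡+suc zero    = refl
  odd≡+suc (suc j) = cong suc (trans (cong suc (odd≡+suc j)) (sym (ℕₚ.+-suc j (suc j))))

  halves : ∀ j → (fromℕ j + ½) + (fromℕ j + ½) ≡ fromℕ (odd j)
  halves j = trans (e (fromℕ j)) (sym (trans (cong fromℕ (odd≡+suc j))
    (trans (fromℕ-+ j (suc j)) (cong (fromℕ j +_) (fromℕ-+ 1 j)))))
    where
    e : ∀ x → (x + ½) + (x + ½) ≡ x + (1ℚ + x)
    e x = solve (x ∷ []) ℚ-acr

  half-shift : ∀ r j → fromℕ (r ℕ.+ j) + ½ - fromℕ r ≡ fromℕ j + ½
  half-shift r j = trans (cong (λ x → x + ½ - fromℕ r) (fromℕ-+ r j)) (e (fromℕ r) (fromℕ j))
    where
    e : ∀ r j → r + j + ½ - r ≡ j + ½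
    e r j = solve (r ∷ j ∷ []) ℚ-acr

  binom-middle : ∀ j → binom (fromℕ (odd j)) (suc j) ≡ binom (fromℕ (odd j)) j
  binom-middle j = subst (λ n → binom (fromℕ n) (suc j) ≡ binom (fromℕ n) j) (sym (odd≡+suc j))
    (trans (cong (λ n → binom (fromℕ n) (suc j)) (ℕₚ.+-comm j (suc j))) (sym (binom-sym j (suc j))))

  -- S (h + 1) differs from S h by a multiple of B (h + 1), and the three numbers have
  -- parities forcing S h = 0.
  S-middle : ∀ g → S (suc g) (fromℕ (suc g) + ½) ≡ 0ℚ
  S-middle g = begin
    s                           ≡⟨ e₁ s ⟩
    ½ * (s + s)                 ≡⟨ cong (λ x → ½ * (x + s)) s≡-s ⟩
    ½ * (- s + s)               ≡⟨ e₂ s ⟩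
    0ℚ                          ∎
    where
    open ≡-Reasoning
    h = suc g
    α = fromℕ h + ½
    s = S h α
    z = 4ℚ ^ℚ suc h * (binom α (suc h) * bernoulli (suc h))
    e₁ : ∀ s → s ≡ ½ * (s + s)
    e₁ s = solve (s ∷ []) ℚ-acr
    e₂ : ∀ s → ½ * (- s + s) ≡ 0ℚ
    e₂ s = solve (s ∷ []) ℚ-acr
    e₃ : ∀ a s z → - 1ℚ * a * (s + z) ≡ - (a * s) + - 1ℚ * a * z
    e₃ a s z = solve (a ∷ s ∷ z ∷ []) ℚ-acr
    e₄ : ∀ s z → (s + z) - z ≡ s
    e₄ s z = solve (s ∷ z ∷ []) ℚ-acr
    e₅ : ∀ a p b c → a * (p * (b * c)) ≡ p * (b * (a * c))
    e₅ a p b c = solve (a ∷ p ∷ b ∷ c ∷ []) ℚ-acr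
    -- For r + j = h the upper argument 2α - 2r is 2j + 1, whose two central binomial coefficients
    -- coincide.
    term : ∀ r j → r ℕ.+ j ≡ h → binom ((α - fromℕ r) + (α - fromℕ r)) (suc j) ≡ binom ((α - fromℕ r) + (α - fromℕ r)) j
    term r j r+j≡h = subst (λ x → binom (x + x) (suc j) ≡ binom (x + x) j) (sym
        (trans (cong (λ n → fromℕ n + ½ - fromℕ r) (sym r+j≡h)) (half-shift r j)))
      (subst (λ x → binom x (suc j) ≡ binom x j) (sym (halves j)) (binom-middle j))
    S-suc : S (suc h) α ≡ s + z
    S-suc = trans (∑₊-last (λ r j → 4ℚ ^ℚ r * (binom α r * bernoulli r) * binom ((α - fromℕ r) + (α - fromℕ r)) j) h)
      (cong₂ _+_ (∑₊-cong h (λ r j p → cong (4ℚ ^ℚ r * (binom α r * bernoulli r) *_) (term r j p)))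
        (ℚₚ.*-identityʳ z))
    -- As h = g + 1, the Bernoulli index h + 1 is at least 2 and avoids the exceptional B_1.
    z-even : sgn (suc h) * z ≡ z
    z-even = trans (e₅ (sgn (suc h)) (4ℚ ^ℚ suc h) (binom α (suc h)) (bernoulli (suc h)))
      (cong (λ x → 4ℚ ^ℚ suc h * (binom α (suc h) * x)) (sgn-bernoulli-2+ g))
    s≡-s : s ≡ - s
    s≡-s = begin
      s                         ≡⟨ e₄ s z ⟨
      (s + z) - z               ≡⟨ cong (_- z) (trans (sym S-suc) (sym (S-even (suc h) α))) ⟩
      sgn (suc h) * S (suc h) α - z   ≡⟨ cong (λ x → sgn (suc h) * x - z) S-suc ⟩
      sgn (suc h) * (s + z) - z       ≡⟨ cong (_- z) (e₃ (sgn h) s z) ⟩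
      (- (sgn h * s) + sgn (suc h) * z) - z  ≡⟨ cong₂ (λ x y → (- x + y) - z) (S-even h α) z-even ⟩
      (- s + z) - z             ≡⟨ e₄ (- s) z ⟩
      - s                       ∎

  -- The numbers S m α as expansion coefficients, and their relation to A and P.

  -- For ud = c this is the coefficient of `u ^ odd i + d ^ odd i` in the sum of γ r ((u +
  -- d)/2)^(2l+1) over r + l = m + i.
  regroup : ℚ → (ℕ → ℚ) → ℕ → ℕ → ℚ
  regroup c γ m i = ∑₊ (λ r j → γ r * (½ ^ℚ odd (j ℕ.+ i) * (binom (fromℕ (odd (j ℕ.+ i))) j * c ^ℚ j))) m

  ½^-4^ : ∀ r l → ½ ^ℚ odd (r ℕ.+ l) * 4ℚ ^ℚ r ≡ ½ ^ℚ odd l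
  ½^-4^ zero    l = ℚₚ.*-identityʳ (½ ^ℚ odd l)
  ½^-4^ (suc r) l = trans (e (½ ^ℚ odd (r ℕ.+ l)) (4ℚ ^ℚ r)) (½^-4^ r l)
    where
    e : ∀ x y → ½ * (½ * x) * (4ℚ * y) ≡ x * y
    e x y = solve (x ∷ y ∷ []) ℚ-acr

  β : ℚ → ℕ → ℚ
  β α r = binom α r * bernoulli r

  -- With l = j + i = h - r, the number 2α - 2r is 2l + 1, and the factor 4^r reduces 2h + 1 halves
  -- to 2l + 1 halves.
  S-term : ∀ h r j i → r ℕ.+ (j ℕ.+ i) ≡ h → let α = fromℕ h + ½ in
    ½ ^ℚ odd (j ℕ.+ i) * binom (fromℕ (odd (j ℕ.+ i))) j
      ≡ ½ ^ℚ odd h * (4ℚ ^ℚ r * binom ((α - fromℕ r) + (α - fromℕ r)) j)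
  S-term h r j i refl = trans
    (cong₂ (λ x y → x * binom y j) (sym (½^-4^ r (j ℕ.+ i)))
      (trans (sym (halves (j ℕ.+ i))) (cong (λ x → x + x) (sym (half-shift r (j ℕ.+ i))))))
    (ℚₚ.*-assoc (½ ^ℚ odd h) (4ℚ ^ℚ r) (binom ((α - fromℕ r) + (α - fromℕ r)) j))
    where α = fromℕ h + ½

  -- The power `c ^ r` of the weight and the power `c ^ j` of the expansion combine to `c ^ m` in
  -- every term, so that c factors out.
  regroup-S : ∀ c h m i → m ℕ.+ i ≡ h → let α = fromℕ h + ½ in
    regroup c (λ r → c ^ℚ r * β α r) m i ≡ c ^ℚ m * (½ ^ℚ odd h * S m α)
  regroup-S c h m i m+i≡h = begin
    regroup c (λ r → c ^ℚ r * β α r) m i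
      ≡⟨ ∑₊-cong m term ⟩
    ∑₊ (λ r j → c ^ℚ m * ½ ^ℚ odd h * f r j) m
      ≡⟨ *-∑₊ (c ^ℚ m * ½ ^ℚ odd h) f m ⟨
    c ^ℚ m * ½ ^ℚ odd h * S m α
      ≡⟨ ℚₚ.*-assoc (c ^ℚ m) (½ ^ℚ odd h) (S m α) ⟩
    c ^ℚ m * (½ ^ℚ odd h * S m α) ∎
    where
    open ≡-Reasoning
    α = fromℕ h + ½
    f : ℕ → ℕ → ℚ
    f r j = 4ℚ ^ℚ r * β α r * binom ((α - fromℕ r) + (α - fromℕ r)) j
    e₁ : ∀ x b p y z → x * b * (p * (y * z)) ≡ x * z * b * (p * y)
    e₁ x b p y z = solve (x ∷ b ∷ p ∷ y ∷ z ∷ []) ℚ-acr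
    e₂ : ∀ c b p q y → c * b * (p * (q * y)) ≡ c * p * (q * b * y)
    e₂ c b p q y = solve (c ∷ b ∷ p ∷ q ∷ y ∷ []) ℚ-acr
    term : ∀ r j → r ℕ.+ j ≡ m →
      c ^ℚ r * β α r * (½ ^ℚ odd (j ℕ.+ i) * (binom (fromℕ (odd (j ℕ.+ i))) j * c ^ℚ j))
        ≡ c ^ℚ m * ½ ^ℚ odd h * f r j
    term r j r+j≡m = trans
      (e₁ (c ^ℚ r) (β α r) (½ ^ℚ odd (j ℕ.+ i)) (binom (fromℕ (odd (j ℕ.+ i))) j) (c ^ℚ j))
      (trans (cong₂ (λ x y → x * β α r * y) (trans (sym (^-homo-* c r j)) (cong (c ^ℚ_) r+j≡m))
          (S-term h r j i (trans (sym (ℕₚ.+-assoc r j i)) (trans (cong (ℕ._+ i) r+j≡m) m+i≡h))))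
        (e₂ (c ^ℚ m) (β α r) (½ ^ℚ odd h) (4ℚ ^ℚ r) (binom ((α - fromℕ r) + (α - fromℕ r)) j)))

  [odd/2]+1 : ∀ g → [ odd g /2]+1 ≡ fromℕ (suc g) + ½
  [odd/2]+1 g = *-cancelˡ-≢0 2ℚ (λ ()) (begin
    2ℚ * (q + 1ℚ)                                ≡⟨ e₁ q ⟩
    q * 2ℚ + 2ℚ                                  ≡⟨ cong (_+ 2ℚ) (/-*-fromℕ (odd g) 1) ⟩
    fromℕ (odd g) + 2ℚ                           ≡⟨ cong (_+ 2ℚ) (halves g) ⟨
    fromℕ g + ½ + (fromℕ g + ½) + 2ℚ             ≡⟨ e₂ (fromℕ g) ⟩
    2ℚ * (1ℚ + fromℕ g + ½)                      ≡⟨ cong (λ x → 2ℚ * (x + ½)) (fromℕ-+ 1 g) ⟨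
    2ℚ * (fromℕ (suc g) + ½)                     ∎)
    where
    open ≡-Reasoning
    q = ℤ.+ odd g ℚ./ 2
    e₁ : ∀ q → 2ℚ * (q + 1ℚ) ≡ q * 2ℚ + 2ℚ
    e₁ q = solve (q ∷ []) ℚ-acr
    e₂ : ∀ x → x + ½ + (x + ½) + 2ℚ ≡ 2ℚ * (1ℚ + x + ½)
    e₂ x = solve (x ∷ []) ℚ-acr

  ∑ℚ-∸ : ∀ n (f : ℕ → ℕ → ℚ) → ∑ℚ (suc n) (λ i → f i (n ℕ.∸ i)) ≡ ∑₊ f n
  ∑ℚ-∸ n f = trans (∑ℚ≡∑₊ n (λ i → f i (n ℕ.∸ i)))
    (∑₊-cong n λ { i j refl → cong (f i) (ℕₚ.m+n∸m≡n i j) })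

  -- For i = 2j + 3 the definition of `A` has i - 1 halves, one fewer than `S-term`. The resulting
  -- factor 2 will match the doubled power d^i + d^i in the increment.
  A≡S : ∀ j m → let h = suc (j ℕ.+ m) in
    A (odd (j ℕ.+ m)) (3 ℕ.+ 2 ℕ.* j) ≡ 1/[ odd (j ℕ.+ m) /2]+1 * (2ℚ * (½ ^ℚ odd h * S m (fromℕ h + ½)))
  A≡S j m = begin
    v * ½ ^ℚ (2 ℕ.+ 2 ℕ.* j) * ∑ℚ (suc h′) (λ s → F s (h′ ℕ.∸ s))
      ≡⟨ cong (λ n → v * ½ ^ℚ (2 ℕ.+ 2 ℕ.* j) * ∑ℚ (suc n) (λ s → F s (n ℕ.∸ s))) h′≡m ⟩
    v * ½ ^ℚ (2 ℕ.+ 2 ℕ.* j) * ∑ℚ (suc m) (λ s → F s (m ℕ.∸ s))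
      ≡⟨ cong (v * ½ ^ℚ (2 ℕ.+ 2 ℕ.* j) *_) (trans (∑ℚ-∸ m F) (∑₊-flip F m)) ⟩
    v * ½ ^ℚ (2 ℕ.+ 2 ℕ.* j) * ∑₊ (λ r s → F s r) m
      ≡⟨ ℚₚ.*-assoc v (½ ^ℚ (2 ℕ.+ 2 ℕ.* j)) (∑₊ (λ r s → F s r) m) ⟩
    v * (½ ^ℚ (2 ℕ.+ 2 ℕ.* j) * ∑₊ (λ r s → F s r) m)
      ≡⟨ cong (v *_) (trans (*-∑₊ (½ ^ℚ (2 ℕ.+ 2 ℕ.* j)) (λ r s → F s r) m)
           (trans (∑₊-cong m term)
             (sym (*-∑₊ (2ℚ * ½ ^ℚ odd h) G m)))) ⟩
    v * (2ℚ * ½ ^ℚ odd h * S m α)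
      ≡⟨ cong (v *_) (ℚₚ.*-assoc 2ℚ (½ ^ℚ odd h) (S m α)) ⟩
    v * (2ℚ * (½ ^ℚ odd h * S m α)) ∎
    where
    open ≡-Reasoning
    k = odd (j ℕ.+ m)
    h = suc (j ℕ.+ m)
    h′ = (k ℕ.+ 2 ℕ.∸ (3 ℕ.+ 2 ℕ.* j)) ℕ./ 2
    v = 1/[ k /2]+1
    α = fromℕ h + ½
    ¼ = ℤ.+ 1 ℚ./ 4
    F G : ℕ → ℕ → ℚ
    F s r = binom (fromℕ (2 ℕ.* s ℕ.+ (3 ℕ.+ 2 ℕ.* j))) s * ¼ ^ℚ s * binom [ k /2]+1 r * bernoulli r
    G r s = 4ℚ ^ℚ r * β α r * binom ((α - fromℕ r) + (α - fromℕ r)) s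
    h′≡m : h′ ≡ m
    h′≡m = trans (cong (ℕ._/ 2) (trans
        (cong (ℕ._∸ (3 ℕ.+ 2 ℕ.* j)) (trans (ℕₚ.+-comm k 2)
          (cong (3 ℕ.+_) (trans (ℕₚ.*-distribʳ-+ 2 j m) (cong (ℕ._+ m ℕ.* 2) (ℕₚ.*-comm j 2))))))
        (ℕₚ.m+n∸m≡n (3 ℕ.+ 2 ℕ.* j) (m ℕ.* 2))))
      (ℕD.m*n/n≡m m 2)
    index : ∀ s → 2 ℕ.* s ℕ.+ (3 ℕ.+ 2 ℕ.* j) ≡ odd (s ℕ.+ suc j)
    index s = trans (cong₂ (λ x y → x ℕ.+ (3 ℕ.+ y)) (ℕₚ.*-comm 2 s) (ℕₚ.*-comm 2 j))
      (trans (ℕₚ.+-suc (s ℕ.* 2) (suc j ℕ.* 2)) (cong suc (sym (ℕₚ.*-distribʳ-+ 2 s (suc j)))))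
    powers : ∀ s → ½ ^ℚ (2 ℕ.+ 2 ℕ.* j) * ¼ ^ℚ s ≡ 2ℚ * ½ ^ℚ odd (s ℕ.+ suc j)
    powers zero = trans (cong (λ n → ½ ^ℚ (2 ℕ.+ n) * 1ℚ) (ℕₚ.*-comm 2 j)) (e (½ ^ℚ (suc j ℕ.* 2)))
      where
      e : ∀ x → x * 1ℚ ≡ 2ℚ * (½ * x)
      e x = solve (x ∷ []) ℚ-acr
    powers (suc s) = trans (e₁ (½ ^ℚ (2 ℕ.+ 2 ℕ.* j)) (¼ ^ℚ s)) (trans (cong (λ x → ½ * (½ * x)) (powers s))
      (e₂ (½ ^ℚ odd (s ℕ.+ suc j))))
      where
      e₁ : ∀ x y → x * (¼ * y) ≡ ½ * (½ * (x * y))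
      e₁ x y = solve (x ∷ y ∷ []) ℚ-acr
      e₂ : ∀ x → ½ * (½ * (2ℚ * x)) ≡ 2ℚ * (½ * (½ * x))
      e₂ x = solve (x ∷ []) ℚ-acr
    e₁ : ∀ p x q a b → p * (x * q * a * b) ≡ p * q * x * (a * b)
    e₁ p x q a b = solve (p ∷ x ∷ q ∷ a ∷ b ∷ []) ℚ-acr
    e₂ : ∀ x y b → 2ℚ * x * y * b ≡ 2ℚ * (x * y) * b
    e₂ x y b = solve (x ∷ y ∷ b ∷ []) ℚ-acr
    e₃ : ∀ x p y b → 2ℚ * (x * (p * y)) * b ≡ 2ℚ * x * (p * b * y)
    e₃ x p y b = solve (x ∷ p ∷ y ∷ b ∷ []) ℚ-acr
    sum-index : ∀ r s → r ℕ.+ s ≡ m → r ℕ.+ (s ℕ.+ suc j) ≡ h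
    sum-index r s r+s≡m = trans (sym (ℕₚ.+-assoc r s (suc j)))
      (trans (cong (ℕ._+ suc j) r+s≡m) (ℕₚ.+-comm m (suc j)))
    term : ∀ r s → r ℕ.+ s ≡ m → ½ ^ℚ (2 ℕ.+ 2 ℕ.* j) * F s r ≡ 2ℚ * ½ ^ℚ odd h * G r s
    term r s r+s≡m = begin
      ½ ^ℚ (2 ℕ.+ 2 ℕ.* j) * F s r
        ≡⟨ e₁ (½ ^ℚ (2 ℕ.+ 2 ℕ.* j)) (binom (fromℕ (2 ℕ.* s ℕ.+ (3 ℕ.+ 2 ℕ.* j))) s) (¼ ^ℚ s) (binom [ k /2]+1 r) (bernoulli r) ⟩
      ½ ^ℚ (2 ℕ.+ 2 ℕ.* j) * ¼ ^ℚ s * binom (fromℕ (2 ℕ.* s ℕ.+ (3 ℕ.+ 2 ℕ.* j))) s * β [ k /2]+1 r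
        ≡⟨ cong₂ (λ x y → x * y * β [ k /2]+1 r) (powers s) (cong (λ n → binom (fromℕ n) s) (index s)) ⟩
      2ℚ * ½ ^ℚ odd (s ℕ.+ suc j) * binom (fromℕ (odd (s ℕ.+ suc j))) s * β [ k /2]+1 r
        ≡⟨ cong (λ a → 2ℚ * ½ ^ℚ odd (s ℕ.+ suc j) * binom (fromℕ (odd (s ℕ.+ suc j))) s * β a r) ([odd/2]+1 (j ℕ.+ m)) ⟩
      2ℚ * ½ ^ℚ odd (s ℕ.+ suc j) * binom (fromℕ (odd (s ℕ.+ suc j))) s * β α r
        ≡⟨ e₂ (½ ^ℚ odd (s ℕ.+ suc j)) (binom (fromℕ (odd (s ℕ.+ suc j))) s) (β α r) ⟩
      2ℚ * (½ ^ℚ odd (s ℕ.+ suc j) * binom (fromℕ (odd (s ℕ.+ suc j))) s) * β α r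
        ≡⟨ cong (λ x → 2ℚ * x * β α r) (S-term h r s (suc j) (sum-index r s r+s≡m)) ⟩
      2ℚ * (½ ^ℚ odd h * (4ℚ ^ℚ r * binom ((α - fromℕ r) + (α - fromℕ r)) s)) * β α r
        ≡⟨ e₃ (½ ^ℚ odd h) (4ℚ ^ℚ r) (binom ((α - fromℕ r) + (α - fromℕ r)) s) (β α r) ⟩
      2ℚ * ½ ^ℚ odd h * G r s ∎

  [odd+1]/2 : ∀ g → (odd g ℕ.+ 1) ℕ./ 2 ≡ suc g
  [odd+1]/2 g = trans (cong (ℕ._/ 2) (ℕₚ.+-comm (odd g) 1)) (ℕD.m*n/n≡m (suc g) 2)

  P≡∑₊ : ∀ g x → let h = suc g; α = fromℕ h + ½ in
    P (odd g) x ≡ 1/[ odd g /2]+1 * ∑₊ (λ r l → sgn r * β α r * x ^ℚ l) h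
  P≡∑₊ g x = cong (1/[ k /2]+1 *_) (begin
    ∑ℚ (suc ((k ℕ.+ 1) ℕ./ 2)) (λ i → F i ((k ℕ.+ 1) ℕ./ 2 ℕ.∸ i))
      ≡⟨ cong (λ n → ∑ℚ (suc n) (λ i → F i (n ℕ.∸ i))) ([odd+1]/2 g) ⟩
    ∑ℚ (suc h) (λ i → F i (h ℕ.∸ i))
      ≡⟨ ∑ℚ-∸ h F ⟩
    ∑₊ F h
      ≡⟨ ∑₊-cong h (λ r l _ → trans
           (cong (λ a → binom a r * sgn r * bernoulli r * x ^ℚ l) ([odd/2]+1 g))
           (e (binom α r) (sgn r) (bernoulli r) (x ^ℚ l))) ⟩
    ∑₊ (λ r l → sgn r * β α r * x ^ℚ l) h ∎)
    where
    open ≡-Reasoning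
    k = odd g
    h = suc g
    α = fromℕ h + ½
    F : ℕ → ℕ → ℚ
    F r l = binom [ k /2]+1 r * sgn r * bernoulli r * x ^ℚ l
    e : ∀ a s b y → a * s * b * y ≡ s * (a * b) * y
    e a s b y = solve (a ∷ s ∷ b ∷ y ∷ []) ℚ-acr

  1/[/2]+1-inverse : ∀ g → 1/[ odd g /2]+1 * (fromℕ (suc g) + ½) ≡ 1ℚ
  1/[/2]+1-inverse g = trans (cong (1/[ k /2]+1 *_) (sym ([odd/2]+1 g)))
    (ℚₚ.*-inverseˡ [ k /2]+1 {{ℚₚ.pos⇒nonZero [ k /2]+1 {{ℚₚ.nonNeg+pos⇒pos (ℤ.+ k ℚ./ 2) {{ℚₚ.normalize-nonNeg k 2}} 1ℚ}}}})
    where k = odd g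

  1^ : ∀ n → 1ℚ ^ℚ n ≡ 1ℚ
  1^ zero    = refl
  1^ (suc n) = trans (ℚₚ.*-identityˡ (1ℚ ^ℚ n)) (1^ n)

  -- sgn r * B r exceeds B r by 1 at r = 1 only.
  bump : ℚ → ℕ → ℚ
  bump α zero    = 0ℚ
  bump α (suc r) = α * one r

  sgn-β : ∀ α r → sgn r * β α r ≡ β α r + bump α r
  sgn-β α zero          = trans (ℚₚ.*-identityˡ (β α 0)) (sym (ℚₚ.+-identityʳ (β α 0)))
  sgn-β α (suc zero)    = trans (e (binom α 1) (bernoulli 1)) (trans (cong (binom α 1 *_) sgn-bernoulli-1)
      (trans (ℚₚ.*-distribˡ-+ (binom α 1) (bernoulli 1) 1ℚ) (cong (β α 1 +_) (cong (_* 1ℚ) (e′ α)))))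
    where
    e : ∀ a b → sgn 1 * (a * b) ≡ a * (sgn 1 * b)
    e a b = trans (sym (ℚₚ.*-assoc (sgn 1) a b)) (trans (cong (_* b) (ℚₚ.*-comm (sgn 1) a)) (ℚₚ.*-assoc a (sgn 1) b))
    e′ : ∀ α → 1ℚ * (α - 0ℚ) * 1ℚ ≡ α
    e′ α = solve (α ∷ []) ℚ-acr
  sgn-β α (suc (suc n)) = trans (e (sgn r) (binom α r) (bernoulli r))
    (trans (cong (binom α r *_) (sgn-bernoulli-2+ n)) (e′ (β α r) α))
    where
    r = suc (suc n)
    e : ∀ s a b → s * (a * b) ≡ a * (s * b)
    e s a b = solve (s ∷ a ∷ b ∷ []) ℚ-acr
    e′ : ∀ x α → x ≡ x + α * 0ℚ
    e′ x α = solve (x ∷ α ∷ []) ℚ-acr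

-- Expansion of odd powers of (u + d)/2 over the reals.

open import Defs
open import Algebra.Properties.Semiring.Exp ℝR.semiring using (^-homo-*; ^-congˡ)
open import Algebra.Properties.CommutativeSemiring.Exp ℝR.commutativeSemiring using (^-distrib-*)
open ℕ-in-ℚ
open ℚ-Lemmas
open RationalIdentities

module ∑ℚ₊ = Antidiagonal ℚₚ.+-*-commutativeRing
open Antidiagonal ℝ-commutativeRing

μ : ℕ → ℝ
μ n = ι (fromℕ n)

ω : ℕ → ℝ
ω n = ι (1/! n)

ι-cong : ∀ {p q} → p ≡ q → ι p ≃ ι q
ι-cong refl = ≃-refl

μ-cancel : ∀ n {x y} → μ (suc n) * x ≃ μ (suc n) * y → x ≃ y
μ-cancel n {x} {y} p = ≃-trans (≃-sym (undo x)) (≃-trans (*-cong (≃-refl {ι i}) p) (undo y))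
  where
  s = fromℕ (suc n)
  i = inv s
  i*s≡1 : i ℚ.* s ≡ 1ℚ
  i*s≡1 = trans (ℚₚ.*-comm i s) (*-inv⁺ (0<fromℕ-suc n))
  undo : ∀ z → ι i * (μ (suc n) * z) ≃ z
  undo z = pointwise λ t → trans (sym (ℚₚ.*-assoc i s (seq z t)))
    (trans (cong (ℚ._* seq z t) i*s≡1) (ℚₚ.*-identityˡ (seq z t)))

open Weighted μ ≃-refl (λ m n → pointwise λ _ → fromℕ-+ m n)
open Exponential ω ≃-refl (λ n → pointwise λ _ → *-1/!-suc n) μ-cancel

-- This is n! times the addition rule `exp-+`.
binomial-theorem : ∀ x y n → (x + y) ^ n ≃ ∑₊ (λ i j → ι (binom (fromℕ n) i) * (x ^ i * y ^ j)) n
binomial-theorem x y n = begin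
  (x + y) ^ n
    ≈⟨ pointwise (λ t → scale (seq ((x + y) ^ n) t)) ⟩
  ι n! * exp (x + y) n
    ≈⟨ *-cong (≃-refl {ι n!}) (exp-+ x y n) ⟨
  ι n! * ∑₊ (λ i j → exp x i * exp y j) n
    ≈⟨ *-∑₊ (ι n!) _ n ⟩
  ∑₊ (λ i j → ι n! * (exp x i * exp y j)) n
    ≈⟨ ∑₊-cong n (λ { i j refl → pointwise λ t → term i j (seq (x ^ i) t) (seq (y ^ j) t) }) ⟩
  ∑₊ (λ i j → ι (binom (fromℕ n) i) * (x ^ i * y ^ j)) n ∎
  where
  open import Relation.Binary.Reasoning.Setoid ℝR.setoid
  n! = fromℕ (n ℕ.!)
  scale : ∀ a → a ≡ n! ℚ.* (1/! n ℚ.* a)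
  scale a = sym (trans (sym (ℚₚ.*-assoc n! (1/! n) a))
    (trans (cong (ℚ._* a) (1/!-! n)) (ℚₚ.*-identityˡ a)))
  e : ∀ f v w a b → f ℚ.* ((v ℚ.* a) ℚ.* (w ℚ.* b)) ≡ f ℚ.* (v ℚ.* w) ℚ.* (a ℚ.* b)
  e f v w a b = solve (f ∷ v ∷ w ∷ a ∷ b ∷ []) ℚ-acr
  term : ∀ i j a b → fromℕ ((i ℕ.+ j) ℕ.!) ℚ.* ((1/! i ℚ.* a) ℚ.* (1/! j ℚ.* b))
    ≡ binom (fromℕ (i ℕ.+ j)) i ℚ.* (a ℚ.* b)
  term i j a b = trans (e (fromℕ ((i ℕ.+ j) ℕ.!)) (1/! i) (1/! j) a b) (cong (ℚ._* (a ℚ.* b)) (sym (binom-! i j)))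

odd-split : ∀ j i → odd (j ℕ.+ i) ≡ j ℕ.+ (odd i ℕ.+ j)
odd-split zero    i = sym (ℕₚ.+-identityʳ (odd i))
odd-split (suc j) i = cong suc (trans (cong suc (odd-split j i))
  (trans (sym (ℕₚ.+-suc j (odd i ℕ.+ j))) (cong (j ℕ.+_) (sym (ℕₚ.+-suc (odd i) j)))))

ι-^ : ∀ q n → ι q ^ n ≃ ι (q ^ℚ n)
ι-^ q zero    = ≃-refl
ι-^ q (suc n) = ≃-trans (*-cong (≃-refl {ι q}) (ι-^ q n)) (≃-sym (ι-* q (q ^ℚ n)))

-- In the binomial expansion, mirrored terms have equal binomial coefficients and share the factor
-- (ud)^j = c^j.
odd-power : ∀ u d c → u * d ≃ ι c → ∀ l → (u + d) ^ odd l ≃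
  ∑₊ (λ j i → ι (binom (fromℕ (odd l)) j ℚ.* c ^ℚ j) * (u ^ odd i + d ^ odd i)) l
odd-power u d c ud≃c l = begin
  (u + d) ^ odd l
    ≈⟨ binomial-theorem u d (odd l) ⟩
  ∑₊ f (odd l)
    ≈⟨ ∑₊-odd f l ⟩
  ∑₊ (λ j i → f j (odd i ℕ.+ j) + f (odd i ℕ.+ j) j) l
    ≈⟨ ∑₊-cong l (λ { j i refl → term j i }) ⟩
  ∑₊ (λ j i → ι (binom (fromℕ (odd l)) j ℚ.* c ^ℚ j) * (u ^ odd i + d ^ odd i)) l ∎
  where
  open import Relation.Binary.Reasoning.Setoid ℝR.setoid
  f : ℕ → ℕ → ℝ
  f i j = ι (binom (fromℕ (odd l)) i) * (u ^ i * d ^ j)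
  power : ∀ j → u ^ j * d ^ j ≃ ι (c ^ℚ j)
  power j = ≃-trans (≃-sym (^-distrib-* u d j)) (≃-trans (^-congˡ j ud≃c) (ι-^ c j))
  e₁ : ∀ b v w x y → b ℚ.* (v ℚ.* (y ℚ.* w)) ℚ.+ b ℚ.* ((x ℚ.* v) ℚ.* w) ≡ b ℚ.* ((v ℚ.* w) ℚ.* (x ℚ.+ y))
  e₁ b v w x y = solve (b ∷ v ∷ w ∷ x ∷ y ∷ []) ℚ-acr
  upper : ∀ j i → binom (fromℕ (odd (j ℕ.+ i))) (odd i ℕ.+ j) ≡ binom (fromℕ (odd (j ℕ.+ i))) j
  upper j i = subst (λ n → binom (fromℕ n) (odd i ℕ.+ j) ≡ binom (fromℕ n) j) (sym (odd-split j i))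
    (trans (cong (λ n → binom (fromℕ n) (odd i ℕ.+ j)) (ℕₚ.+-comm j (odd i ℕ.+ j)))
      (binom-sym (odd i ℕ.+ j) j))
  term : ∀ j i → ι (binom (fromℕ (odd (j ℕ.+ i))) j) * (u ^ j * d ^ (odd i ℕ.+ j))
      + ι (binom (fromℕ (odd (j ℕ.+ i))) (odd i ℕ.+ j)) * (u ^ (odd i ℕ.+ j) * d ^ j)
    ≃ ι (binom (fromℕ (odd (j ℕ.+ i))) j ℚ.* c ^ℚ j) * (u ^ odd i + d ^ odd i)
  term j i = begin
    ι b * (u ^ j * d ^ (odd i ℕ.+ j)) + ι (binom (fromℕ (odd (j ℕ.+ i))) (odd i ℕ.+ j)) * (u ^ (odd i ℕ.+ j) * d ^ j)
      ≈⟨ +-cong (*-cong (≃-refl {ι b}) (*-cong (≃-refl {u ^ j}) (^-homo-* d (odd i) j)))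
                (*-cong (ι-cong (upper j i)) (*-cong (^-homo-* u (odd i) j) (≃-refl {d ^ j}))) ⟩
    ι b * (u ^ j * (d ^ odd i * d ^ j)) + ι b * ((u ^ odd i * u ^ j) * d ^ j)
      ≈⟨ pointwise (λ t → e₁ b (seq (u ^ j) t) (seq (d ^ j) t) (seq (u ^ odd i) t) (seq (d ^ odd i) t)) ⟩
    ι b * ((u ^ j * d ^ j) * (u ^ odd i + d ^ odd i))
      ≈⟨ *-cong (≃-refl {ι b}) (*-cong (power j) (≃-refl {u ^ odd i + d ^ odd i})) ⟩
    ι b * (ι (c ^ℚ j) * (u ^ odd i + d ^ odd i))
      ≈⟨ pointwise (λ t → ℚₚ.*-assoc b (c ^ℚ j) (seq (u ^ odd i + d ^ odd i) t)) ⟨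
    ι (b ℚ.* c ^ℚ j) * (u ^ odd i + d ^ odd i) ∎
    where
    b = binom (fromℕ (odd (j ℕ.+ i))) j

ι-∑₊ : ∀ f n → ∑₊ (λ i j → ι (f i j)) n ≃ ι (∑ℚ₊.∑₊ f n)
ι-∑₊ f zero    = ≃-refl
ι-∑₊ f (suc n) = ≃-trans (+-cong (≃-refl {ι (f 0 (suc n))}) (ι-∑₊ (λ i j → f (suc i) j) n))
  (≃-sym (ι-+ (f 0 (suc n)) (∑ℚ₊.∑₊ (λ i j → f (suc i) j) n)))

-- Expanding each power by `odd-power` gives a sum over r + j + i = h. Collecting by i instead of by
-- r leaves the inner sum over r + j = m.
odd-power-sum : ∀ u d c (γ : ℕ → ℚ) → u * d ≃ ι c → ∀ h →
  ∑₊ (λ r l → ι (γ r) * (ι ½ * (u + d)) ^ odd l) h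
    ≃ ∑₊ (λ m i → ι (regroup c γ m i) * (u ^ odd i + d ^ odd i)) h
odd-power-sum u d c γ ud≃c h = begin
  ∑₊ (λ r l → ι (γ r) * (ι ½ * (u + d)) ^ odd l) h
    ≈⟨ ∑₊-cong h (λ r l _ → expand r l) ⟩
  ∑₊ (λ r l → ∑₊ (λ j i → f r j i) l) h
    ≈⟨ ∑₊-assoc f h ⟨
  ∑₊ (λ m i → ∑₊ (λ r j → f r j i) m) h
    ≈⟨ ∑₊-cong h (λ m i _ → collect m i) ⟩
  ∑₊ (λ m i → ι (regroup c γ m i) * (u ^ odd i + d ^ odd i)) h ∎
  where
  open import Relation.Binary.Reasoning.Setoid ℝR.setoid
  κ : ℕ → ℕ → ℕ → ℚ
  κ r j i = γ r ℚ.* (½ ^ℚ odd (j ℕ.+ i) ℚ.* (binom (fromℕ (odd (j ℕ.+ i))) j ℚ.* c ^ℚ j))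
  f : ℕ → ℕ → ℕ → ℝ
  f r j i = ι (κ r j i) * (u ^ odd i + d ^ odd i)
  e : ∀ a b c x → (a ℚ.* b) ℚ.* (c ℚ.* x) ≡ (a ℚ.* (b ℚ.* c)) ℚ.* x
  e a b c x = solve (a ∷ b ∷ c ∷ x ∷ []) ℚ-acr
  expand : ∀ r l → ι (γ r) * (ι ½ * (u + d)) ^ odd l ≃ ∑₊ (λ j i → f r j i) l
  expand r l = begin
    ι (γ r) * (ι ½ * (u + d)) ^ odd l
      ≈⟨ *-cong (≃-refl {ι (γ r)}) (≃-trans (^-distrib-* (ι ½) (u + d) (odd l))
           (*-cong (ι-^ ½ (odd l)) (odd-power u d c ud≃c l))) ⟩
    ι (γ r) * (ι (½ ^ℚ odd l) * ∑₊ g l)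
      ≈⟨ pointwise (λ t → ℚₚ.*-assoc (γ r) (½ ^ℚ odd l) (seq (∑₊ g l) t)) ⟨
    ι (γ r ℚ.* ½ ^ℚ odd l) * ∑₊ g l
      ≈⟨ *-∑₊ (ι (γ r ℚ.* ½ ^ℚ odd l)) g l ⟩
    ∑₊ (λ j i → ι (γ r ℚ.* ½ ^ℚ odd l) * g j i) l
      ≈⟨ ∑₊-cong l (λ { j i refl → pointwise λ t →
           e (γ r) (½ ^ℚ odd (j ℕ.+ i)) (binom (fromℕ (odd (j ℕ.+ i))) j ℚ.* c ^ℚ j) (seq (u ^ odd i + d ^ odd i) t) }) ⟩
    ∑₊ (λ j i → f r j i) l ∎
    where
    g : ℕ → ℕ → ℝ
    g j i = ι (binom (fromℕ (odd l)) j ℚ.* c ^ℚ j) * (u ^ odd i + d ^ odd i)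
  collect : ∀ m i → ∑₊ (λ r j → f r j i) m ≃ ι (regroup c γ m i) * (u ^ odd i + d ^ odd i)
  collect m i = begin
    ∑₊ (λ r j → ι (κ r j i) * x) m   ≈⟨ ∑₊-cong m (λ r j _ → ℝR.*-comm (ι (κ r j i)) x) ⟩
    ∑₊ (λ r j → x * ι (κ r j i)) m   ≈⟨ *-∑₊ x (λ r j → ι (κ r j i)) m ⟨
    x * ∑₊ (λ r j → ι (κ r j i)) m   ≈⟨ *-cong (≃-refl {x}) (ι-∑₊ (λ r j → κ r j i) m) ⟩
    x * ι (regroup c γ m i)          ≈⟨ ℝR.*-comm x (ι (regroup c γ m i)) ⟩
    ι (regroup c γ m i) * x          ∎
    where x = u ^ odd i + d ^ odd i

∑ℝ≃∑₊ : ∀ n f → ∑ℝ (suc n) f ≃ ∑₊ (λ i _ → f i) n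
∑ℝ≃∑₊ zero    f = ℝR.+-identityʳ (f 0)
∑ℝ≃∑₊ (suc n) f = +-cong (≃-refl {f 0}) (∑ℝ≃∑₊ n (λ i → f (suc i)))

square-power : ∀ {x q} → x * x ≃ ι q → ∀ l → ι (q ^ℚ l) ≃ x ^ (l ℕ.* 2)
square-power         x²≃q zero    = ≃-refl
square-power {x} {q} x²≃q (suc l) = ≃-trans (ι-* q (q ^ℚ l))
  (≃-trans (*-cong (≃-sym x²≃q) (square-power x²≃q l)) (ℝR.*-assoc x x (x ^ (l ℕ.* 2))))

neg-odd : ∀ x i → (- x) ^ odd i ≃ - (x ^ odd i)
neg-odd x zero    = pointwise λ t → e (seq x t)
  where
  e : ∀ x → ℚ.- x ℚ.* 1ℚ ≡ ℚ.- (x ℚ.* 1ℚ)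
  e x = solve (x ∷ []) ℚ-acr
neg-odd x (suc i) = ≃-trans
  (*-cong (≃-refl { - x}) (*-cong (≃-refl { - x}) (neg-odd x i)))
  (pointwise λ t → e (seq x t) (seq (x ^ odd i) t))
  where
  e : ∀ x y → ℚ.- x ℚ.* (ℚ.- x ℚ.* ℚ.- y) ≡ ℚ.- (x ℚ.* (x ℚ.* y))
  e x y = solve (x ∷ y ∷ []) ℚ-acr

-- The increment of √n P(n).

module _ (g : ℕ) where
  private
    k = odd g
    h = suc g
    α = fromℕ h ℚ.+ ½
    v = 1/[ k /2]+1
    s : ℕ → ℚ
    s m = ½ ^ℚ odd h ℚ.* S m α

  -- `Q` at √n is α √n P(n), written as an odd polynomial in √n; `Q₀` omits the signs of P.
  Q Q₀ : ℝ → ℝ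
  Q x  = ∑₊ (λ r l → ι (sgn r ℚ.* β α r) * x ^ odd l) h
  Q₀ x = ∑₊ (λ r l → ι (β α r) * x ^ odd l) h

  √-P : ∀ N → √ N * ι (P k (fromℕ N)) ≃ ι v * Q (√ N)
  √-P N = begin
    x * ι (P k (fromℕ N))
      ≈⟨ *-cong (≃-refl {x}) (≃-trans (ι-cong (P≡∑₊ g (fromℕ N)))
           (≃-trans (ι-* v (∑ℚ₊.∑₊ f h)) (*-cong (≃-refl {ι v}) (≃-sym (ι-∑₊ f h))))) ⟩
    x * (ι v * ∑₊ (λ r l → ι (f r l)) h)
      ≈⟨ pointwise (λ t → e₁ (seq x t) v (seq (∑₊ (λ r l → ι (f r l)) h) t)) ⟩
    ι v * (x * ∑₊ (λ r l → ι (f r l)) h)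
      ≈⟨ *-cong (≃-refl {ι v}) (≃-trans (*-∑₊ x (λ r l → ι (f r l)) h) (∑₊-cong h λ r l _ → term r l)) ⟩
    ι v * Q x ∎
    where
    open import Relation.Binary.Reasoning.Setoid ℝR.setoid
    x = √ N
    f : ℕ → ℕ → ℚ
    f r l = sgn r ℚ.* β α r ℚ.* fromℕ N ^ℚ l
    e₁ : ∀ a b c → a ℚ.* (b ℚ.* c) ≡ b ℚ.* (a ℚ.* c)
    e₁ a b c = solve (a ∷ b ∷ c ∷ []) ℚ-acr
    term : ∀ r l → x * ι (f r l) ≃ ι (sgn r ℚ.* β α r) * x ^ odd l
    term r l = ≃-trans (pointwise λ t → e₁ (seq x t) (sgn r ℚ.* β α r) (fromℕ N ^ℚ l))
      (*-cong (≃-refl {ι (sgn r ℚ.* β α r)}) (*-cong (≃-refl {x}) (square-power (√*√ N) l)))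

  -- The signs matter at r = 1 only, where l = h - 1 = g and `odd g` is k. The prefactor 1/α of P
  -- later turns this term into the new summand.
  Q≃Q₀ : ∀ x → Q x ≃ Q₀ x + ι α * x ^ k
  Q≃Q₀ x = begin
    Q x
      ≈⟨ ∑₊-cong h (λ r l _ → ≃-trans
           (*-cong (≃-trans (ι-cong (sgn-β α r)) (ι-+ (β α r) (bump α r))) (≃-refl {x ^ odd l}))
           (ℝR.distribʳ (x ^ odd l) (ι (β α r)) (ι (bump α r)))) ⟩
    ∑₊ (λ r l → ι (β α r) * x ^ odd l + ι (bump α r) * x ^ odd l) h
      ≈⟨ ∑₊-+ (λ r l → ι (β α r) * x ^ odd l) (λ r l → ι (bump α r) * x ^ odd l) h ⟩
    Q₀ x + (ι 0ℚ * x ^ odd h + ∑₊ (λ r l → ι (α ℚ.* one r) * x ^ odd l) g)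
      ≈⟨ +-cong (≃-refl {Q₀ x}) (≃-trans (+-cong (ℝR.zeroˡ (x ^ odd h)) (only g (λ l → x ^ odd l)))
           (ℝR.+-identityˡ (ι α * x ^ k))) ⟩
    Q₀ x + ι α * x ^ k ∎
    where
    open import Relation.Binary.Reasoning.Setoid ℝR.setoid
    only : ∀ n y → ∑₊ (λ r l → ι (α ℚ.* one r) * y l) n ≃ ι α * y n
    only zero    y = *-cong (ι-cong (ℚₚ.*-identityʳ α)) (≃-refl {y 0})
    only (suc n) y = ≃-trans (+-cong (*-cong (ι-cong (ℚₚ.*-identityʳ α)) (≃-refl {y (suc n)}))
        (≃-trans (∑₊-cong n (λ r l _ → *-cong (ι-cong (ℚₚ.*-zeroʳ α)) (≃-refl {y l})))
          (≃-trans (≃-sym (*-∑₊ 0ℝ (λ _ l → y l) n)) (ℝR.zeroˡ (∑₊ (λ _ l → y l) n)))))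
      (ℝR.+-identityʳ (ι α * y (suc n)))

  module _ (a : ℕ) where
    private
      x y d u : ℝ
      x = √ a
      y = √ (suc a)
      d = δ a
      u = √+√ a

      u*d≃1 : u * d ≃ ι 1ℚ
      u*d≃1 = *-recip u (0<√+√ a)

      u*-d≃-1 : u * (- d) ≃ ι (ℚ.- 1ℚ)
      u*-d≃-1 = ≃-trans (pointwise λ t → e (seq u t) (seq d t))
        (≃-trans (-‿cong u*d≃1) (pointwise λ _ → refl))
        where
        e : ∀ u d → u ℚ.* ℚ.- d ≡ ℚ.- (u ℚ.* d)
        e u d = solve (u ∷ d ∷ []) ℚ-acr

      y≃ : y ≃ ι ½ * (u + d)
      y≃ = ≃-sym (≃-trans (*-cong (≃-refl {ι ½}) (+-cong (≃-refl {u}) (δ≃Δ√ a)))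
        (pointwise λ t → e (seq x t) (seq y t)))
        where
        e : ∀ x y → ½ ℚ.* ((x ℚ.+ y) ℚ.+ (y ℚ.- x)) ≡ y
        e x y = solve (x ∷ y ∷ []) ℚ-acr

      x≃ : x ≃ ι ½ * (u + (- d))
      x≃ = ≃-sym (≃-trans (*-cong (≃-refl {ι ½}) (+-cong (≃-refl {u}) (-‿cong (δ≃Δ√ a))))
        (pointwise λ t → e (seq x t) (seq y t)))
        where
        e : ∀ x y → ½ ℚ.* ((x ℚ.+ y) ℚ.- (y ℚ.- x)) ≡ x
        e x y = solve (x ∷ y ∷ []) ℚ-acr

      Δ E : ℝ
      Δ = ∑₊ (λ m i → ι (s m) * (d ^ odd i + d ^ odd i)) h
      E = ∑₊ (λ j _ → ι (A k (3 ℕ.+ 2 ℕ.* j)) * d ^ (3 ℕ.+ 2 ℕ.* j)) g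

    Q₀-y : Q₀ y ≃ ∑₊ (λ m i → ι (s m) * (u ^ odd i + d ^ odd i)) h
    Q₀-y = ≃-trans
      -- A trivial factor `1 ^ r` brings the weights into the form required by `regroup-S` at c = 1.
      (∑₊-cong h λ r l _ → *-cong
        (ι-cong (sym (trans (cong (ℚ._* β α r) (1^ r)) (ℚₚ.*-identityˡ (β α r))))) (^-congˡ (odd l) y≃))
      (≃-trans (odd-power-sum u d 1ℚ (λ r → 1ℚ ^ℚ r ℚ.* β α r) u*d≃1 h)
        (∑₊-cong h λ m i m+i≡h → *-cong
          (ι-cong (trans (regroup-S 1ℚ h m i m+i≡h) (trans (cong (ℚ._* s m) (1^ m)) (ℚₚ.*-identityˡ (s m)))))
          (≃-refl {u ^ odd i + d ^ odd i})))

    -- The signs of `Q` are powers of c = u (-d) = -1, so `regroup-S` produces (-1)^m, which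
    -- `S-even` absorbs. The coefficients thus agree with those of `Q₀-y`.
    Q-x : Q x ≃ ∑₊ (λ m i → ι (s m) * (u ^ odd i - d ^ odd i)) h
    Q-x = ≃-trans
      (∑₊-cong h λ r l _ → *-cong (≃-refl {ι (sgn r ℚ.* β α r)}) (^-congˡ (odd l) x≃))
      (≃-trans (odd-power-sum u (- d) (ℚ.- 1ℚ) (λ r → sgn r ℚ.* β α r) u*-d≃-1 h)
        (∑₊-cong h λ m i m+i≡h → *-cong
          (ι-cong (trans (regroup-S (ℚ.- 1ℚ) h m i m+i≡h) (trans (e (sgn m) (½ ^ℚ odd h) (S m α))
            (cong (½ ^ℚ odd h ℚ.*_) (S-even m α)))))
          (+-cong (≃-refl {u ^ odd i}) (neg-odd d i))))
      where
      e : ∀ a b c → a ℚ.* (b ℚ.* c) ≡ b ℚ.* (a ℚ.* c)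
      e a b c = solve (a ∷ b ∷ c ∷ []) ℚ-acr

    Q₀-y≃Q-x : Q₀ y ≃ Q x + Δ
    Q₀-y≃Q-x = ≃-trans Q₀-y (≃-trans
      (∑₊-cong {f = λ m i → ι (s m) * (u ^ odd i + d ^ odd i)} {g = λ m i → f m i + f′ m i} h λ m i _ →
        pointwise λ t → e (s m) (seq (u ^ odd i) t) (seq (d ^ odd i) t))
      (≃-trans (∑₊-+ f f′ h) (+-cong (≃-sym Q-x) (≃-refl {Δ}))))
      where
      f f′ : ℕ → ℕ → ℝ
      f m i  = ι (s m) * (u ^ odd i - d ^ odd i)
      f′ m i = ι (s m) * (d ^ odd i + d ^ odd i)
      e : ∀ s u d → s ℚ.* (u ℚ.+ d) ≡ s ℚ.* (u ℚ.- d) ℚ.+ s ℚ.* (d ℚ.+ d)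
      e s u d = solve (s ∷ u ∷ d ∷ []) ℚ-acr

    -- The term i = 0 belongs to m = h and vanishes by `S-middle`. This disposes of the exponent 1,
    -- for which `τ` is not defined; the terms i = j + 1 have the exponents 3 + 2j.
    v*Δ≃E : ι v * Δ ≃ E
    v*Δ≃E = begin
      ι v * Δ
        ≈⟨ *-cong (≃-refl {ι v}) (∑₊-flip (λ m i → ι (s m) * D i) h) ⟩
      ι v * (ι (s h) * D 0 + ∑₊ (λ j m → ι (s m) * D (suc j)) g)
        ≈⟨ *-cong (≃-refl {ι v}) (≃-trans (+-cong
             (≃-trans (*-cong (ι-cong (trans (cong (½ ^ℚ odd h ℚ.*_) (S-middle g)) (ℚₚ.*-zeroʳ (½ ^ℚ odd h)))) (≃-refl {D 0}))
               (ℝR.zeroˡ (D 0)))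
             (≃-refl {∑₊ (λ j m → ι (s m) * D (suc j)) g}))
             (ℝR.+-identityˡ (∑₊ (λ j m → ι (s m) * D (suc j)) g))) ⟩
      ι v * ∑₊ (λ j m → ι (s m) * D (suc j)) g
        ≈⟨ *-∑₊ (ι v) (λ j m → ι (s m) * D (suc j)) g ⟩
      ∑₊ (λ j m → ι v * (ι (s m) * D (suc j))) g
        ≈⟨ ∑₊-cong g term ⟩
      E ∎
      where
      open import Relation.Binary.Reasoning.Setoid ℝR.setoid
      D : ℕ → ℝ
      D i = d ^ odd i + d ^ odd i
      e : ∀ v s x → v ℚ.* (s ℚ.* (x ℚ.+ x)) ≡ v ℚ.* (2ℚ ℚ.* s) ℚ.* x
      e v s x = solve (v ∷ s ∷ x ∷ []) ℚ-acr
      A≡ : ∀ j m → j ℕ.+ m ≡ g → A k (3 ℕ.+ 2 ℕ.* j) ≡ v ℚ.* (2ℚ ℚ.* s m)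
      A≡ j m refl = A≡S j m
      term : ∀ j m → j ℕ.+ m ≡ g →
        ι v * (ι (s m) * D (suc j)) ≃ ι (A k (3 ℕ.+ 2 ℕ.* j)) * d ^ (3 ℕ.+ 2 ℕ.* j)
      term j m j+m≡g = ≃-trans (pointwise λ t → e v (s m) (seq (d ^ odd (suc j)) t))
        (*-cong (ι-cong (sym (A≡ j m j+m≡g))) (ℝR.reflexive (cong (λ n → d ^ (3 ℕ.+ n)) (ℕₚ.*-comm j 2))))

    √P-step : y * ι (P k (fromℕ (suc a))) ≃ (x * ι (P k (fromℕ a)) + E) + y ^ k
    √P-step = begin
      y * ι (P k (fromℕ (suc a)))                ≈⟨ √-P (suc a) ⟩
      ι v * Q y                                  ≈⟨ *-cong (≃-refl {ι v}) (≃-trans (Q≃Q₀ y)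
                                                      (+-cong Q₀-y≃Q-x (≃-refl {ι α * y ^ k}))) ⟩
      ι v * ((Q x + Δ) + ι α * y ^ k)            ≈⟨ pointwise (λ t → e v (seq (Q x) t) (seq Δ t) α (seq (y ^ k) t)) ⟩
      (ι v * Q x + ι v * Δ) + ι (v ℚ.* α) * y ^ k
        ≈⟨ +-cong (+-cong (≃-sym (√-P a)) v*Δ≃E)
             (≃-trans (*-cong (ι-cong (1/[/2]+1-inverse g)) (≃-refl {y ^ k})) (ℝR.*-identityˡ (y ^ k))) ⟩
      (x * ι (P k (fromℕ a)) + E) + y ^ k        ∎
      where
      open import Relation.Binary.Reasoning.Setoid ℝR.setoid
      e : ∀ v q d α z → v ℚ.* ((q ℚ.+ d) ℚ.+ α ℚ.* z) ≡ (v ℚ.* q ℚ.+ v ℚ.* d) ℚ.+ v ℚ.* α ℚ.* z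
      e v q d α z = solve (v ∷ q ∷ d ∷ α ∷ z ∷ []) ℚ-acr

-- The increment of τ.

-- A single index K beyond both thresholds suffices: the triangle inequality through `xs (suc K)`
-- and `c + ys K` costs ε/2 + ε/4 + ε/4.
⟶-shift : ∀ {xs ys c x y} → (∀ N → xs (suc N) ≃ c + ys N) → xs ⟶ x → ys ⟶ y → x ≃ c + y
⟶-shift {xs} {ys} {c} {x} {y} eq xs⟶x ys⟶y = mk≃ λ ε 0<ε →
  let η = ½ ℚ.* (½ ℚ.* ε)
      0<η = 0<½* (0<½* 0<ε)
      N , p = xs⟶x (½ ℚ.* ε) (0<½* 0<ε)
      M , q = ys⟶y η 0<η
      K = N ℕ.⊔ M
  in ev-map₃ (λ t a b d → triangle½ (seq x t) (seq (xs (suc K)) t) (seq (c + y) t) ε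
         (subst (ℚ._< ½ ℚ.* ε) (dist-sym (seq (xs (suc K)) t) (seq x t)) a)
         (triangle½ (seq (xs (suc K)) t) (seq (c + ys K) t) (seq (c + y) t) (½ ℚ.* ε) b
           (subst (λ z → ℚ.∣ z ∣ ℚ.< η) (e (seq c t) (seq (ys K) t) (seq y t)) d)))
       (∣x∣<ι⁻¹ {xs (suc K) - x} (p (suc K) (ℕₚ.m≤n⇒m≤1+n (ℕₚ.m≤m⊔n N M))))
       (close (eq K) η 0<η)
       (∣x∣<ι⁻¹ {ys K - y} (q K (ℕₚ.m≤n⊔m N M)))
  where
  e : ∀ c a b → a ℚ.- b ≡ (c ℚ.+ a) ℚ.- (c ℚ.+ b)
  e c a b = solve (c ∷ a ∷ b ∷ []) ℚ-acr

∑ℝ-cong : ∀ n {f g} → (∀ i → f i ≃ g i) → ∑ℝ n f ≃ ∑ℝ n g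
∑ℝ-cong zero    f≃g = ≃-refl
∑ℝ-cong (suc n) f≃g = +-cong (f≃g 0) (∑ℝ-cong n (λ i → f≃g (suc i)))

∑ℝ-shift : ∀ n f g {c} → f 0 ≃ c → (∀ i → f (suc i) ≃ g i) → ∑ℝ (suc n) f ≃ c + ∑ℝ n g
∑ℝ-shift n f g f0≃c f≃g = +-cong f0≃c (∑ℝ-cong n f≃g)

δ^-cong : ∀ {a b} m → a ≡ b → δ a ^ m ≃ δ b ^ m
δ^-cong m refl = ≃-refl

τ-term-suc : ∀ n m ν → τ-term n m (suc ν) ≃ τ-term (suc n) m ν
τ-term-suc n m ν = ≃-trans {y = δ (n ℕ.+ suc ν) ^ m} (τ-term≃δ^ n m (suc ν))
  (≃-trans {y = δ (suc n ℕ.+ ν) ^ m} (δ^-cong m (ℕₚ.+-suc n ν))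
    (≃-sym {τ-term (suc n) m ν} {δ (suc n ℕ.+ ν) ^ m} (τ-term≃δ^ (suc n) m ν)))

-- Removing the term ν = 0 from a partial sum for n leaves the partial sum for n + 1 with one term
-- fewer.
τ-step : ∀ n m 3≤m → τ n m 3≤m ≃ δ n ^ m + τ (suc n) m 3≤m
τ-step n m 3≤m = ⟶-shift
  {λ N → ∑ℝ N (τ-term n m)} {λ N → ∑ℝ N (τ-term (suc n) m)} {δ n ^ m} {τ n m 3≤m} {τ (suc n) m 3≤m}
  (λ N → ∑ℝ-shift N (τ-term n m) (τ-term (suc n) m)
    (≃-trans {y = δ (n ℕ.+ 0) ^ m} (τ-term≃δ^ n m 0) (δ^-cong m (ℕₚ.+-identityʳ n)))
    (τ-term-suc n m))
  (τ-converges n m 3≤m) (τ-converges (suc n) m 3≤m)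

-- The value at n = 1 and the induction on n.

-- For x = `√ 1`, x + 1 is at least 1 and hence invertible, and x - 1 = (x² - 1)/(x + 1) vanishes.
√1≃1 : √ 1 ≃ 1ℝ
√1≃1 = begin
  x                            ≈⟨ pointwise (λ t → e₁ (seq x t)) ⟩
  (x - 1ℝ) * 1ℝ + 1ℝ           ≈⟨ +-cong (*-cong (≃-refl {x - 1ℝ}) (*-recip (x + 1ℝ) 0<x+1)) (≃-refl {1ℝ}) ⟨
  (x - 1ℝ) * ((x + 1ℝ) * r) + 1ℝ
    ≈⟨ pointwise (λ t → e₂ (seq x t) (seq r t)) ⟩
  (x * x - 1ℝ) * r + 1ℝ
    ≈⟨ +-cong (*-cong (≃-trans (+-cong (√*√ 1) (≃-refl { - 1ℝ})) (ℝR.-‿inverseʳ 1ℝ)) (≃-refl {r})) (≃-refl {1ℝ}) ⟩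
  0ℝ * r + 1ℝ                  ≈⟨ +-cong (ℝR.zeroˡ r) (≃-refl {1ℝ}) ⟩
  0ℝ + 1ℝ                      ≈⟨ ℝR.+-identityˡ 1ℝ ⟩
  1ℝ                           ∎
  where
  open import Relation.Binary.Reasoning.Setoid ℝR.setoid
  x = √ 1
  0<x+1 : 0ℝ < x + 1ℝ
  0<x+1 = <-≤-trans (ι-mono-< 0<1) (≤-resp (ℝR.+-identityˡ 1ℝ) ≃-refl (+-mono-≤ (0≤√ 1) (≤-refl {1ℝ})))
  r = recip (x + 1ℝ) 0<x+1
  e₁ : ∀ x → x ≡ (x ℚ.- 1ℚ) ℚ.* 1ℚ ℚ.+ 1ℚ
  e₁ x = solve (x ∷ []) ℚ-acr
  e₂ : ∀ x r → (x ℚ.- 1ℚ) ℚ.* ((x ℚ.+ 1ℚ) ℚ.* r) ℚ.+ 1ℚ ≡ (x ℚ.* x ℚ.- 1ℚ) ℚ.* r ℚ.+ 1ℚ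
  e₂ x r = solve (x ∷ r ∷ []) ℚ-acr

√1^ : ∀ k → 1 ^[ k /2] ≃ 1ℝ
√1^ zero    = ≃-refl
√1^ (suc n) = ≃-trans (*-cong √1≃1 (√1^ n)) (ℝR.*-identityˡ 1ℝ)

∑Aτ-step : ∀ g n → ∑Aτ (odd g) n ≃
  ∑₊ (λ j _ → ι (A (odd g) (3 ℕ.+ 2 ℕ.* j)) * δ n ^ (3 ℕ.+ 2 ℕ.* j)) g + ∑Aτ (odd g) (suc n)
∑Aτ-step g n = begin
  ∑Aτ k n
    ≈⟨ as-∑₊ n ⟩
  ∑₊ (λ j _ → a j * tail n j) g
    ≈⟨ ∑₊-cong g (λ j _ _ → ≃-trans
         (*-cong (≃-refl {a j}) (τ-step n (3 ℕ.+ 2 ℕ.* j) (ℕₚ.m≤m+n 3 (2 ℕ.* j))))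
         (ℝR.distribˡ (a j) (δ n ^ (3 ℕ.+ 2 ℕ.* j)) (tail (suc n) j))) ⟩
  ∑₊ (λ j _ → a j * δ n ^ (3 ℕ.+ 2 ℕ.* j) + a j * tail (suc n) j) g
    ≈⟨ ∑₊-+ (λ j _ → a j * δ n ^ (3 ℕ.+ 2 ℕ.* j)) (λ j _ → a j * tail (suc n) j) g ⟩
  ∑₊ (λ j _ → a j * δ n ^ (3 ℕ.+ 2 ℕ.* j)) g + ∑₊ (λ j _ → a j * tail (suc n) j) g
    ≈⟨ +-cong (≃-refl {∑₊ (λ j _ → a j * δ n ^ (3 ℕ.+ 2 ℕ.* j)) g}) (≃-sym (as-∑₊ (suc n))) ⟩
  ∑₊ (λ j _ → a j * δ n ^ (3 ℕ.+ 2 ℕ.* j)) g + ∑Aτ k (suc n) ∎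
  where
  open import Relation.Binary.Reasoning.Setoid ℝR.setoid
  k = odd g
  a : ℕ → ℝ
  a j = ι (A k (3 ℕ.+ 2 ℕ.* j))
  tail : ℕ → ℕ → ℝ
  tail n j = τ n (3 ℕ.+ 2 ℕ.* j) (ℕₚ.m≤m+n 3 (2 ℕ.* j))
  as-∑₊ : ∀ n → ∑Aτ k n ≃ ∑₊ (λ j _ → a j * tail n j) g
  as-∑₊ n = ≃-trans (ℝR.reflexive (cong (λ m → ∑ℝ m (λ j → a j * tail n j)) ([odd+1]/2 g)))
    (∑ℝ≃∑₊ g (λ j → a j * tail n j))

formula-step : ∀ g n → let k = odd g in
  C k + √ (suc n) * ι (P k (fromℕ (suc n))) + ∑Aτ k (suc n)
    ≃ (C k + √ n * ι (P k (fromℕ n)) + ∑Aτ k n) + suc n ^[ k /2]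
formula-step g n = begin
  c + b + t                  ≈⟨ +-cong (+-cong (≃-refl {c}) (√P-step g n)) (≃-refl {t}) ⟩
  c + ((a + E) + y) + t      ≈⟨ pointwise (λ i → e (seq c i) (seq a i) (seq E i) (seq y i) (seq t i)) ⟩
  (c + a + (E + t)) + y      ≈⟨ +-cong (+-cong (≃-refl {c + a}) (≃-sym (∑Aτ-step g n))) (≃-refl {y}) ⟩
  c + a + ∑Aτ k n + y        ∎
  where
  open import Relation.Binary.Reasoning.Setoid ℝR.setoid
  k = odd g
  c = C k
  a = √ n * ι (P k (fromℕ n))
  b = √ (suc n) * ι (P k (fromℕ (suc n)))
  t = ∑Aτ k (suc n)
  y = √ (suc n) ^ k
  E = ∑₊ (λ j _ → ι (A k (3 ℕ.+ 2 ℕ.* j)) * δ n ^ (3 ℕ.+ 2 ℕ.* j)) g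
  e : ∀ c a E y t → c ℚ.+ ((a ℚ.+ E) ℚ.+ y) ℚ.+ t ≡ (c ℚ.+ a ℚ.+ (E ℚ.+ t)) ℚ.+ y
  e c a E y t = solve (c ∷ a ∷ E ∷ y ∷ t ∷ []) ℚ-acr

formula-1 : ∀ k → C k + √ 1 * ι (P k (fromℕ 1)) + ∑Aτ k 1 ≃ 1ℝ
formula-1 k = ≃-trans
  (+-cong (+-cong (≃-refl {C k}) (≃-trans (*-cong √1≃1 (≃-refl {p})) (ℝR.*-identityˡ p))) (≃-refl {t}))
  (pointwise λ i → e (P k 1ℚ) (seq t i))
  where
  p = ι (P k (fromℕ 1))
  t = ∑Aτ k 1
  e : ∀ p t → 1ℚ ℚ.- p ℚ.- t ℚ.+ p ℚ.+ t ≡ 1ℚ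
  e p t = solve (p ∷ t ∷ []) ℚ-acr

-- The constant C is fixed by the value at n = 1. The start of the induction is recovered by running
-- the step from 0 to 1 backwards, which gives f 0 = f 1 - y 1 = 0.
∑ℝ-unique : ∀ (f y : ℕ → ℝ) → (∀ n → f (suc n) ≃ f n + y (suc n)) → f 1 ≃ 1ℝ → y 1 ≃ 1ℝ →
  ∀ n → ∑ℝ n (λ i → y (suc i)) ≃ f n
∑ℝ-unique f y step f1≃1 y1≃1 zero = begin
  0ℝ               ≈⟨ ℝR.-‿inverseʳ 1ℝ ⟨
  1ℝ - 1ℝ          ≈⟨ +-cong (≃-trans (≃-sym (step 0)) f1≃1) (-‿cong y1≃1) ⟨
  (f 0 + y 1) - y 1 ≈⟨ pointwise (λ i → e (seq (f 0) i) (seq (y 1) i)) ⟩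
  f 0              ∎
  where
  open import Relation.Binary.Reasoning.Setoid ℝR.setoid
  e : ∀ x y → (x ℚ.+ y) ℚ.- y ≡ x
  e x y = solve (x ∷ y ∷ []) ℚ-acr
∑ℝ-unique f y step f1≃1 y1≃1 (suc n) = ≃-trans (∑ℝ-last n (λ i → y (suc i)))
  (≃-trans (+-cong (∑ℝ-unique f y step f1≃1 y1≃1 n) (≃-refl {y (suc n)})) (≃-sym (step n)))

even⊎odd : ∀ k → 2 ∣ k ⊎ ∃[ g ] k ≡ odd g
even⊎odd zero          = inj₁ (divides 0 refl)
even⊎odd (suc zero)    = inj₂ (0 , refl)
even⊎odd (suc (suc k)) with even⊎odd k
... | inj₁ (divides q refl) = inj₁ (divides (suc q) refl)
... | inj₂ (g , refl)       = inj₂ (suc g , refl)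

¬even⇒odd : ∀ k → ¬ (2 ∣ k) → ∃[ g ] k ≡ odd g
¬even⇒odd k 2∤k with even⊎odd k
... | inj₁ 2∣k = ⊥-elim (2∤k 2∣k)
... | inj₂ k≡  = k≡

sum-formula : ∀ {k} g → k ≡ odd g → ∀ n →
  ∑ℝ[ i < n ] (suc i ^[ k /2]) ≃ C k + √ n * ι (P k (fromℕ n)) + ∑Aτ k n
sum-formula {k} g refl = ∑ℝ-unique (λ n → C k + √ n * ι (P k (fromℕ n)) + ∑Aτ k n) (_^[ k /2])
  (formula-step g) (formula-1 k) (√1^ k)

theorem1 : ∀ (k : ℕ) → ¬ (2 ∣ k) → ∀ (n : ℕ) →
    ∑ℝ[ i < n ] (suc i ^[ k /2]) ≃ C k + √ n * ι (P k (fromℕ n)) + ∑Aτ k n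
theorem1 k 2∤k = sum-formula {k} (proj₁ k-odd) (proj₂ k-odd)
  where k-odd = ¬even⇒odd k 2∤k
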